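{- Let $K$ be a differential-henselian $H$-asymptotic field with exponential integration and max $0$ whose value group is divisible. Then $K$ has no proper differentially algebraic $H$-asymptotic (valued differential field) extension $L$ with max $0$ and residue field $\boldsymbol k_L=\boldsymbol k$.
   Context: All fields have characteristic $0$. A valued differential field is a field $K$ with a nontrivial derivation $\partial$ (write $f'=\partial f$, $f^\dagger=f'/f$) and a nontrivial surjective valuation $v\colon K^\times\to\Gamma$, $v(0)=\infty$; $f\preccurlyeq g$ iff $v(f)\geqslant v(g)$, $f\prec g$ iff $v(f)>v(g)$, $f\asymp g$ iff $v(f)=v(g)$. $\mathcal O=\{f\preccurlyeq1\}$, $\mathfrak o=\{f\prec1\}$, residue field $\boldsymbol k=\mathcal O/\mathfrak o$. Small derivation: $\partial\mathfrak o\subseteq\mathfrak o$. $K$ is asymptotic if for all nonzero $f,g\in\mathfrak o$: $f\prec g\iff f'\prec g'$; $H$-asymptotic if moreover $f^\dagger\succcurlyeq g^\dagger$ whenever $f,g\neq0$ and $f\preccurlyeq g\prec1$. For asymptotic $K$ and $g\in K^\times$ with $g\not\asymp1$, $v(g^\dagger)$ depends only on $vg$, giving $\psi\colon\Gamma\setminus\{0\}\to\Gamma$; set $\Psi=\psi(\Gamma\setminus\{0\})$. $K$ has max $0$ if $\max\Psi=0$. Exponential integration: every $f\in K$ is $z^\dagger$ for some $z\in K^\times$. A differential field $F$ is linearly surjective if every $a_0y+\dots+a_ry^{(r)}=b$ ($a_i,b\in F$, $a_r\neq0$) has a solution in $F$. For $P\in K\{Y\}$, $v(P)$ is the minimum valuation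 of its coefficients, $P_d$ its degree-$d$ homogeneous part. $K$ is differential-henselian if it has small derivation, $\boldsymbol k$ (with induced derivation) is linearly surjective, and every $P\in\mathcal O\{Y\}$ with $P_0\prec1$, $P_1\asymp1$ has a zero $y\prec1$ in $K$. Differentially algebraic extension: each element satisfies a nonzero differential polynomial over $K$. -}

module Defs where

open import Level using (Level; _⊔_; Lift) renaming (suc to lsuc)
open import Algebra.Bundles using (AbelianGroup; CommutativeRing)
open import Relation.Binary.Structures using (IsTotalOrder)
open import Relation.Nullary using (¬_)
open import Data.Empty using (⊥)
open import Data.Unit using (⊤)
open import Data.Nat using (ℕ; zero; suc) renaming (_+_ to _+ℕ_)
open import Data.Fin using (Fin; toℕ; fromℕ) renaming (zero to fzero; suc to fsuc)
open import Data.Vec using (Vec; []; _∷_)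
open import Data.Product using (Σ; ∃; _×_; _,_)
open import Data.Sum using (_⊎_)
open import Function using (_∘_; _⇔_)
open import Relation.Binary.PropositionalEquality using (_≡_)

record OrderedAbelianGroup (g gℓ : Level) : Set (lsuc (g ⊔ gℓ)) where
  field
    abGroup : AbelianGroup g gℓ
  open AbelianGroup abGroup public
  field
    _≤_          : Carrier → Carrier → Set gℓ
    isTotalOrder : IsTotalOrder _≈_ _≤_
    ≤-compat     : ∀ {x y} z → x ≤ y → (x ∙ z) ≤ (y ∙ z)

  ⊥' : Set gℓ
  ⊥' = Lift gℓ ⊥
  ⊤' : Set gℓ
  ⊤' = Lift gℓ ⊤

  _·_ : ℕ → Carrier → Carrier
  zero  · x = ε
  suc n · x = x ∙ (n · x)

  data Γ∞ : Set g where
    fin : Carrier → Γ∞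
    ∞   : Γ∞

  _≈∞_ : Γ∞ → Γ∞ → Set gℓ
  fin a ≈∞ fin b = a ≈ b
  fin a ≈∞ ∞     = ⊥'
  ∞     ≈∞ fin b = ⊥'
  ∞     ≈∞ ∞     = ⊤'

  _≤∞_ : Γ∞ → Γ∞ → Set gℓ
  fin a ≤∞ fin b = a ≤ b
  ∞     ≤∞ fin b = ⊥'
  _     ≤∞ ∞     = ⊤'

  _+∞_ : Γ∞ → Γ∞ → Γ∞
  fin a +∞ fin b = fin (a ∙ b)
  fin a +∞ ∞     = ∞
  ∞     +∞ _     = ∞

natCast : ∀ {c ℓ} (R : CommutativeRing c ℓ) → ℕ → CommutativeRing.Carrier R
natCast R zero    = CommutativeRing.0# R
natCast R (suc n) = CommutativeRing._+_ R (CommutativeRing.1# R) (natCast R n)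

record ValuedDifferentialField (c ℓ g gℓ : Level) : Set (lsuc (c ⊔ ℓ ⊔ g ⊔ gℓ)) where
  field
    cring : CommutativeRing c ℓ
  open CommutativeRing cring public
  field
    -- field axioms (multiplicative inverse; 0⁻¹ is junk)
    _⁻¹      : Carrier → Carrier
    1≉0      : ¬ (1# ≈ 0#)
    inverseʳ : ∀ x → ¬ (x ≈ 0#) → (x * (x ⁻¹)) ≈ 1#
    ⁻¹-cong  : ∀ {x y} → x ≈ y → (x ⁻¹) ≈ (y ⁻¹)
    char0    : ∀ n → ¬ (natCast cring (suc n) ≈ 0#)
    ∂        : Carrier → Carrier
    ∂-cong   : ∀ {x y} → x ≈ y → ∂ x ≈ ∂ y
    ∂-+      : ∀ x y → ∂ (x + y) ≈ (∂ x + ∂ y)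
    ∂-*      : ∀ x y → ∂ (x * y) ≈ ((∂ x * y) + (x * ∂ y))
    ∂-nontrivial : ∃ λ x → ¬ (∂ x ≈ 0#)
    Γ        : OrderedAbelianGroup g gℓ
  open OrderedAbelianGroup Γ public
    using (Γ∞; fin; ∞; _≈∞_; _≤∞_; _+∞_; _·_)
    renaming (Carrier to ΓCarrier; _≈_ to _≈Γ_; ε to 0Γ; _≤_ to _≤Γ_)
  field
    v        : Carrier → Γ∞
    v-cong   : ∀ {x y} → x ≈ y → v x ≈∞ v y
    v-∞      : ∀ x → (v x ≈∞ ∞) ⇔ (x ≈ 0#)
    v-*      : ∀ x y → v (x * y) ≈∞ (v x +∞ v y)
    v-+      : ∀ x y → (v x ≤∞ v (x + y)) ⊎ (v y ≤∞ v (x + y))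
    v-surj   : ∀ γ → ∃ λ x → v x ≈∞ fin γ
    v-nontrivial : ∃ λ x → ¬ (x ≈ 0#) × ¬ (v x ≈∞ fin 0Γ)

  infix 4 _≼_ _≍_ _≺_
  infix 9 _†
  _≼_ : Carrier → Carrier → Set gℓ
  f ≼ g = v g ≤∞ v f
  _≍_ : Carrier → Carrier → Set gℓ
  f ≍ g = v f ≈∞ v g
  _≺_ : Carrier → Carrier → Set gℓ
  f ≺ g = (f ≼ g) × ¬ (f ≍ g)

  _† : Carrier → Carrier
  f † = ∂ f * (f ⁻¹)

  ∂^ : ℕ → Carrier → Carrier
  ∂^ zero    y = y
  ∂^ (suc n) y = ∂ (∂^ n y)

  pow : Carrier → ℕ → Carrier
  pow x zero    = 1#
  pow x (suc n) = x * pow x n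

  sumFin : ∀ n → (Fin n → Carrier) → Carrier
  sumFin zero    f = 0#
  sumFin (suc n) f = f fzero + sumFin n (f ∘ fsuc)

  -- Differential polynomials in Y, Y', ..., Y^(r) with each exponent ≤ d,
  -- given by their coefficient function on exponent vectors
  -- (position i of the vector = exponent of Y^(i)).
  DiffPoly : ℕ → ℕ → Set c
  DiffPoly r d = Vec (Fin (suc d)) (suc r) → Carrier

  evalAux : ∀ {d} n → (Vec (Fin (suc d)) n → Carrier) → (Fin n → Carrier) → Carrier
  evalAux zero    cf xs = cf []
  evalAux (suc n) cf xs =
    sumFin _ (λ e → pow (xs fzero) (toℕ e) * evalAux n (λ es → cf (e ∷ es)) (xs ∘ fsuc))

  evalDP : ∀ {r d} → DiffPoly r d → Carrier → Carrier
  evalDP {r} P y = evalAux (suc r) P (λ i → ∂^ (toℕ i) y)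

  SmallDerivation : Set (c ⊔ gℓ)
  SmallDerivation = ∀ f → f ≺ 1# → ∂ f ≺ 1#

  Asymptotic : Set (c ⊔ ℓ ⊔ gℓ)
  Asymptotic = ∀ f g → ¬ (f ≈ 0#) → ¬ (g ≈ 0#) → f ≺ 1# → g ≺ 1# →
               (f ≺ g) ⇔ (∂ f ≺ ∂ g)

  HAsymptotic : Set (c ⊔ ℓ ⊔ gℓ)
  HAsymptotic = Asymptotic ×
    (∀ f g → ¬ (f ≈ 0#) → ¬ (g ≈ 0#) → f ≼ g → g ≺ 1# → g † ≼ f †)

  -- max Ψ = 0, where Ψ = { v(g†) : g ≠ 0, g ≭ 1 }
  Max0 : Set (c ⊔ ℓ ⊔ gℓ)
  Max0 = (∀ g → ¬ (g ≈ 0#) → ¬ (g ≍ 1#) → v (g †) ≤∞ fin 0Γ)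
       × (∃ λ g → ¬ (g ≈ 0#) × ¬ (g ≍ 1#) × (v (g †) ≈∞ fin 0Γ))

  ExponentialIntegration : Set (c ⊔ ℓ)
  ExponentialIntegration = ∀ f → ∃ λ z → ¬ (z ≈ 0#) × (z † ≈ f)

  DivisibleValueGroup : Set (g ⊔ gℓ)
  DivisibleValueGroup = ∀ (γ : ΓCarrier) n → ∃ λ δ → (suc n · δ) ≈Γ γ

  -- The residue field k = 𝒪/𝔬 with the induced derivation is linearly
  -- surjective (written out on representatives in 𝒪).
  ResidueLinearlySurjective : Set (c ⊔ gℓ)
  ResidueLinearlySurjective =
    ∀ r (a : Fin (suc r) → Carrier) b →
      (∀ i → a i ≼ 1#) → a (fromℕ r) ≍ 1# → b ≼ 1# →
      ∃ λ y → y ≼ 1# × ((sumFin (suc r) (λ i → a i * ∂^ (toℕ i) y) - b) ≺ 1#)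

  totalDeg : ∀ {m n} → Vec (Fin m) n → ℕ
  totalDeg []       = 0
  totalDeg (e ∷ es) = toℕ e +ℕ totalDeg es

  DifferentialHenselian : Set (c ⊔ ℓ ⊔ gℓ)
  DifferentialHenselian = SmallDerivation × ResidueLinearlySurjective ×
    (∀ r d (P : DiffPoly r d) →
       (∀ e → P e ≼ 1#) →
       (∀ e → totalDeg e ≡ 0 → P e ≺ 1#) →
       (∃ λ e → totalDeg e ≡ 1 × P e ≍ 1#) →               -- P₁ ≍ 1 (given P ∈ 𝒪{Y})
       ∃ λ y → y ≺ 1# × (evalDP P y ≈ 0#))

record Extension {c ℓ g gℓ c' ℓ' g' gℓ'}
                 (K : ValuedDifferentialField c ℓ g gℓ)
                 (L : ValuedDifferentialField c' ℓ' g' gℓ')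
                 : Set (c ⊔ ℓ ⊔ gℓ ⊔ c' ⊔ ℓ' ⊔ gℓ') where
  private
    module K = ValuedDifferentialField K
    module L = ValuedDifferentialField L
  field
    ι      : K.Carrier → L.Carrier
    ι-cong : ∀ {x y} → x K.≈ y → ι x L.≈ ι y
    ι-+    : ∀ x y → ι (x K.+ y) L.≈ (ι x L.+ ι y)
    ι-*    : ∀ x y → ι (x K.* y) L.≈ (ι x L.* ι y)
    ι-1    : ι K.1# L.≈ L.1#
    ι-∂    : ∀ x → ι (K.∂ x) L.≈ L.∂ (ι x)
    -- the valuation of L extends that of K (𝒪_L ∩ K = 𝒪_K)
    ι-≼    : ∀ x y → (x K.≼ y) ⇔ (ι x L.≼ ι y)

  Proper : Set (c ⊔ c' ⊔ ℓ')
  Proper = ∃ λ (y : L.Carrier) → ∀ x → ¬ (ι x L.≈ y)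

  DifferentiallyAlgebraic : Set (c ⊔ ℓ ⊔ c' ⊔ ℓ')
  DifferentiallyAlgebraic = ∀ (y : L.Carrier) →
    ∃ λ r → ∃ λ d → ∃ λ (P : K.DiffPoly r d) →
      (∃ λ e → ¬ (P e K.≈ K.0#)) × (L.evalDP (ι ∘ P) y L.≈ L.0#)

  -- the induced embedding 𝒌 → 𝒌_L is onto, i.e. 𝒌_L = 𝒌
  SameResidueField : Set (c ⊔ gℓ ⊔ c' ⊔ gℓ')
  SameResidueField = ∀ (y : L.Carrier) → y L.≼ L.1# →
    ∃ λ x → x K.≼ K.1# × ((ι x L.- y) L.≺ L.1#)

{-# OPTIONS --safe #-}
module Submission where

open import Defs
open import Level using (Level; _⊔_; Lift; lift; lower) renaming (suc to lsuc)
open import Algebra.Bundles using (AbelianGroup)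
open import Data.Empty using (⊥; ⊥-elim)
open import Data.Fin using (Fin; toℕ; fromℕ; fromℕ<; inject₁) renaming (zero to fzero; suc to fsuc)
import Data.Fin.Properties as FP
open import Data.List.Base as List using (List; []; _∷_; _++_; map; length; replicate; tabulate)
import Data.List.Properties as LP
open import Data.List.Relation.Binary.Permutation.Propositional as Perm using (_↭_; ↭-refl; ↭-sym; ↭-trans)
open import Data.List.Relation.Binary.Permutation.Propositional.Properties using (++⁺ˡ; ++⁺ʳ; shift)
open import Data.List.Relation.Binary.Pointwise using (Pointwise; []; _∷_)
open import Data.List.Relation.Unary.All using (All; []; _∷_)
import Data.List.Relation.Unary.All.Properties as AllP
open import Data.Maybe using (Maybe; just; nothing)
open import Data.Nat as ℕ using (ℕ; zero; suc; s≤s; z≤n)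
open import Data.Nat.Induction using (<-rec)
open import Data.Nat.ListAction using (sum)
import Data.Nat.Properties as ℕP
open import Data.Product using (∃; _×_; _,_; proj₁; proj₂)
open import Data.Sum using (_⊎_; inj₁; inj₂)
open import Data.Unit using (tt)
open import Data.Vec.Base as Vec using (Vec; []; _∷_; _∷ʳ_; lookup)
open import Function using (_∘_; Equivalence)
open import Relation.Binary.Definitions using (tri<; tri≈; tri>)
open import Relation.Binary.PropositionalEquality as ≡ using (_≡_)
open import Relation.Binary.Structures using (IsTotalOrder)
open import Relation.Nullary using (¬_; Dec; yes; no)

-- Inside L, let 𝒦 be the image of K.  It suffices that every y ∈ L has a best approximation in 𝒦: then
-- y ∉ 𝒦 yields elements whose valuation lies outside that of 𝒦, and iterating "logarithmic derivative minus
-- its best approximation" (logarithmic derivatives of 𝒦 fill 𝒦, by exponential integration) yields y₀, y₁, …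
-- whose valuations are independent over that of 𝒦, because ψ(γ) = o(γ) for H-type with max Ψ = 0.  So y₀ is
-- differentially transcendental.
--
-- If y has no best approximation, take a nonzero differential polynomial of least total degree that is not
-- dominated by its constant term on any ball h around y, h running over the cut of y.  By minimality its
-- partial derivatives, in all rescaled coordinates, are dominated by their constant terms.  If the linear part
-- dominates on some ball, d-henselianity produces zeros in 𝒦 closer and closer to y; their differences become
-- kernel elements of one linear operator, of too many distinct valuations.  Otherwise some degree d ≥ 2
-- competes with degree 1 along the whole cut.  Rescaling then changes the leading coefficients of both degrees
-- by exact powers of the scale, so the cut is pinned to a single q ∈ 𝒦 with q^(d-1) ≍ c₁/c_d, with an error
-- too small for ψ(γ) = o(γ).
--
-- The goal being ⊥, classical reasoning is available: x ⊴ y and x ◁ y are double-negation stable versions of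
-- x ≼ y and x ≺ y, and existence statements are used in the form ¬ ¬ ∃.

-- Rescaling by `k` is not multiplication by `k` on jets: the Leibniz rule gives a triangular matrix
-- with diagonal `k` whose other entries are larger by powers of `k †`. So every change of scale
-- loses powers of a logarithmic derivative, and ψ(γ) = o(γ) makes such a loss harmless against a
-- single factor `k ≺ 1`. These crude estimates settle the linear case, but they cannot locate the
-- scale at which two degrees balance. There the failure of the linear case is itself used: it
-- forces the logarithmic derivative of the scale to be one element `W` up to ≍ on a whole final
-- part of the cut. Words in the rescaled coordinates are weighted by powers of `W`, and the leading
-- word of a degree is the heaviest among the largest ones, so that the triangular mixing adds only
-- negligible terms. A later reference scale may change the leading word, but only to a lighter one,
-- so a choice of least total weight is stable. The balancing scale can be taken in 𝒦 because
-- minimality of the degree gives the leading coefficients valuations from 𝒦, whose value group is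
-- divisible.

fin-¬¬ : ∀ {a} n {P : Fin n → Set a} → (∀ i → ¬ ¬ P i) → ¬ ¬ (∀ i → P i)
fin-¬¬ zero h k = k (λ ())
fin-¬¬ (suc n) h k = h fzero λ a → fin-¬¬ n (λ i → h (fsuc i)) λ b → k λ { fzero → a ; (fsuc i) → b i }

vec-¬¬ : ∀ {a d} k {Q : Vec (Fin d) k → Set a} → (∀ e → ¬ ¬ Q e) → ¬ ¬ (∀ e → Q e)
vec-¬¬ zero h k = h [] λ q → k λ { [] → q }
vec-¬¬ {d = d} (suc n) {Q} h k = fin-¬¬ d {λ i → ∀ es → Q (i ∷ es)} (λ i → vec-¬¬ n (λ es → h (i ∷ es))) λ f → k λ { (i ∷ es) → f i es }

-- Dominance relations, finite sums and polynomial evaluation in a valued field.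

module ValuedField {c ℓ g gℓ} (F : ValuedDifferentialField c ℓ g gℓ) where

  open ValuedDifferentialField F hiding (zero) public
  import Algebra.Properties.Ring ring as RP
  open import Relation.Binary.Reasoning.Setoid setoid
  module Sol where
    open import Algebra.Solver.Ring.NaturalCoefficients.Default commutativeSemiring public
  open Sol using (solve; _:*_; _:+_; _:=_)

  private
    module G = OrderedAbelianGroup Γ
    module O = IsTotalOrder G.isTotalOrder

    ≤∞-reflexive : ∀ a b → a ≈∞ b → a ≤∞ b
    ≤∞-reflexive (fin a) (fin b) p = O.reflexive p
    ≤∞-reflexive ∞ ∞ p = lift tt

    ≤∞-trans : ∀ a b d → a ≤∞ b → b ≤∞ d → a ≤∞ d
    ≤∞-trans (fin a) (fin b) (fin d) p q = O.trans p q
    ≤∞-trans (fin a) (fin b) ∞ p q = lift tt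
    ≤∞-trans (fin a) ∞ (fin d) p (lift ())
    ≤∞-trans (fin a) ∞ ∞ p q = lift tt
    ≤∞-trans ∞ (fin b) d (lift ()) q
    ≤∞-trans ∞ ∞ d p q = q

    ≤∞-total : ∀ a b → (a ≤∞ b) ⊎ (b ≤∞ a)
    ≤∞-total (fin a) (fin b) = O.total a b
    ≤∞-total (fin a) ∞ = inj₁ (lift tt)
    ≤∞-total ∞ (fin b) = inj₂ (lift tt)
    ≤∞-total ∞ ∞ = inj₁ (lift tt)

    ≤∞-antisym : ∀ a b → a ≤∞ b → b ≤∞ a → a ≈∞ b
    ≤∞-antisym (fin a) (fin b) p q = O.antisym p q
    ≤∞-antisym (fin a) ∞ p (lift ())
    ≤∞-antisym ∞ (fin b) (lift ()) q
    ≤∞-antisym ∞ ∞ p q = lift tt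

    ≈∞-sym : ∀ a b → a ≈∞ b → b ≈∞ a
    ≈∞-sym (fin a) (fin b) p = G.sym p
    ≈∞-sym ∞ ∞ p = p

    +∞-mono : ∀ a b d → a ≤∞ b → (a +∞ d) ≤∞ (b +∞ d)
    +∞-mono (fin a) (fin b) (fin d) p = G.≤-compat d p
    +∞-mono (fin a) (fin b) ∞ p = lift tt
    +∞-mono (fin a) ∞ (fin d) p = lift tt
    +∞-mono (fin a) ∞ ∞ p = lift tt
    +∞-mono ∞ (fin b) d (lift ())
    +∞-mono ∞ ∞ d p = lift tt

  ≼-reflexive : ∀ {x y} → x ≈ y → x ≼ y
  ≼-reflexive {x} {y} e = ≤∞-reflexive (v y) (v x) (v-cong (sym e))

  ≼-trans : ∀ {x y z} → x ≼ y → y ≼ z → x ≼ z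
  ≼-trans {x} {y} {z} p q = ≤∞-trans (v z) (v y) (v x) q p

  ≼-total : ∀ x y → (x ≼ y) ⊎ (y ≼ x)
  ≼-total x y = ≤∞-total (v y) (v x)

  ≼-antisym : ∀ {x y} → x ≼ y → y ≼ x → x ≍ y
  ≼-antisym {x} {y} p q = ≤∞-antisym (v x) (v y) q p

  ≍⇒≼ : ∀ {x y} → x ≍ y → x ≼ y
  ≍⇒≼ {x} {y} p = ≤∞-reflexive (v y) (v x) (≈∞-sym (v x) (v y) p)

  ≍⇒≽ : ∀ {x y} → x ≍ y → y ≼ x
  ≍⇒≽ {x} {y} p = ≤∞-reflexive (v x) (v y) p

  private
    ≈∞-trans : ∀ a b d → a ≈∞ b → b ≈∞ d → a ≈∞ d
    ≈∞-trans (fin a) (fin b) (fin d) p q = G.trans p q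
    ≈∞-trans ∞ ∞ ∞ p q = p

    +∞-cong : ∀ a b d e → a ≈∞ b → d ≈∞ e → (a +∞ d) ≈∞ (b +∞ e)
    +∞-cong (fin a) (fin b) (fin d) (fin e) p q = G.∙-cong p q
    +∞-cong (fin a) (fin b) ∞ ∞ p q = p'
      where p' = lift tt
    +∞-cong ∞ ∞ d e p q = lift tt

  v1≈0 : v 1# ≈∞ fin 0Γ
  v1≈0 with v 1# | v-∞ 1# | ≈∞-trans (v 1#) (v (1# * 1#)) (v 1# +∞ v 1#) (v-cong (sym (*-identityˡ 1#))) (v-* 1# 1#)
  ... | ∞ | e | _ = ⊥-elim (1≉0 (Equivalence.to e (lift tt)))
  ... | fin γ | e | p = GP.identityˡ-unique γ γ (G.sym p)
    where import Algebra.Properties.Group (AbelianGroup.group G.abGroup) as GP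

  ≤0⇒1≼ : ∀ {x} → v x ≤∞ fin 0Γ → 1# ≼ x
  ≤0⇒1≼ {x} p = ≤∞-trans (v x) (fin 0Γ) (v 1#) p (≤∞-reflexive (fin 0Γ) (v 1#) (≈∞-sym (v 1#) (fin 0Γ) v1≈0))

  ≈0⇒≍1 : ∀ {x} → v x ≈∞ fin 0Γ → x ≍ 1#
  ≈0⇒≍1 {x} p = ≈∞-trans (v x) (fin 0Γ) (v 1#) p (≈∞-sym (v 1#) (fin 0Γ) v1≈0)

  private
    v-pow : ∀ z δ → v z ≈∞ fin δ → ∀ n → v (pow z n) ≈∞ fin (n · δ)
    v-pow z δ p zero = v1≈0
    v-pow z δ p (suc n) = ≈∞-trans (v (z * pow z n)) (v z +∞ v (pow z n)) (fin (suc n · δ)) (v-* z (pow z n))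
      (+∞-cong (v z) (fin δ) (v (pow z n)) (fin (n · δ)) p (v-pow z δ p n))

  root-≍ : DivisibleValueGroup → ∀ x → ¬ (x ≈ 0#) → ∀ n → ∃ λ z → ¬ (z ≈ 0#) × pow z (suc n) ≍ x
  root-≍ div x x≉0 n with v x in eq
  ... | ∞ = ⊥-elim (x≉0 (Equivalence.to (v-∞ x) (≡.subst (λ t → t ≈∞ ∞) (≡.sym eq) (lift tt))))
  ... | fin γ with div γ n
  ... | δ , p with v-surj δ
  ... | z , q = z , (λ z≈0 → lem z≈0 q) ,
    ≈∞-trans (v (pow z (suc n))) (fin (suc n · δ)) (fin γ) (v-pow z δ q (suc n)) p
    where
    lem : z ≈ 0# → v z ≈∞ fin δ → ⊥
    lem z≈0 q with v z | Equivalence.from (v-∞ z) z≈0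
    lem z≈0 (lift ()) | ∞ | _

  -- The constructors of `Γ∞` tell whether a value is infinite, so vanishing is decidable, whereas
  -- the alternative between `◁` and `⊴` is available only under a double negation.
  _≟0 : ∀ x → Dec (x ≈ 0#)
  x ≟0 with v x in eq | v-∞ x
  ... | ∞     | e = yes (Equivalence.to e (lift tt))
  ... | fin γ | e = no λ p → lower (Equivalence.from e p)

  0≼ : ∀ x → 0# ≼ x
  0≼ x with v 0# | Equivalence.from (v-∞ 0#) refl | v x
  ... | ∞ | _ | fin _ = lift tt
  ... | ∞ | _ | ∞ = lift tt

  ≼0⇒≈0 : ∀ {x} → x ≼ 0# → x ≈ 0#
  ≼0⇒≈0 {x} p with v x | v-∞ x | v 0# | Equivalence.from (v-∞ 0#) refl
  ... | ∞ | e | _ | _ = Equivalence.to e (lift tt)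
  ≼0⇒≈0 {x} (lift ()) | fin γ | e | ∞ | _

  *-monoʳ-≼ : ∀ {x y} z → x ≼ y → (x * z) ≼ (y * z)
  *-monoʳ-≼ {x} {y} z p =
    ≤∞-trans (v (y * z)) (v y +∞ v z) (v (x * z)) (≤∞-reflexive (v (y * z)) (v y +∞ v z) (v-* y z))
      (≤∞-trans (v y +∞ v z) (v x +∞ v z) (v (x * z)) (+∞-mono (v y) (v x) (v z) p)
        (≤∞-reflexive (v x +∞ v z) (v (x * z)) (≈∞-sym (v (x * z)) (v x +∞ v z) (v-* x z))))

  inverseˡ' : ∀ x → ¬ (x ≈ 0#) → (x ⁻¹) * x ≈ 1#
  inverseˡ' x n = trans (*-comm _ _) (inverseʳ x n)

  cancel-inv : ∀ x z → ¬ (z ≈ 0#) → (x * z) * z ⁻¹ ≈ x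
  cancel-inv x z n = trans (*-assoc _ _ _) (trans (*-congˡ (inverseʳ z n)) (*-identityʳ x))

  cancel-inv' : ∀ x z → ¬ (z ≈ 0#) → (x * z ⁻¹) * z ≈ x
  cancel-inv' x z n = trans (*-assoc _ _ _) (trans (*-congˡ (inverseˡ' z n)) (*-identityʳ x))

  *-cancelʳ-≼ : ∀ {x y} z → ¬ (z ≈ 0#) → (x * z) ≼ (y * z) → x ≼ y
  *-cancelʳ-≼ {x} {y} z n p =
    ≼-trans (≼-reflexive (sym (cancel-inv x z n))) (≼-trans (*-monoʳ-≼ (z ⁻¹) p) (≼-reflexive (cancel-inv y z n)))

  *-≉0 : ∀ {x y} → ¬ (x ≈ 0#) → ¬ (y ≈ 0#) → ¬ (x * y ≈ 0#)
  *-≉0 {x} {y} n m e = n (trans (sym (cancel-inv x y m)) (trans (*-congʳ e) (zeroˡ _)))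

  ⁻¹-≉0 : ∀ {x} → ¬ (x ≈ 0#) → ¬ (x ⁻¹ ≈ 0#)
  ⁻¹-≉0 {x} n e = 1≉0 (trans (sym (inverseʳ x n)) (trans (*-congˡ e) (zeroʳ x)))

  -1≼1 : (- 1#) ≼ 1#
  -1≼1 with ≼-total (- 1#) 1#
  ... | inj₁ p = p
  ... | inj₂ p = ≼-trans (≼-reflexive (sym (*-identityˡ _)))
                   (≼-trans (*-monoʳ-≼ (- 1#) p)
                     (≼-reflexive (trans (sym (RP.-‿distribˡ-* 1# (- 1#))) (trans (-‿cong (*-identityˡ _)) (RP.-‿involutive 1#)))))

  neg≼ : ∀ {x} → (- x) ≼ x
  neg≼ {x} = ≼-trans (≼-reflexive (trans (-‿cong (sym (*-identityˡ x))) (RP.-‿distribˡ-* 1# x)))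
               (≼-trans (*-monoʳ-≼ x -1≼1) (≼-reflexive (*-identityˡ x)))

  infix 4 _⊴_ _◁_ _~_
  record _⊴_ (x y : Carrier) : Set gℓ where
    constructor mk⊴
    field un⊴ : ¬ ¬ (x ≼ y)
  open _⊴_ public
  record _◁_ (x y : Carrier) : Set gℓ where
    constructor mk◁
    field un◁ : ¬ (y ≼ x)
  open _◁_ public
  _~_ : Carrier → Carrier → Set gℓ
  x ~ y = x ⊴ y × y ⊴ x

  cmp : ∀ x y → ((x ◁ y ⊎ y ⊴ x) → ⊥) → ⊥
  cmp x y k = k (inj₂ (mk⊴ λ n → k (inj₁ (mk◁ n))))

  ⊴-by : ∀ {x y} → (y ◁ x → ⊥) → x ⊴ y
  ⊴-by f = mk⊴ λ n → f (mk◁ n)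

  ◁-by : ∀ {x y} → (y ⊴ x → ⊥) → x ◁ y
  ◁-by f = mk◁ λ p → f (mk⊴ λ n → n p)

  ⊴◁⊥ : ∀ {x y} → x ⊴ y → y ◁ x → ⊥
  ⊴◁⊥ p q = un⊴ p (un◁ q)

  ≼⇒⊴ : ∀ {x y} → x ≼ y → x ⊴ y
  ≼⇒⊴ p = mk⊴ λ n → n p

  ≺⇒◁ : ∀ {x y} → x ≺ y → x ◁ y
  ≺⇒◁ (p , n) = mk◁ λ q → n (≼-antisym p q)

  ◁⇒≺ : ∀ {x y} → x ◁ y → x ≺ y
  ◁⇒≺ {x} {y} (mk◁ n) with ≼-total x y
  ... | inj₁ p = p , λ e → n (≍⇒≽ e)
  ... | inj₂ q = ⊥-elim (n q)

  ⊴-reflexive : ∀ {x y} → x ≈ y → x ⊴ y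
  ⊴-reflexive e = ≼⇒⊴ (≼-reflexive e)

  ⊴-refl : ∀ {x} → x ⊴ x
  ⊴-refl = ⊴-reflexive refl

  ⊴-trans : ∀ {x y z} → x ⊴ y → y ⊴ z → x ⊴ z
  ⊴-trans (mk⊴ p) (mk⊴ q) = mk⊴ λ k → p λ a → q λ b → k (≼-trans a b)

  ⊴-◁-trans : ∀ {x y z} → x ⊴ y → y ◁ z → x ◁ z
  ⊴-◁-trans p q = ◁-by λ r → ⊴◁⊥ (⊴-trans r p) q

  ◁-⊴-trans : ∀ {x y z} → x ◁ y → y ⊴ z → x ◁ z
  ◁-⊴-trans p q = ◁-by λ r → ⊴◁⊥ (⊴-trans q r) p

  ◁⇒⊴ : ∀ {x y} → x ◁ y → x ⊴ y
  ◁⇒⊴ p = ≼⇒⊴ (proj₁ (◁⇒≺ p))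

  ◁-trans : ∀ {x y z} → x ◁ y → y ◁ z → x ◁ z
  ◁-trans p q = ◁-⊴-trans p (◁⇒⊴ q)

  ◁-irrefl : ∀ {x} → x ◁ x → ⊥
  ◁-irrefl p = ⊴◁⊥ ⊴-refl p

  ⊴-resp : ∀ {x x' y y'} → x ≈ x' → y ≈ y' → x ⊴ y → x' ⊴ y'
  ⊴-resp e f p = ⊴-trans (⊴-reflexive (sym e)) (⊴-trans p (⊴-reflexive f))

  ◁-resp : ∀ {x x' y y'} → x ≈ x' → y ≈ y' → x ◁ y → x' ◁ y'
  ◁-resp e f p = ⊴-◁-trans (⊴-reflexive (sym e)) (◁-⊴-trans p (⊴-reflexive f))

  ~-refl : ∀ {x} → x ~ x
  ~-refl = ⊴-refl , ⊴-refl
  ~-sym : ∀ {x y} → x ~ y → y ~ x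
  ~-sym (p , q) = q , p
  ~-trans : ∀ {x y z} → x ~ y → y ~ z → x ~ z
  ~-trans (p , q) (r , s) = ⊴-trans p r , ⊴-trans s q
  ~-reflexive : ∀ {x y} → x ≈ y → x ~ y
  ~-reflexive e = ⊴-reflexive e , ⊴-reflexive (sym e)

  0⊴ : ∀ {x} → 0# ⊴ x
  0⊴ = ≼⇒⊴ (0≼ _)

  ⊴0⇒≈0 : ∀ {x} → x ⊴ 0# → x ≈ 0#
  ⊴0⇒≈0 {x} p with x ≟0
  ... | yes e = e
  ... | no n = ⊥-elim (un⊴ p λ q → n (≼0⇒≈0 q))

  ≉0⇒0◁ : ∀ {x} → ¬ (x ≈ 0#) → 0# ◁ x
  ≉0⇒0◁ n = ◁-by λ p → n (⊴0⇒≈0 p)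

  ◁⇒≉0 : ∀ {x y} → x ◁ y → ¬ (y ≈ 0#)
  ◁⇒≉0 p e = ⊴◁⊥ 0⊴ (◁-resp refl e p)

  ⊴-≉0 : ∀ {x y} → x ⊴ y → ¬ (x ≈ 0#) → ¬ (y ≈ 0#)
  ⊴-≉0 p n e = n (⊴0⇒≈0 (⊴-resp refl e p))

  *-monoʳ-⊴ : ∀ {x y} z → x ⊴ y → x * z ⊴ y * z
  *-monoʳ-⊴ z (mk⊴ p) = mk⊴ λ k → p λ a → k (*-monoʳ-≼ z a)

  *-monoˡ-⊴ : ∀ {x y} z → x ⊴ y → z * x ⊴ z * y
  *-monoˡ-⊴ z p = ⊴-resp (*-comm _ _) (*-comm _ _) (*-monoʳ-⊴ z p)

  *-mono-⊴ : ∀ {a b x y} → a ⊴ b → x ⊴ y → a * x ⊴ b * y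
  *-mono-⊴ p q = ⊴-trans (*-monoʳ-⊴ _ p) (*-monoˡ-⊴ _ q)

  *-monoʳ-◁ : ∀ {x y} z → ¬ (z ≈ 0#) → x ◁ y → x * z ◁ y * z
  *-monoʳ-◁ z n (mk◁ p) = mk◁ λ q → p (*-cancelʳ-≼ z n q)

  *-monoˡ-◁ : ∀ {x y} z → ¬ (z ≈ 0#) → x ◁ y → z * x ◁ z * y
  *-monoˡ-◁ z n p = ◁-resp (*-comm _ _) (*-comm _ _) (*-monoʳ-◁ z n p)

  *-mono-◁⊴ : ∀ {a b x y} → a ◁ b → x ⊴ y → ¬ (y ≈ 0#) → a * x ◁ b * y
  *-mono-◁⊴ p q n = ⊴-◁-trans (*-monoˡ-⊴ _ q) (*-monoʳ-◁ _ n p)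

  *-mono-~ : ∀ {a b x y} → a ~ b → x ~ y → a * x ~ b * y
  *-mono-~ (p , q) (r , s) = *-mono-⊴ p r , *-mono-⊴ q s

  *-cancelʳ-⊴ : ∀ {x y} z → ¬ (z ≈ 0#) → x * z ⊴ y * z → x ⊴ y
  *-cancelʳ-⊴ z n (mk⊴ p) = mk⊴ λ k → p λ a → k (*-cancelʳ-≼ z n a)

  *-cancelʳ-◁ : ∀ {x y} z → x * z ◁ y * z → x ◁ y
  *-cancelʳ-◁ z p = ◁-by λ q → ⊴◁⊥ (*-monoʳ-⊴ z q) p

  *-cancelʳ-~ : ∀ {x y} z → ¬ (z ≈ 0#) → x * z ~ y * z → x ~ y
  *-cancelʳ-~ z n (p , q) = *-cancelʳ-⊴ z n p , *-cancelʳ-⊴ z n q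

  +-⊴ : ∀ {x y z} → x ⊴ z → y ⊴ z → x + y ⊴ z
  +-⊴ {x} {y} (mk⊴ p) (mk⊴ q) = mk⊴ λ k → p λ a → q λ b → lem k a b (v-+ x y)
    where
    lem : ∀ {z} → ¬ (x + y ≼ z) → x ≼ z → y ≼ z → (v x ≤∞ v (x + y)) ⊎ (v y ≤∞ v (x + y)) → ⊥
    lem k a b (inj₁ r) = k (≼-trans r a)
    lem k a b (inj₂ r) = k (≼-trans r b)

  +-◁ : ∀ {x y z} → x ◁ z → y ◁ z → x + y ◁ z
  +-◁ {x} {y} (mk◁ p) (mk◁ q) = mk◁ λ r → lem r (v-+ x y)
    where
    lem : _ → (v x ≤∞ v (x + y)) ⊎ (v y ≤∞ v (x + y)) → ⊥
    lem r (inj₁ s) = p (≼-trans r s)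
    lem r (inj₂ s) = q (≼-trans r s)

  neg-⊴ : ∀ {x y} → x ⊴ y → - x ⊴ y
  neg-⊴ p = ⊴-trans (≼⇒⊴ neg≼) p

  neg-◁ : ∀ {x y} → x ◁ y → - x ◁ y
  neg-◁ p = ⊴-◁-trans (≼⇒⊴ neg≼) p

  neg-~ : ∀ {x} → - x ~ x
  neg-~ {x} = ≼⇒⊴ neg≼ , ⊴-trans (⊴-reflexive (sym (RP.-‿involutive x))) (≼⇒⊴ neg≼)

  x-y+y : ∀ x y → (x - y) + y ≈ x
  x-y+y x y = trans (+-assoc _ _ _) (trans (+-congˡ (-‿inverseˡ y)) (+-identityʳ x))

  x+y-y : ∀ x y → (x + y) - y ≈ x
  x+y-y x y = trans (+-assoc _ _ _) (trans (+-congˡ (-‿inverseʳ y)) (+-identityʳ x))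

  x-y≈0⇒x≈y : ∀ {x y} → x - y ≈ 0# → x ≈ y
  x-y≈0⇒x≈y {x} {y} e = trans (sym (x-y+y x y)) (trans (+-congʳ e) (+-identityˡ y))

  neg-sub : ∀ x y → - (x - y) ≈ y - x
  neg-sub x y = begin
    - (x - y) ≈⟨ sym (RP.-‿+-comm x (- y)) ⟩
    - x + - - y ≈⟨ +-congˡ (RP.-‿involutive y) ⟩
    - x + y ≈⟨ +-comm _ _ ⟩
    y - x ∎

  sub-sub : ∀ x y z → (x - y) + (y - z) ≈ x - z
  sub-sub x y z = begin
    (x - y) + (y - z) ≈⟨ sym (+-assoc _ _ _) ⟩
    ((x - y) + y) - z ≈⟨ +-congʳ (x-y+y x y) ⟩
    x - z ∎

  sub-~ : ∀ x y → x - y ~ y - x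
  sub-~ x y = ~-trans (~-sym neg-~) (~-reflexive (neg-sub x y))

  +-absorb : ∀ {x y} → x ◁ y → x + y ~ y
  +-absorb {x} {y} p = +-⊴ (◁⇒⊴ p) ⊴-refl ,
    ⊴-by λ q → ◁-irrefl (◁-resp (trans (+-comm _ _) (trans (sym (+-assoc _ _ _)) (trans (+-congʳ (-‿inverseˡ x)) (+-identityˡ y)))) refl (+-◁ q (neg-◁ p)))

  close⇒~ : ∀ {x y} → x - y ◁ y → x ~ y
  close⇒~ {x} {y} p = ~-trans (~-reflexive (sym (x-y+y x y))) (+-absorb p)

  em : ∀ {a} (P : Set a) → ((P ⊎ ¬ P) → ⊥) → ⊥
  em P k = k (inj₂ λ p → k (inj₁ p))

  ⊴-¬¬ : ∀ {x y} → ¬ ¬ (x ⊴ y) → x ⊴ y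
  ⊴-¬¬ n = ⊴-by λ k → n λ p → ⊴◁⊥ p k

  ◁-¬¬ : ∀ {x y} → ¬ ¬ (x ◁ y) → x ◁ y
  ◁-¬¬ n = ◁-by λ k → n λ p → ⊴◁⊥ k p

  ⊴-total : ∀ x y → (x ⊴ y) ⊎ (y ⊴ x)
  ⊴-total x y with ≼-total x y
  ... | inj₁ p = inj₁ (≼⇒⊴ p)
  ... | inj₂ p = inj₂ (≼⇒⊴ p)

  argmax : ∀ {n} (f : Fin (suc n) → Carrier) → ∃ λ i → ∀ j → f j ⊴ f i
  argmax {zero} f = fzero , λ { fzero → ⊴-refl }
  argmax {suc n} f with argmax (f ∘ fsuc)
  ... | i , p with ⊴-total (f fzero) (f (fsuc i))
  ... | inj₁ q = fsuc i , λ { fzero → q ; (fsuc j) → p j }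
  ... | inj₂ q = fzero , λ { fzero → ⊴-refl ; (fsuc j) → ⊴-trans (p j) q }

  inv-◁ : ∀ {x y} → ¬ (x ≈ 0#) → ¬ (y ≈ 0#) → x ◁ y → y ⁻¹ ◁ x ⁻¹
  inv-◁ {x} {y} n m p =
    *-cancelʳ-◁ (x * y) (◁-resp
      (trans (sym (*-identityˡ x)) (trans (*-congʳ (sym (inverseˡ' y m))) (solve 3 (λ a b d → a :* b :* d := a :* (d :* b)) refl (y ⁻¹) y x)))
      (trans (sym (*-identityˡ y)) (trans (*-congʳ (sym (inverseˡ' x n))) (solve 3 (λ a b d → a :* b :* d := a :* (b :* d)) refl (x ⁻¹) x y))) p)

  inv-⊴ : ∀ {x y} → ¬ (x ≈ 0#) → x ⊴ y → y ⁻¹ ⊴ x ⁻¹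
  inv-⊴ {x} {y} n p = *-cancelʳ-⊴ (x * y) (*-≉0 n m) (⊴-resp
      (trans (sym (*-identityˡ x)) (trans (*-congʳ (sym (inverseˡ' y m))) (solve 3 (λ a b d → a :* b :* d := a :* (d :* b)) refl (y ⁻¹) y x)))
      (trans (sym (*-identityˡ y)) (trans (*-congʳ (sym (inverseˡ' x n))) (solve 3 (λ a b d → a :* b :* d := a :* (b :* d)) refl (x ⁻¹) x y))) p)
    where m = ⊴-≉0 p n

  inv-1 : 1# ⁻¹ ≈ 1#
  inv-1 = trans (sym (*-identityˡ _)) (inverseʳ 1# 1≉0)

  inv-unique : ∀ {x y} → ¬ (x ≈ 0#) → x * y ≈ 1# → y ≈ x ⁻¹
  inv-unique {x} {y} n e = begin
    y ≈⟨ sym (cancel-inv y x n) ⟩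
    (y * x) * x ⁻¹ ≈⟨ *-congʳ (trans (*-comm y x) e) ⟩
    1# * x ⁻¹ ≈⟨ *-identityˡ _ ⟩
    x ⁻¹ ∎

  inv-* : ∀ {x y} → ¬ (x ≈ 0#) → ¬ (y ≈ 0#) → (x * y) ⁻¹ ≈ x ⁻¹ * y ⁻¹
  inv-* {x} {y} n m = sym (inv-unique (*-≉0 n m) (begin
    (x * y) * (x ⁻¹ * y ⁻¹) ≈⟨ solve 4 (λ a b d e → (a :* b) :* (d :* e) := (a :* d) :* (b :* e)) refl x y (x ⁻¹) (y ⁻¹) ⟩
    (x * x ⁻¹) * (y * y ⁻¹) ≈⟨ *-cong (inverseʳ x n) (inverseʳ y m) ⟩
    1# * 1# ≈⟨ *-identityˡ _ ⟩
    1# ∎))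

  +-interchange : ∀ a b d e → (a + b) + (d + e) ≈ (a + d) + (b + e)
  +-interchange = solve 4 (λ a b d e → (a :+ b) :+ (d :+ e) := (a :+ d) :+ (b :+ e)) refl

  -- Powers and finite sums

  pow-cong : ∀ {x y} n → x ≈ y → pow x n ≈ pow y n
  pow-cong zero e = refl
  pow-cong (suc n) e = *-cong e (pow-cong n e)

  pow-+ : ∀ x m n → pow x (m ℕ.+ n) ≈ pow x m * pow x n
  pow-+ x zero n = sym (*-identityˡ _)
  pow-+ x (suc m) n = trans (*-congˡ (pow-+ x m n)) (sym (*-assoc _ _ _))

  pow-* : ∀ x y n → pow (x * y) n ≈ pow x n * pow y n
  pow-* x y zero = sym (*-identityˡ _)
  pow-* x y (suc n) = trans (*-congˡ (pow-* x y n))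
    (solve 4 (λ a b d e → (a :* b) :* (d :* e) := (a :* d) :* (b :* e)) refl x y (pow x n) (pow y n))

  pow-≉0 : ∀ {x} n → ¬ (x ≈ 0#) → ¬ (pow x n ≈ 0#)
  pow-≉0 zero m = 1≉0
  pow-≉0 (suc n) m = *-≉0 m (pow-≉0 n m)

  pow-mono : ∀ {x y} n → x ⊴ y → pow x n ⊴ pow y n
  pow-mono zero p = ⊴-refl
  pow-mono (suc n) p = *-mono-⊴ p (pow-mono n p)

  1pow : ∀ n → pow 1# n ≈ 1#
  1pow zero = refl
  1pow (suc n) = trans (*-identityˡ _) (1pow n)

  1⊴pow : ∀ {w} n → 1# ⊴ w → 1# ⊴ pow w n
  1⊴pow n p = ⊴-trans (⊴-reflexive (sym (1pow n))) (pow-mono n p)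

  pow-≤ : ∀ {w m n} → 1# ⊴ w → m ℕ.≤ n → pow w m ⊴ pow w n
  pow-≤ {n = n} p z≤n = 1⊴pow n p
  pow-≤ p (s≤s q) = *-monoˡ-⊴ _ (pow-≤ p q)

  pow⊴1 : ∀ {x} n → x ⊴ 1# → pow x n ⊴ 1#
  pow⊴1 n p = ⊴-trans (pow-mono n p) (⊴-reflexive (1pow n))

  pow-suc⊴ : ∀ {x} n → x ⊴ 1# → pow x (suc n) ⊴ x
  pow-suc⊴ n p = ⊴-trans (*-monoˡ-⊴ _ (pow⊴1 n p)) (⊴-reflexive (*-identityʳ _))

  ⊴pow-suc : ∀ {x} n → 1# ⊴ x → x ⊴ pow x (suc n)
  ⊴pow-suc n p = ⊴-trans (⊴-reflexive (sym (*-identityʳ _))) (*-monoˡ-⊴ _ (1⊴pow n p))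

  pow-anti : ∀ {w m n} → w ⊴ 1# → m ℕ.≤ n → pow w n ⊴ pow w m
  pow-anti {n = n} p z≤n = pow⊴1 n p
  pow-anti p (s≤s q) = *-monoˡ-⊴ _ (pow-anti p q)

  pow-mul : ∀ x m n → pow (pow x m) n ≈ pow x (n ℕ.* m)
  pow-mul x m zero = refl
  pow-mul x m (suc n) = trans (*-congˡ (pow-mul x m n)) (sym (pow-+ x m (n ℕ.* m)))

  sumFin-cong : ∀ n {f h : Fin n → Carrier} → (∀ i → f i ≈ h i) → sumFin n f ≈ sumFin n h
  sumFin-cong zero e = refl
  sumFin-cong (suc n) e = +-cong (e fzero) (sumFin-cong n (λ i → e (fsuc i)))

  sumFin-0 : ∀ n {f : Fin n → Carrier} → (∀ i → f i ≈ 0#) → sumFin n f ≈ 0#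
  sumFin-0 zero e = refl
  sumFin-0 (suc n) e = trans (+-cong (e fzero) (sumFin-0 n (λ i → e (fsuc i)))) (+-identityˡ 0#)

  sumFin-+ : ∀ n (f h : Fin n → Carrier) → sumFin n (λ i → f i + h i) ≈ sumFin n f + sumFin n h
  sumFin-+ zero f h = sym (+-identityˡ 0#)
  sumFin-+ (suc n) f h = trans (+-congˡ (sumFin-+ n _ _))
    (+-interchange _ _ _ _)

  sumFin-*ˡ : ∀ n x (f : Fin n → Carrier) → sumFin n (λ i → x * f i) ≈ x * sumFin n f
  sumFin-*ˡ zero x f = sym (zeroʳ x)
  sumFin-*ˡ (suc n) x f = trans (+-congˡ (sumFin-*ˡ n x _)) (sym (distribˡ x _ _))

  sumFin-*ʳ : ∀ n x (f : Fin n → Carrier) → sumFin n (λ i → f i * x) ≈ sumFin n f * x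
  sumFin-*ʳ n x f = trans (sumFin-cong n (λ i → *-comm _ _)) (trans (sumFin-*ˡ n x f) (*-comm _ _))

  sumFin-swap : ∀ n m (f : Fin n → Fin m → Carrier) →
    sumFin n (λ i → sumFin m (f i)) ≈ sumFin m (λ j → sumFin n (λ i → f i j))
  sumFin-swap zero m f = sym (sumFin-0 m (λ _ → refl))
  sumFin-swap (suc n) m f = trans (+-congˡ (sumFin-swap n m _)) (sym (sumFin-+ m _ _))

  sumFin-single : ∀ n (i : Fin n) (f : Fin n → Carrier) → (∀ j → ¬ (i ≡.≡ j) → f j ≈ 0#) → sumFin n f ≈ f i
  sumFin-single (suc n) fzero f z = trans (+-congˡ (sumFin-0 n (λ j → z (fsuc j) (λ ())))) (+-identityʳ _)
  sumFin-single (suc n) (fsuc i) f z = trans (+-cong (z fzero (λ ()))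
    (sumFin-single n i (f ∘ fsuc) (λ j m → z (fsuc j) (λ { ≡.refl → m ≡.refl })))) (+-identityˡ _)

  sumFin-⊴ : ∀ n {f : Fin n → Carrier} {z} → (∀ i → f i ⊴ z) → sumFin n f ⊴ z
  sumFin-⊴ zero p = 0⊴
  sumFin-⊴ (suc n) p = +-⊴ (p fzero) (sumFin-⊴ n (λ i → p (fsuc i)))

  sumFin-◁ : ∀ n {f : Fin n → Carrier} {z} → ¬ (z ≈ 0#) → (∀ i → f i ◁ z) → sumFin n f ◁ z
  sumFin-◁ zero m p = ≉0⇒0◁ m
  sumFin-◁ (suc n) m p = +-◁ (p fzero) (sumFin-◁ n m (λ i → p (fsuc i)))

  evalAux-cong : ∀ {d} n {C C' : Vec (Fin (suc d)) n → Carrier} {xs xs'} → (∀ e → C e ≈ C' e) → (∀ i → xs i ≈ xs' i) → evalAux n C xs ≈ evalAux n C' xs'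
  evalAux-cong zero e f = e []
  evalAux-cong {d} (suc n) {C} {C'} e f = sumFin-cong (suc d) (λ i → *-cong (pow-cong (toℕ i) (f fzero)) (evalAux-cong n {λ es → C (i ∷ es)} {λ es → C' (i ∷ es)} (λ es → e (i ∷ es)) (λ i → f (fsuc i))))

  evalAux-0 : ∀ {d} n {C : Vec (Fin (suc d)) n → Carrier} {xs} → (∀ e → C e ≈ 0#) → evalAux n C xs ≈ 0#
  evalAux-0 zero e = e []
  evalAux-0 {d} (suc n) {C} {xs} e = sumFin-0 (suc d) (λ i → trans (*-congˡ {pow (xs fzero) (toℕ i)} (evalAux-0 n {λ es → C (i ∷ es)} {xs ∘ fsuc} (λ es → e (i ∷ es)))) (zeroʳ _))

  private
    slice : ∀ {d} n (C : Vec (Fin (suc d)) (suc n) → Carrier) (xs : Fin (suc n) → Carrier) → Fin (suc d) → Carrier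
    slice n C xs i = pow (xs fzero) (toℕ i) * evalAux n (λ es → C (i ∷ es)) (xs ∘ fsuc)

  evalAux-+ : ∀ {d} n (C C' : Vec (Fin (suc d)) n → Carrier) xs → evalAux n (λ e → C e + C' e) xs ≈ evalAux n C xs + evalAux n C' xs
  evalAux-+ zero C C' xs = refl
  evalAux-+ {d} (suc n) C C' xs = trans (sumFin-cong (suc d) {slice n (λ e → C e + C' e) xs} {λ i → slice n C xs i + slice n C' xs i}
      (λ i → trans (*-congˡ (evalAux-+ n (λ es → C (i ∷ es)) (λ es → C' (i ∷ es)) (xs ∘ fsuc))) (distribˡ _ _ _)))
    (sumFin-+ (suc d) (slice n C xs) (slice n C' xs))

  evalAux-*ʳ : ∀ {d} n (C : Vec (Fin (suc d)) n → Carrier) t xs → evalAux n (λ e → C e * t) xs ≈ evalAux n C xs * t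
  evalAux-*ʳ zero C t xs = refl
  evalAux-*ʳ {d} (suc n) C t xs = trans (sumFin-cong (suc d) {slice n (λ e → C e * t) xs} {λ i → slice n C xs i * t}
      (λ i → trans (*-congˡ (evalAux-*ʳ n (λ es → C (i ∷ es)) t (xs ∘ fsuc))) (sym (*-assoc _ _ _))))
    (sumFin-*ʳ (suc d) t (slice n C xs))

  evalAux-sum : ∀ {d} n k (C : Fin k → Vec (Fin (suc d)) n → Carrier) xs → evalAux n (λ e → sumFin k (λ j → C j e)) xs ≈ sumFin k (λ j → evalAux n (C j) xs)
  evalAux-sum n zero C xs = evalAux-0 n (λ _ → refl)
  evalAux-sum n (suc k) C xs = trans (evalAux-+ n _ _ xs) (+-congˡ (evalAux-sum n k _ xs))

-- Derivatives and logarithmic derivatives in an H-asymptotic field with max 0.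

module MaxZero {c ℓ g gℓ} (F : ValuedDifferentialField c ℓ g gℓ)
  (hasy : ValuedDifferentialField.HAsymptotic F) (max0 : ValuedDifferentialField.Max0 F) where

  open ValuedField F public
  open Sol using (solve; _:*_; _:+_; _:=_)
  import Algebra.Properties.Ring ring as RP
  open import Relation.Binary.Reasoning.Setoid setoid

  private
    x≈x+x : ∀ {x} → x ≈ x + x → x ≈ 0#
    x≈x+x {x} e = sym (trans (sym (-‿inverseʳ x)) (trans (+-congʳ e) (x+y-y x x)))

  ∂0 : ∂ 0# ≈ 0#
  ∂0 = x≈x+x (trans (∂-cong (sym (+-identityˡ 0#))) (∂-+ 0# 0#))

  ∂1 : ∂ 1# ≈ 0#
  ∂1 = x≈x+x (trans (∂-cong (sym (*-identityˡ 1#))) (trans (∂-* 1# 1#) (+-cong (*-identityʳ _) (*-identityˡ _))))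

  +-inv-unique : ∀ {x y} → x + y ≈ 0# → y ≈ - x
  +-inv-unique {x} {y} e = begin
    y ≈⟨ sym (+-identityˡ y) ⟩
    0# + y ≈⟨ +-congʳ (sym (-‿inverseˡ x)) ⟩
    (- x + x) + y ≈⟨ +-assoc _ _ _ ⟩
    - x + (x + y) ≈⟨ +-congˡ e ⟩
    - x + 0# ≈⟨ +-identityʳ _ ⟩
    - x ∎

  ∂^-cong : ∀ {x y} n → x ≈ y → ∂^ n x ≈ ∂^ n y
  ∂^-cong zero e = e
  ∂^-cong (suc n) e = ∂-cong (∂^-cong n e)

  †-cong : ∀ {x y} → x ≈ y → x † ≈ y †
  †-cong e = *-cong (∂-cong e) (⁻¹-cong e)

  ∂≈†* : ∀ {x} → ¬ (x ≈ 0#) → ∂ x ≈ x † * x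
  ∂≈†* {x} n = sym (cancel-inv' (∂ x) x n)

  †-* : ∀ {x y} → ¬ (x ≈ 0#) → ¬ (y ≈ 0#) → (x * y) † ≈ x † + y †
  †-* {x} {y} n m = begin
    ∂ (x * y) * (x * y) ⁻¹ ≈⟨ *-cong (∂-* x y) (inv-* n m) ⟩
    (∂ x * y + x * ∂ y) * (x ⁻¹ * y ⁻¹) ≈⟨ solve 6 (λ x' y x y' xi yi → (x' :* y :+ x :* y') :* (xi :* yi) := (y :* yi) :* (x' :* xi) :+ (x :* xi) :* (y' :* yi)) refl (∂ x) y x (∂ y) (x ⁻¹) (y ⁻¹) ⟩
    (y * y ⁻¹) * x † + (x * x ⁻¹) * y † ≈⟨ +-cong (*-congʳ (inverseʳ y m)) (*-congʳ (inverseʳ x n)) ⟩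
    1# * x † + 1# * y † ≈⟨ +-cong (*-identityˡ _) (*-identityˡ _) ⟩
    x † + y † ∎

  1† : 1# † ≈ 0#
  1† = trans (*-congʳ ∂1) (zeroˡ _)

  †-inv : ∀ {x} → ¬ (x ≈ 0#) → (x ⁻¹) † ≈ - (x †)
  †-inv {x} n = +-inv-unique (trans (sym (†-* n (⁻¹-≉0 n))) (trans (†-cong (inverseʳ x n)) 1†))

  †-/ : ∀ {x y} → ¬ (x ≈ 0#) → ¬ (y ≈ 0#) → (x * y ⁻¹) † ≈ x † - y †
  †-/ n m = trans (†-* n (⁻¹-≉0 m)) (+-congˡ (†-inv m))

  nat : ℕ → Carrier
  nat = natCast cring

  †-pow : ∀ {x} n → ¬ (x ≈ 0#) → (pow x n) † ≈ nat n * x †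
  †-pow zero m = trans 1† (sym (zeroˡ _))
  †-pow {x} (suc n) m = trans (†-* m (pow-≉0 n m)) (trans (+-cong (sym (*-identityˡ _)) (†-pow n m)) (sym (distribʳ _ _ _)))

  ~1⇒¬¬≍1 : ∀ {x y} → x ~ y → ¬ ¬ (x ≍ y)
  ~1⇒¬¬≍1 (p , q) k = un⊴ p λ a → un⊴ q λ b → k (≼-antisym a b)

  1⊴† : ∀ {x} → ¬ (x ≈ 0#) → ¬ (x ~ 1#) → 1# ⊴ x †
  1⊴† n m = ≼⇒⊴ (≤0⇒1≼ (proj₁ max0 _ n (λ e → m (≼⇒⊴ (≍⇒≼ e) , ≼⇒⊴ (≍⇒≽ e)))))

  ◁1⇒≁1 : ∀ {x} → x ◁ 1# → ¬ (x ~ 1#)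
  ◁1⇒≁1 p (_ , q) = ⊴◁⊥ q p

  -- Otherwise max 0 would give `1# ⊴ x †`, while the logarithmic derivative of a constant is 0.
  const~1 : ∀ {x} → ¬ (x ≈ 0#) → ∂ x ≈ 0# → x ~ 1#
  const~1 {x} n e = ⊴-¬¬ (λ k → lem (λ t → k (proj₁ t))) , ⊴-¬¬ (λ k → lem (λ t → k (proj₂ t)))
    where
    lem : ¬ ¬ (x ~ 1#)
    lem k = 1≉0 (⊴0⇒≈0 (⊴-resp refl (trans (*-congʳ e) (zeroˡ _)) (1⊴† n k)))

  ∂nat : ∀ n → ∂ (nat n) ≈ 0#
  ∂nat zero = ∂0
  ∂nat (suc n) = trans (∂-+ _ _) (trans (+-cong ∂1 (∂nat n)) (+-identityˡ _))

  -- Nonzero natural numbers are constants. Hence the numerical factors produced by symmetrisation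
  -- never affect dominance.
  nat~1 : ∀ n → nat (suc n) ~ 1#
  nat~1 n = const~1 (char0 n) (∂nat (suc n))

  H-mono : ∀ {x y} → ¬ (x ≈ 0#) → ¬ (y ≈ 0#) → x ⊴ y → y ◁ 1# → y † ⊴ x †
  H-mono n m (mk⊴ p) q = ⊴-¬¬ λ k → p λ a → k (≼⇒⊴ (proj₂ hasy _ _ n m a (◁⇒≺ q)))

  ∂-mono◁ : ∀ {x y} → ¬ (x ≈ 0#) → ¬ (y ≈ 0#) → x ◁ y → y ◁ 1# → ∂ x ◁ ∂ y
  ∂-mono◁ n m p q = ≺⇒◁ (Equivalence.to (proj₁ hasy _ _ n m (◁⇒≺ (◁-trans p q)) (◁⇒≺ q)) (◁⇒≺ p))

  private
    -- In the value group: Ψ lies strictly below all values of derivatives of infinitesimals. As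
    -- `f * h ◁ h`, asymptoticity gives `∂ (f * h) ◁ ∂ h`; the term `f * ∂ h` is also below `∂ h`,
    -- so `∂ f * h` must be.
    ∂◁† : ∀ {f h} → ¬ (f ≈ 0#) → ¬ (h ≈ 0#) → f ◁ 1# → h ◁ 1# → ∂ f ◁ h †
    ∂◁† {f} {h} n m p q = *-cancelʳ-◁ h (◁-resp (trans (+-congʳ (∂-* f h)) (x+y-y _ _)) (∂≈†* m)
      (+-◁ (∂-mono◁ (*-≉0 n m) m fh◁h q) (neg-◁ (◁-resp refl (*-identityˡ _) (*-monoʳ-◁ (∂ h) ∂h≉0 p)))))
      where
      fh◁h : f * h ◁ h
      fh◁h = ◁-resp refl (*-identityˡ h) (*-monoʳ-◁ h m p)
      ∂h≉0 : ¬ (∂ h ≈ 0#)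
      ∂h≉0 e = 1≉0 (⊴0⇒≈0 (⊴-resp refl (trans (*-congʳ e) (zeroˡ _)) (1⊴† m (◁1⇒≁1 q))))

  -- Smallness of the derivation is derived by comparing `∂ f` with `h †` for an `h` realising max
  -- 0; replacing `h` by its inverse changes only the sign of `h †`.
  ∂-◁1 : ∀ {f} → f ◁ 1# → ∂ f ◁ 1#
  ∂-◁1 {f} p with f ≟0 | proj₂ max0
  ... | yes e | _ = ◁-resp (sym (trans (∂-cong e) ∂0)) refl (≉0⇒0◁ 1≉0)
  ... | no n | h , m , h≭1 , h† = ◁-¬¬ λ k → cmp h 1# λ
    { (inj₁ q) → k (◁-⊴-trans (∂◁† n m p q) h†⊴1)
    ; (inj₂ q) → cmp (h ⁻¹) 1# λ
       { (inj₁ r) → k (◁-⊴-trans (∂◁† n (⁻¹-≉0 m) p r) (⊴-trans (⊴-reflexive (†-inv m)) (neg-⊴ h†⊴1)))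
       ; (inj₂ r) → ~1⇒¬¬≍1 (⊴-resp (*-identityˡ h) (inverseˡ' h m) (*-monoʳ-⊴ h r) , q) h≭1 } }
    where
    h†⊴1 : h † ⊴ 1#
    h†⊴1 = ≼⇒⊴ (≍⇒≼ (≈0⇒≍1 h†))

  -- If `∂ f` were infinite, then `x = ∂ f ⁻¹` would be infinitesimal, and so would be `∂ (x * f)`
  -- and `∂ x * f`, although they differ by 1.
  ∂-⊴1 : ∀ {f} → f ⊴ 1# → ∂ f ⊴ 1#
  ∂-⊴1 {f} p = ⊴-by λ 1◁∂f →
    let n = ◁⇒≉0 1◁∂f
        x = ∂ f ⁻¹
        x◁1 : x ◁ 1#
        x◁1 = ◁-resp refl inv-1 (inv-◁ 1≉0 n 1◁∂f)
        xf◁1 : x * f ◁ 1#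
        xf◁1 = ⊴-◁-trans (⊴-trans (*-monoˡ-⊴ x p) (⊴-reflexive (*-identityʳ x))) x◁1
        ∂xf◁1 : ∂ x * f ◁ 1#
        ∂xf◁1 = ⊴-◁-trans (⊴-trans (*-monoˡ-⊴ (∂ x) p) (⊴-reflexive (*-identityʳ _))) (∂-◁1 x◁1)
        e : ∂ (x * f) - ∂ x * f ≈ 1#
        e = trans (+-congʳ (trans (∂-* x f) (+-comm _ _))) (trans (x+y-y _ _) (inverseˡ' (∂ f) n))
    in ◁-irrefl (◁-resp e refl (+-◁ (∂-◁1 xf◁1) (neg-◁ ∂xf◁1)))

  -- This is smallness of the derivation at `w ⁻¹`, whose derivative is `- (w † * w ⁻¹)`.
  †◁ : ∀ {w} → 1# ◁ w → w † ◁ w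
  †◁ {w} p = *-cancelʳ-◁ (w ⁻¹) (◁-resp (begin
      - ∂ (w ⁻¹) ≈⟨ -‿cong (∂≈†* (⁻¹-≉0 n)) ⟩
      - ((w ⁻¹) † * w ⁻¹) ≈⟨ -‿cong (*-congʳ (†-inv n)) ⟩
      - (- (w †) * w ⁻¹) ≈⟨ RP.-‿distribˡ-* _ _ ⟩
      - - (w †) * w ⁻¹ ≈⟨ *-congʳ (RP.-‿involutive _) ⟩
      w † * w ⁻¹ ∎) (sym (inverseʳ w n)) (neg-◁ (∂-◁1 u)))
    where
    n = ◁⇒≉0 p
    u : w ⁻¹ ◁ 1#
    u = ◁-resp refl inv-1 (inv-◁ 1≉0 n p)

  †⊴ : ∀ {w} → 1# ⊴ w → w † ⊴ w
  †⊴ {w} p = ⊴-¬¬ λ k → cmp 1# w λ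
    { (inj₁ q) → k (◁⇒⊴ (†◁ q))
    ; (inj₂ q) → k (⊴-trans (⊴-resp refl (*-identityˡ _) (*-mono-⊴ (∂-⊴1 q) ⊴-refl))
          (⊴-trans (⊴-trans (inv-⊴ 1≉0 p) (⊴-reflexive inv-1)) p)) }

  -- H-type forces ψ(γ) = o(γ): if x (x†)ⁿ ≽ 1 then x† ≼ (w⁻ⁿ)† ≍ w† ≺ w for w = x†.
  x†ⁿ◁ : ∀ {x} n → ¬ (x ≈ 0#) → x ◁ 1# → x * pow (x †) n ◁ 1#
  x†ⁿ◁ {x} zero m p = ◁-resp (sym (*-identityʳ x)) refl p
  x†ⁿ◁ {x} (suc n) m p = ◁-by λ q → cmp 1# w λ
    { (inj₂ r) → ⊴◁⊥ (⊴-trans q (⊴-trans (*-monoˡ-⊴ x (pow⊴1 (suc n) r)) (⊴-reflexive (*-identityʳ x)))) p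
    ; (inj₁ r) →
        let u = pow w (suc n) ⁻¹
            wn≉0 = pow-≉0 (suc n) w≉0
            u⊴x : u ⊴ x
            u⊴x = *-cancelʳ-⊴ (pow w (suc n)) wn≉0 (⊴-trans (⊴-reflexive (inverseˡ' _ wn≉0)) q)
            u† : u † ⊴ w †
            u† = ⊴-trans (⊴-reflexive (trans (†-inv wn≉0) (-‿cong (†-pow (suc n) w≉0))))
                   (neg-⊴ (⊴-trans (*-monoʳ-⊴ (w †) (proj₁ (nat~1 n))) (⊴-reflexive (*-identityˡ _))))
        in ⊴◁⊥ (⊴-trans (H-mono (⁻¹-≉0 wn≉0) m u⊴x p) u†) (†◁ r) }
    where
    w = x †
    w≉0 : ¬ (w ≈ 0#)
    w≉0 = ⊴-≉0 (1⊴† m (◁1⇒≁1 p)) 1≉0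

  -- With `s = k * pow w t` and `x = s * u`, the derivative of `u` stays bounded, and `s †` is `k †`
  -- plus a multiple of `w †`, hence at most `w`: each derivative costs one factor `w`.
  ∂-bound : ∀ {k w x} t → ¬ (k ≈ 0#) → 1# ⊴ w → k † ⊴ w → x ⊴ k * pow w t → ∂ x ⊴ k * pow w (suc t)
  ∂-bound {k} {w} {x} t n p q r = ⊴-trans (⊴-reflexive e₁) (⊴-trans (+-⊴ a b) (⊴-reflexive (solve 3 (λ k w p → (k :* p) :* w := k :* (w :* p)) refl k w (pow w t))))
    where
    w≉0 = ⊴-≉0 p 1≉0
    s = k * pow w t
    s≉0 : ¬ (s ≈ 0#)
    s≉0 = *-≉0 n (pow-≉0 t w≉0)
    u = x * s ⁻¹
    x≈ : x ≈ s * u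
    x≈ = trans (sym (cancel-inv' x s s≉0)) (*-comm _ _)
    u⊴1 : u ⊴ 1#
    u⊴1 = ⊴-trans (*-monoʳ-⊴ (s ⁻¹) r) (⊴-reflexive (inverseʳ s s≉0))
    s†⊴w : s † ⊴ w
    s†⊴w = ⊴-trans (⊴-reflexive (†-* n (pow-≉0 t w≉0))) (+-⊴ q (⊴-trans (⊴-reflexive (†-pow t w≉0))
             (⊴-trans (*-mono-⊴ (nat⊴1 t) (†⊴ p)) (⊴-reflexive (*-identityˡ w)))))
      where
      nat⊴1 : ∀ t → nat t ⊴ 1#
      nat⊴1 zero = 0⊴
      nat⊴1 (suc t) = proj₁ (nat~1 t)
    e₁ : ∂ x ≈ (∂ s * u) + (s * ∂ u)
    e₁ = trans (∂-cong x≈) (∂-* s u)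
    a : ∂ s * u ⊴ s * w
    a = ⊴-trans (*-mono-⊴ (⊴-reflexive (∂≈†* s≉0)) u⊴1) (⊴-trans (⊴-reflexive (*-identityʳ _)) (⊴-trans (*-monoʳ-⊴ s s†⊴w) (⊴-reflexive (*-comm _ _))))
    b : s * ∂ u ⊴ s * w
    b = *-monoˡ-⊴ s (⊴-trans (∂-⊴1 u⊴1) p)

-- Jets, symmetric multilinear forms and their behaviour under change of scale.

module Forms {c ℓ g gℓ} (F : ValuedDifferentialField c ℓ g gℓ)
  (hasy : ValuedDifferentialField.HAsymptotic F) (max0 : ValuedDifferentialField.Max0 F) (r : ℕ) where

  open MaxZero F hasy max0 public
  open Sol using (solve; _:*_; _:+_; _:=_)
  import Algebra.Properties.Ring ring as RP
  open import Relation.Binary.Reasoning.Setoid setoid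

  -- Jets

  V : Set c
  V = ℕ → Carrier

  σ : V → V
  σ x j = x (suc j)

  jet : Carrier → V
  jet u j = ∂^ j u

  -- mulJet h is the Leibniz rule on formal jets, arranged so that no binomial coefficients occur.
  mulJet : Carrier → V → V
  mulJet h x zero = h * x zero
  mulJet h x (suc j) = mulJet (∂ h) x j + mulJet h (σ x) j

  ∂^-+ : ∀ n x y → ∂^ n (x + y) ≈ ∂^ n x + ∂^ n y
  ∂^-+ zero x y = refl
  ∂^-+ (suc n) x y = trans (∂-cong (∂^-+ n x y)) (∂-+ _ _)

  ∂^-∂ : ∀ n x → ∂^ n (∂ x) ≈ ∂ (∂^ n x)
  ∂^-∂ zero x = refl
  ∂^-∂ (suc n) x = ∂-cong (∂^-∂ n x)

  ∂^-0 : ∀ n → ∂^ n 0# ≈ 0#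
  ∂^-0 zero = refl
  ∂^-0 (suc n) = trans (∂-cong (∂^-0 n)) ∂0

  ∂^-◁1 : ∀ {x} n → x ◁ 1# → ∂^ n x ◁ 1#
  ∂^-◁1 zero p = p
  ∂^-◁1 (suc n) p = ∂-◁1 (∂^-◁1 n p)

  mulJet-cong : ∀ {h h'} j {x x' : V} → h ≈ h' → (∀ i → i ℕ.≤ j → x i ≈ x' i) → mulJet h x j ≈ mulJet h' x' j
  mulJet-cong zero e f = *-cong e (f zero z≤n)
  mulJet-cong (suc j) e f = +-cong (mulJet-cong j (∂-cong e) (λ i p → f i (ℕP.m≤n⇒m≤1+n p))) (mulJet-cong j e (λ i p → f (suc i) (s≤s p)))

  mulJet-+ˡ : ∀ h k x j → mulJet (h + k) x j ≈ mulJet h x j + mulJet k x j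
  mulJet-+ˡ h k x zero = distribʳ _ _ _
  mulJet-+ˡ h k x (suc j) = trans (+-cong (trans (mulJet-cong j (∂-+ h k) (λ _ _ → refl)) (mulJet-+ˡ (∂ h) (∂ k) x j)) (mulJet-+ˡ h k (σ x) j))
    (+-interchange _ _ _ _)

  mulJet-+ʳ : ∀ h x y j → mulJet h (λ i → x i + y i) j ≈ mulJet h x j + mulJet h y j
  mulJet-+ʳ h x y zero = distribˡ _ _ _
  mulJet-+ʳ h x y (suc j) = trans (+-cong (mulJet-+ʳ (∂ h) x y j) (mulJet-+ʳ h (σ x) (σ y) j))
    (+-interchange _ _ _ _)

  mulJet-*ʳ : ∀ h a x j → mulJet h (λ i → a * x i) j ≈ a * mulJet h x j
  mulJet-*ʳ h a x zero = solve 3 (λ h a x → h :* (a :* x) := a :* (h :* x)) refl _ _ _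
  mulJet-*ʳ h a x (suc j) = trans (+-cong (mulJet-*ʳ (∂ h) a x j) (mulJet-*ʳ h a (σ x) j)) (sym (distribˡ _ _ _))

  mulJet-0ʳ : ∀ h x j → (∀ i → x i ≈ 0#) → mulJet h x j ≈ 0#
  mulJet-0ʳ h x zero e = trans (*-congˡ (e zero)) (zeroʳ h)
  mulJet-0ʳ h x (suc j) e = trans (+-cong (mulJet-0ʳ _ x j e) (mulJet-0ʳ h (σ x) j (λ i → e (suc i)))) (+-identityˡ _)

  mulJet-0ˡ : ∀ x j → mulJet 0# x j ≈ 0#
  mulJet-0ˡ x zero = zeroˡ _
  mulJet-0ˡ x (suc j) = trans (+-cong (trans (mulJet-cong j ∂0 (λ _ _ → refl)) (mulJet-0ˡ x j)) (mulJet-0ˡ (σ x) j)) (+-identityˡ _)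

  mulJet-1 : ∀ x j → mulJet 1# x j ≈ x j
  mulJet-1 x zero = *-identityˡ _
  mulJet-1 x (suc j) = trans (+-cong (trans (mulJet-cong j ∂1 (λ _ _ → refl)) (mulJet-0ˡ x j)) (mulJet-1 (σ x) j)) (+-identityˡ _)

  mulJet-assoc : ∀ h k x j → mulJet (h * k) x j ≈ mulJet h (mulJet k x) j
  mulJet-assoc h k x zero = *-assoc _ _ _
  mulJet-assoc h k x (suc j) = begin
    mulJet (∂ (h * k)) x j + mulJet (h * k) (σ x) j
      ≈⟨ +-cong (trans (mulJet-cong j (∂-* h k) (λ _ _ → refl)) (mulJet-+ˡ _ _ x j)) (mulJet-assoc h k (σ x) j) ⟩
    (mulJet (∂ h * k) x j + mulJet (h * ∂ k) x j) + mulJet h (mulJet k (σ x)) j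
      ≈⟨ +-cong (+-cong (mulJet-assoc (∂ h) k x j) (mulJet-assoc h (∂ k) x j)) refl ⟩
    (mulJet (∂ h) (mulJet k x) j + mulJet h (mulJet (∂ k) x) j) + mulJet h (mulJet k (σ x)) j
      ≈⟨ +-assoc _ _ _ ⟩
    mulJet (∂ h) (mulJet k x) j + (mulJet h (mulJet (∂ k) x) j + mulJet h (mulJet k (σ x)) j)
      ≈⟨ +-congˡ (sym (mulJet-+ʳ h _ _ j)) ⟩
    mulJet (∂ h) (mulJet k x) j + mulJet h (σ (mulJet k x)) j ∎

  mulJet-jet : ∀ h u j → mulJet h (jet u) j ≈ ∂^ j (h * u)
  mulJet-jet h u zero = refl
  mulJet-jet h u (suc j) = begin
    mulJet (∂ h) (jet u) j + mulJet h (σ (jet u)) j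
      ≈⟨ +-cong (mulJet-jet (∂ h) u j) (trans (mulJet-cong j refl (λ i _ → sym (∂^-∂ i u))) (mulJet-jet h (∂ u) j)) ⟩
    ∂^ j (∂ h * u) + ∂^ j (h * ∂ u) ≈⟨ sym (∂^-+ j _ _) ⟩
    ∂^ j (∂ h * u + h * ∂ u) ≈⟨ ∂^-cong j (sym (∂-* h u)) ⟩
    ∂^ j (∂ (h * u)) ≈⟨ ∂^-∂ j _ ⟩
    ∂ (∂^ j (h * u)) ∎

  unit : ℕ → V
  unit zero zero = 1#
  unit zero (suc i) = 0#
  unit (suc j) zero = 0#
  unit (suc j) (suc i) = unit j i

  jet1 : ∀ i → jet 1# i ≈ unit 0 i
  jet1 zero = refl
  jet1 (suc i) = trans (sym (∂^-∂ i 1#)) (trans (∂^-cong i ∂1) (∂^-0 i))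

  unit-sum : ∀ m (x : V) i → i ℕ.< m → x i ≈ sumFin m (λ l → x (toℕ l) * unit (toℕ l) i)
  unit-sum (suc m) x zero p = sym (trans (+-cong (*-identityʳ _) (sumFin-0 m (λ l → zeroʳ _))) (+-identityʳ _))
  unit-sum (suc m) x (suc i) (s≤s p) = trans (unit-sum m (σ x) i p) (sym (trans (+-congʳ (zeroʳ _)) (+-identityˡ _)))

  mulJet-sum : ∀ m h (a : Fin m → Carrier) (f : Fin m → V) j →
    mulJet h (λ i → sumFin m (λ l → a l * f l i)) j ≈ sumFin m (λ l → a l * mulJet h (f l) j)
  mulJet-sum zero h a f j = mulJet-0ʳ h _ j (λ _ → refl)
  mulJet-sum (suc m) h a f j = trans (mulJet-+ʳ h _ _ j) (+-cong (mulJet-*ʳ h _ _ j) (mulJet-sum m h _ _ j))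

  mulJet-expand : ∀ m h x j → j ℕ.< m → mulJet h x j ≈ sumFin m (λ l → x (toℕ l) * mulJet h (unit (toℕ l)) j)
  mulJet-expand m h x j p = trans (mulJet-cong j refl (λ i q → unit-sum m x i (ℕP.≤-<-trans q p))) (mulJet-sum m h _ _ j)

  mulJet-unit-< : ∀ h j i → i ℕ.< j → mulJet h (unit j) i ≈ 0#
  mulJet-unit-< h (suc j) zero p = zeroʳ h
  mulJet-unit-< h (suc j) (suc i) (s≤s p) = trans (+-cong (mulJet-unit-< (∂ h) (suc j) i (ℕP.m<n⇒m<1+n p)) (mulJet-unit-< h j i p)) (+-identityˡ _)

  mulJet-unit-≡ : ∀ h j → mulJet h (unit j) j ≈ h
  mulJet-unit-≡ h zero = *-identityʳ h
  mulJet-unit-≡ h (suc j) = trans (+-cong (mulJet-unit-< (∂ h) (suc j) j ℕP.≤-refl) (mulJet-unit-≡ h j)) (+-identityˡ _)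

  -- The entry is a binomial multiple of the derivative of `h` of order i - j, so `∂-bound` applies
  -- that many times; `t` counts the derivatives already taken.
  mulJet-unit-⊴ : ∀ {k w} → ¬ (k ≈ 0#) → 1# ⊴ w → k † ⊴ w → ∀ {h} t j i → h ⊴ k * pow w t → j ℕ.≤ i →
    mulJet h (unit j) i ⊴ k * pow w (t ℕ.+ (i ℕ.∸ j))
  mulJet-unit-⊴ n p q t zero zero b le = ⊴-resp (sym (*-identityʳ _)) (*-congˡ (reflexive (≡.cong (pow _) (≡.sym (ℕP.+-identityʳ t))))) b
  mulJet-unit-⊴ {k} {w} n p q {h} t zero (suc i) b le = +-⊴
    (⊴-resp refl (*-congˡ (reflexive (≡.cong (pow w) (≡.sym (ℕP.+-suc t i))))) (mulJet-unit-⊴ n p q (suc t) zero i (∂-bound t n p q b) z≤n))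
    (⊴-trans (⊴-reflexive (mulJet-0ʳ h _ i (λ _ → refl))) 0⊴)
  mulJet-unit-⊴ {k} {w} n p q {h} t (suc j) (suc i) b (s≤s le) = +-⊴ lem (mulJet-unit-⊴ n p q t j i b le)
    where
    lem : mulJet (∂ h) (unit (suc j)) i ⊴ k * pow w (t ℕ.+ (i ℕ.∸ j))
    lem with suc j ℕ.≤? i
    ... | yes le' = ⊴-resp refl (*-congˡ (reflexive (≡.cong (pow w)
            (≡.trans (≡.sym (ℕP.+-suc t _)) (≡.cong (t ℕ.+_) (≡.sym (ℕP.+-∸-assoc 1 le')))))))
            (mulJet-unit-⊴ n p q (suc t) (suc j) i (∂-bound t n p q b) le')
    ... | no ¬le = ⊴-trans (⊴-reflexive (mulJet-unit-< (∂ h) (suc j) i (ℕP.≰⇒> ¬le))) 0⊴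

  -- Symmetric multilinear forms

  m : ℕ
  m = suc r

  infixr 5 _∷∞_
  _∷∞_ : Carrier → V → V
  (a ∷∞ x) zero = a
  (a ∷∞ x) (suc i) = x i

  infix 4 _≈ᵥ_
  _≈ᵥ_ : V → V → Set ℓ
  x ≈ᵥ y = ∀ i → i ℕ.≤ m → x i ≈ y i

  _+ᵥ_ : V → V → V
  (x +ᵥ y) i = x i + y i

  _*ᵥ_ : Carrier → V → V
  (a *ᵥ x) i = a * x i

  lin : ∀ n → (Fin n → Carrier) → (Fin n → V) → V
  lin n a f i = sumFin n (λ l → a l * f l i)

  -- Coordinate 0 homogenises: a polynomial of degree N in y, y', …, y⁽ʳ⁾ is Φ (hat y, …, hat y) with N arguments,
  -- so that translations and rescalings act by linear substitutions.  Only coordinates up to m = r + 1 matter.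
  record Form : Set (c ⊔ ℓ) where
    no-eta-equality
    field
      ap : List V → Carrier
      hd-cong : ∀ {x y zs} → x ≈ᵥ y → ap (x ∷ zs) ≈ ap (y ∷ zs)
      hd-+ : ∀ x y zs → ap ((x +ᵥ y) ∷ zs) ≈ ap (x ∷ zs) + ap (y ∷ zs)
      hd-* : ∀ a x zs → ap ((a *ᵥ x) ∷ zs) ≈ a * ap (x ∷ zs)
      symm : ∀ {xs ys} → xs ↭ ys → ap xs ≈ ap ys
  open Form public

  -- Fixing arguments gives, up to a numerical factor, a partial derivative; this is how facts about
  -- forms of smaller degree reach the Taylor coefficients.
  pref : List V → Form → Form
  pref xs φ = record
    { ap = λ zs → ap φ (xs ++ zs)
    ; hd-cong = λ {x} {y} {zs} e → trans (mv x zs) (trans (hd-cong φ e) (sym (mv y zs)))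
    ; hd-+ = λ x y zs → trans (mv _ zs) (trans (hd-+ φ x y _) (+-cong (sym (mv x zs)) (sym (mv y zs))))
    ; hd-* = λ a x zs → trans (mv _ zs) (trans (hd-* φ a x _) (*-congˡ (sym (mv x zs))))
    ; symm = λ p → symm φ (++⁺ˡ xs p)
    }
    where
    mv : ∀ x zs → ap φ (xs ++ x ∷ zs) ≈ ap φ (x ∷ xs ++ zs)
    mv x zs = symm φ (shift x xs zs)

  suff : List V → Form → Form
  suff ts φ = record
    { ap = λ zs → ap φ (zs ++ ts)
    ; hd-cong = hd-cong φ
    ; hd-+ = λ x y zs → hd-+ φ x y (zs ++ ts)
    ; hd-* = λ a x zs → hd-* φ a x (zs ++ ts)
    ; symm = λ p → symm φ (++⁺ʳ ts p)
    }

  ap-0 : ∀ φ {x zs} → (∀ i → x i ≈ 0#) → ap φ (x ∷ zs) ≈ 0#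
  ap-0 φ {x} {zs} e = trans (hd-cong φ (λ i _ → trans (e i) (sym (zeroˡ (x i))))) (trans (hd-* φ 0# x zs) (zeroˡ _))

  ap-lin : ∀ φ n a f {x zs} → x ≈ᵥ lin n a f → ap φ (x ∷ zs) ≈ sumFin n (λ l → a l * ap φ (f l ∷ zs))
  ap-lin φ n a f {zs = zs} e = trans (hd-cong φ e) (go n a f)
    where
    go : ∀ n (a : Fin n → Carrier) f → ap φ (lin n a f ∷ zs) ≈ sumFin n (λ l → a l * ap φ (f l ∷ zs))
    go zero a f = ap-0 φ (λ _ → refl)
    go (suc n) a f = trans (hd-+ φ _ _ zs) (+-cong (hd-* φ _ _ zs) (go n (a ∘ fsuc) (f ∘ fsuc)))

  ap-cong : ∀ φ {xs ys} → Pointwise _≈ᵥ_ xs ys → ap φ xs ≈ ap φ ys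
  ap-cong φ [] = refl
  ap-cong φ {x ∷ xs} {y ∷ ys} (e ∷ es) = trans (hd-cong φ e) (ap-cong (pref (y ∷ []) φ) es)

  rep-cong : ∀ {x y} n → x ≈ᵥ y → Pointwise _≈ᵥ_ (replicate n x) (replicate n y)
  rep-cong zero e = []
  rep-cong (suc n) e = e ∷ rep-cong n e

  map-cong : ∀ {a} {A : Set a} {f h : A → V} (is : List A) → (∀ i → f i ≈ᵥ h i) → Pointwise _≈ᵥ_ (map f is) (map h is)
  map-cong [] e = []
  map-cong (i ∷ is) e = e i ∷ map-cong is e

  -- The j-th unit jet in the scale h.
  fh : Carrier → Fin m → V
  fh h j = 0# ∷∞ mulJet h (unit (toℕ j))

  hat : Carrier → V
  hat y = 1# ∷∞ jet y

  Smat : Carrier → Fin m → Fin m → Carrier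
  Smat k j l = mulJet k (unit (toℕ j)) (toℕ l)

  hat0-expand : ∀ h x → (0# ∷∞ mulJet h x) ≈ᵥ lin m (λ l → x (toℕ l)) (fh h)
  hat0-expand h x zero p = sym (sumFin-0 m (λ l → zeroʳ (x (toℕ l))))
  hat0-expand h x (suc i) p = mulJet-expand m h x i p

  fh-cong : ∀ {h h'} j → h ≈ h' → fh h j ≈ᵥ fh h' j
  fh-cong j e zero p = refl
  fh-cong j e (suc i) p = mulJet-cong i e (λ _ _ → refl)

  fh-expand : ∀ h k j → fh (h * k) j ≈ᵥ lin m (Smat k j) (fh h)
  fh-expand h k j zero p = hat0-expand h (mulJet k (unit (toℕ j))) zero p
  fh-expand h k j (suc i) p = trans (mulJet-assoc h k _ i) (hat0-expand h (mulJet k (unit (toℕ j))) (suc i) p)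

  jet-expand : ∀ h u → (0# ∷∞ jet (h * u)) ≈ᵥ lin m (λ l → ∂^ (toℕ l) u) (fh h)
  jet-expand h u zero p = hat0-expand h (jet u) zero p
  jet-expand h u (suc i) p = trans (sym (mulJet-jet h u i)) (hat0-expand h (jet u) (suc i) p)

  S-tri : ∀ k j l → toℕ l ℕ.< toℕ j → Smat k j l ≈ 0#
  S-tri k j l p = mulJet-unit-< k (toℕ j) (toℕ l) p

  S-diag : ∀ k j → Smat k j j ≈ k
  S-diag k j = mulJet-unit-≡ k (toℕ j)

  -- Conjugation by the diagonal matrix of the `pow w j` brings all entries of the triangular matrix
  -- down to the size `k` of its diagonal.
  S-wt : ∀ {k w} → ¬ (k ≈ 0#) → 1# ⊴ w → k † ⊴ w → ∀ j l → toℕ j ℕ.≤ toℕ l → Smat k j l * pow w (toℕ j) ⊴ k * pow w (toℕ l)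
  S-wt {k} {w} n p q j l le = ⊴-trans (*-monoʳ-⊴ _ (mulJet-unit-⊴ n p q 0 (toℕ j) (toℕ l) (⊴-reflexive (sym (*-identityʳ k))) le))
    (⊴-reflexive (trans (*-assoc _ _ _) (*-congˡ (trans (sym (pow-+ w (toℕ l ℕ.∸ toℕ j) (toℕ j))) (reflexive (≡.cong (pow w) (ℕP.m∸n+n≡m le)))))))

  -- Without weights the price is `pow w r`, the indices running from 0 to `r`.
  S-unif : ∀ {k w} → ¬ (k ≈ 0#) → 1# ⊴ w → k † ⊴ w → ∀ j l → Smat k j l ⊴ k * pow w r
  S-unif {k} {w} n p q j l with toℕ j ℕ.≤? toℕ l
  ... | yes le = ⊴-trans (mulJet-unit-⊴ n p q 0 (toℕ j) (toℕ l) (⊴-reflexive (sym (*-identityʳ k))) le)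
         (*-monoˡ-⊴ k (pow-≤ p (ℕP.≤-trans (ℕP.m∸n≤m (toℕ l) (toℕ j)) (ℕP.≤-pred (FP.toℕ<n l)))))
  ... | no ¬le = ⊴-trans (⊴-reflexive (S-tri k j l (ℕP.≰⇒> ¬le))) 0⊴

  -- Change of scale for words

  Word : Set
  Word = List (Fin m)

  _≤w_ : Word → Word → Set
  _≤w_ = Pointwise (λ j l → toℕ j ℕ.≤ toℕ l)

  wt : Word → ℕ
  wt [] = 0
  wt (j ∷ i) = toℕ j ℕ.+ wt i

  ≤w-len : ∀ {i i'} → i ≤w i' → length i' ≡ length i
  ≤w-len [] = ≡.refl
  ≤w-len (_ ∷ p) = ≡.cong suc (≤w-len p)

  ≤w-wt : ∀ {i i'} → i ≤w i' → wt i ℕ.≤ wt i'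
  ≤w-wt [] = z≤n
  ≤w-wt (p ∷ q) = ℕP.+-mono-≤ p (≤w-wt q)

  -- `Q e x` reads: `x` is bounded by `pow s e` times a fixed quantity. The sense of "bounded" stays
  -- abstract so that one induction on words serves both `⊴` and `◁`.
  record Bnd (s : Carrier) : Set (c ⊔ ℓ ⊔ lsuc gℓ) where
    field
      Q : ℕ → Carrier → Set gℓ
      Q-0 : ∀ e → Q e 0#
      Q-+ : ∀ e {x y} → Q e x → Q e y → Q e (x + y)
      Q-≈ : ∀ e {x y} → x ≈ y → Q e x → Q e y
      Q-step : ∀ e {a b x} → a ⊴ s * b → Q e (b * x) → Q (suc e) (a * x)
  open Bnd

  Q-sum : ∀ {s} (B : Bnd s) e n {f : Fin n → Carrier} → (∀ i → Q B e (f i)) → Q B e (sumFin n f)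
  Q-sum B e zero p = Q-0 B e
  Q-sum B e (suc n) p = Q-+ B e (p fzero) (Q-sum B e n (λ i → p (fsuc i)))

  Bnd⊴ : ∀ s B → Bnd s
  Bnd⊴ s B = record
    { Q = λ e x → x ⊴ pow s e * B
    ; Q-0 = λ e → 0⊴
    ; Q-+ = λ e → +-⊴
    ; Q-≈ = λ e q → ⊴-resp q refl
    ; Q-step = λ e {a} {b} {x} p q → ⊴-trans (*-monoʳ-⊴ x p) (⊴-resp (sym (*-assoc _ _ _)) (sym (*-assoc _ _ _)) (*-monoˡ-⊴ s q))
    }

  Bnd◁ : ∀ s B → ¬ (s ≈ 0#) → ¬ (B ≈ 0#) → Bnd s
  Bnd◁ s B s≉0 B≉0 = record
    { Q = λ e x → x ◁ pow s e * B
    ; Q-0 = λ e → ≉0⇒0◁ (*-≉0 (pow-≉0 e s≉0) B≉0)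
    ; Q-+ = λ e → +-◁
    ; Q-≈ = λ e q → ◁-resp q refl
    ; Q-step = λ e {a} {b} {x} p q → ⊴-◁-trans (*-monoʳ-⊴ x p) (◁-resp (sym (*-assoc _ _ _)) (sym (*-assoc _ _ _)) (*-monoˡ-◁ s s≉0 q))
    }

  -- The weights `ρ` are constantly 1 for crude bounds, and powers of a logarithmic derivative when
  -- the size of a leading coefficient must be found exactly. In both uses `s` is the price of one
  -- letter.
  module Scale (S : Fin m → Fin m → Carrier) (f f̃ : Fin m → V) (exp : ∀ j → f̃ j ≈ᵥ lin m (S j) f)
    (tri : ∀ j l → toℕ l ℕ.< toℕ j → S j l ≈ 0#) (ρ : Fin m → Carrier) (s : Carrier)
    (bd : ∀ j l → toℕ j ℕ.≤ toℕ l → S j l * ρ j ⊴ s * ρ l) where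

    R : Word → Carrier
    R [] = 1#
    R (j ∷ i) = ρ j * R i

    -- One letter is expanded at a time: `φ` stores the letters already replaced and `X` their
    -- weights. Triangularity restricts the hypothesis to words that are letterwise at least `i`.
    scale : (B : Bnd s) → ∀ i φ X → (∀ i' → i ≤w i' → Q B 0 (X * (ap φ (map f i') * R i'))) →
      Q B (length i) (X * (ap φ (map f̃ i) * R i))
    scale B [] φ X hyp = hyp [] []
    scale B (j ∷ i) φ X hyp = Q-≈ B _ (sym eq) (Q-sum B _ m term)
      where
      A : Fin m → Carrier
      A l = ap φ (f l ∷ map f̃ i)
      eq : X * (ap φ (f̃ j ∷ map f̃ i) * (ρ j * R i)) ≈ sumFin m (λ l → (S j l * ρ j) * (X * (A l * R i)))
      eq = begin
        X * (ap φ (f̃ j ∷ map f̃ i) * (ρ j * R i)) ≈⟨ *-congˡ (*-congʳ (ap-lin φ m (S j) f (exp j))) ⟩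
        X * (sumFin m (λ l → S j l * A l) * (ρ j * R i)) ≈⟨ solve 4 (λ X s p R → X :* (s :* (p :* R)) := (X :* (p :* R)) :* s) refl X _ (ρ j) (R i) ⟩
        (X * (ρ j * R i)) * sumFin m (λ l → S j l * A l) ≈⟨ sym (sumFin-*ˡ m _ (λ l → S j l * A l)) ⟩
        sumFin m (λ l → (X * (ρ j * R i)) * (S j l * A l)) ≈⟨ sumFin-cong m (λ l → solve 5 (λ X p R S A → (X :* (p :* R)) :* (S :* A) := (S :* p) :* (X :* (A :* R))) refl X (ρ j) (R i) (S j l) (A l)) ⟩
        sumFin m (λ l → (S j l * ρ j) * (X * (A l * R i))) ∎
      term : ∀ l → Q B (suc (length i)) ((S j l * ρ j) * (X * (A l * R i)))
      term l with toℕ j ℕ.≤? toℕ l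
      ... | no ¬le = Q-≈ B _ (sym (trans (*-congʳ (trans (*-congʳ (tri j l (ℕP.≰⇒> ¬le))) (zeroˡ _))) (zeroˡ _))) (Q-0 B _)
      ... | yes le = Q-step B _ (bd j l le) (Q-≈ B _ (solve 4 (λ X p A R → (X :* p) :* (A :* R) := p :* (X :* (A :* R))) refl X (ρ l) (A l) (R i))
          (scale B i (pref (f l ∷ []) φ) (X * ρ l) (λ i' p → Q-≈ B 0
            (solve 4 (λ X a p R → X :* (a :* (p :* R)) := (X :* p) :* (a :* R)) refl X (ap φ (f l ∷ map f i')) (ρ l) (R i'))
            (hyp (l ∷ i') (le ∷ p)))))

    -- The lower left part of the change of scale only contributes words of larger weight.
    exact : (∀ j → S j j ≈ s) → ¬ (s ≈ 0#) → ∀ {B} → ¬ (B ≈ 0#) → ∀ i φ X →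
      (∀ i' → i ≤w i' → wt i ℕ.< wt i' → X * (ap φ (map f i') * R i') ◁ B) →
      X * ((ap φ (map f̃ i) - pow s (length i) * ap φ (map f i)) * R i) ◁ pow s (length i) * B
    exact diag s≉0 {B} B≉0 [] φ X hyp = ◁-resp (sym (trans (*-congˡ (trans (*-congʳ (trans (+-congˡ (-‿cong (*-identityˡ _))) (-‿inverseʳ _))) (zeroˡ _))) (zeroʳ _))) refl
      (≉0⇒0◁ (*-≉0 1≉0 B≉0))
    exact diag s≉0 {B} B≉0 (j ∷ i) φ X hyp = ◁-resp (sym eq) refl (sumFin-◁ m (*-≉0 (pow-≉0 (suc (length i)) s≉0) B≉0) term)
      where
      Y = X * (ρ j * R i)
      b = pow s (suc (length i)) * ap φ (f j ∷ map f i)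
      A : Fin m → Carrier
      A l = ap φ (f l ∷ map f̃ i)
      -- A Kronecker delta carrying `b`, which lets the subtraction enter the sum over `l`.
      δ : Fin m → Carrier
      δ l with j FP.≟ l
      ... | yes _ = b
      ... | no _ = 0#
      δ-j : δ j ≈ b
      δ-j with j FP.≟ j
      ... | yes _ = refl
      ... | no n = ⊥-elim (n ≡.refl)
      δ-n : ∀ l → ¬ (j ≡ l) → δ l ≈ 0#
      δ-n l n with j FP.≟ l
      ... | yes e = ⊥-elim (n e)
      ... | no _ = refl
      eq : X * ((ap φ (f̃ j ∷ map f̃ i) - b) * (ρ j * R i)) ≈ sumFin m (λ l → Y * (S j l * A l - δ l))
      eq = begin
        X * ((ap φ (f̃ j ∷ map f̃ i) - b) * (ρ j * R i)) ≈⟨ solve 4 (λ X s p R → X :* (s :* (p :* R)) := (X :* (p :* R)) :* s) refl X _ (ρ j) (R i) ⟩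
        Y * (ap φ (f̃ j ∷ map f̃ i) - b) ≈⟨ *-congˡ (+-cong (ap-lin φ m (S j) f (exp j)) (-‿cong (sym (trans (sumFin-single m j δ δ-n) δ-j)))) ⟩
        Y * (sumFin m (λ l → S j l * A l) - sumFin m δ) ≈⟨ *-congˡ (+-congˡ (neg-sum m δ)) ⟩
        Y * (sumFin m (λ l → S j l * A l) + sumFin m (λ l → - δ l)) ≈⟨ *-congˡ (sym (sumFin-+ m (λ l → S j l * A l) (λ l → - δ l))) ⟩
        Y * sumFin m (λ l → S j l * A l - δ l) ≈⟨ sym (sumFin-*ˡ m Y (λ l → S j l * A l - δ l)) ⟩
        sumFin m (λ l → Y * (S j l * A l - δ l)) ∎
        where
        neg-sum : ∀ n (h : Fin n → Carrier) → - sumFin n h ≈ sumFin n (λ l → - h l)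
        neg-sum zero h = RP.-0#≈0#
        neg-sum (suc n) h = trans (sym (RP.-‿+-comm _ _)) (+-congˡ (neg-sum n (h ∘ fsuc)))
      term : ∀ l → Y * (S j l * A l - δ l) ◁ pow s (suc (length i)) * B
      term l with j FP.≟ l
      ... | yes ≡.refl = ◁-resp (sym e) (sym (*-assoc _ _ _)) (*-monoˡ-◁ s s≉0 ih)
        where
        ih = exact diag s≉0 B≉0 i (pref (f j ∷ []) φ) (X * ρ j) (λ i' p q → ◁-resp
               (solve 4 (λ X a p R → X :* (a :* (p :* R)) := (X :* p) :* (a :* R)) refl X (ap φ (f j ∷ map f i')) (ρ j) (R i')) refl
               (hyp (j ∷ i') (ℕP.≤-refl ∷ p) (ℕP.+-monoʳ-< (toℕ j) q)))
        a = ap φ (f j ∷ map f i)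
        e : Y * (S j j * A j - b) ≈ s * ((X * ρ j) * ((A j - pow s (length i) * a) * R i))
        e = begin
          Y * (S j j * A j - b) ≈⟨ *-congˡ (+-cong (*-congʳ (diag j)) (trans (-‿cong (*-assoc _ _ _)) (RP.-‿distribʳ-* s _))) ⟩
          Y * (s * A j + s * - (pow s (length i) * a)) ≈⟨ solve 6 (λ X p R s A t → (X :* (p :* R)) :* (s :* A :+ s :* t) := s :* ((X :* p) :* ((A :+ t) :* R))) refl X (ρ j) (R i) s (A j) _ ⟩
          s * ((X * ρ j) * ((A j - pow s (length i) * a) * R i)) ∎
      ... | no j≢l with toℕ j ℕ.≤? toℕ l
      ...   | no ¬le = ◁-resp (sym (trans (*-congˡ (trans (+-cong (trans (*-congʳ (tri j l (ℕP.≰⇒> ¬le))) (zeroˡ _)) RP.-0#≈0#) (+-identityˡ _))) (zeroʳ _))) refl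
                       (≉0⇒0◁ (*-≉0 (pow-≉0 (suc (length i)) s≉0) B≉0))
      -- Off the diagonal the first letter has grown, so all words that occur are heavier than
      -- `j ∷ i`, and `scale` for `◁` suffices.
      ...   | yes le = ◁-resp e refl (Q-step (Bnd◁ s B s≉0 B≉0) (length i) (bd j l le) (◁-resp (solve 4 (λ X p A R → (X :* p) :* (A :* R) := p :* (X :* (A :* R))) refl X (ρ l) (A l) (R i)) refl
          (scale (Bnd◁ s B s≉0 B≉0) i (pref (f l ∷ []) φ) (X * ρ l) (λ i' p → ◁-resp
            (solve 4 (λ X a p R → X :* (a :* (p :* R)) := (X :* p) :* (a :* R)) refl X (ap φ (f l ∷ map f i')) (ρ l) (R i')) (sym (*-identityˡ B))
            (hyp (l ∷ i') (le ∷ p) (ℕP.+-mono-<-≤ (ℕP.≤∧≢⇒< le (λ q → j≢l (FP.toℕ-injective q))) (≤w-wt p)))))))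
        where
        e : (S j l * ρ j) * (X * (A l * R i)) ≈ Y * (S j l * A l - 0#)
        e = trans (solve 5 (λ X p R S A → (S :* p) :* (X :* (A :* R)) := (X :* (p :* R)) :* (S :* A)) refl X (ρ j) (R i) (S j l) (A l))
              (*-congˡ (sym (trans (+-congˡ RP.-0#≈0#) (+-identityʳ _))))

-- Taylor expansion of forms, and kernels of linear differential operators.

module Expansion {c ℓ g gℓ} (F : ValuedDifferentialField c ℓ g gℓ)
  (hasy : ValuedDifferentialField.HAsymptotic F) (max0 : ValuedDifferentialField.Max0 F) (r : ℕ) where

  open Forms F hasy max0 r public
  open Sol using (solve; _:*_; _:+_; _:=_)
  import Algebra.Properties.Ring ring as RP
  open import Relation.Binary.Reasoning.Setoid setoid

  -- Expansion around a centre

  pick : ∀ {n} → V → (Fin n → V) → Maybe (Fin n) → V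
  pick A f nothing = A
  pick A f (just j) = f j

  justs : ∀ {n} → List (Maybe (Fin n)) → List (Fin n)
  justs [] = []
  justs (nothing ∷ cs) = justs cs
  justs (just j ∷ cs) = j ∷ justs cs

  nots : ∀ {n} → List (Maybe (Fin n)) → ℕ
  nots [] = 0
  nots (nothing ∷ cs) = suc (nots cs)
  nots (just j ∷ cs) = nots cs

  deg : ∀ {n} → List (Maybe (Fin n)) → ℕ
  deg cs = length (justs cs)

  deg+nots : ∀ {n} (cs : List (Maybe (Fin n))) → deg cs ℕ.+ nots cs ≡ length cs
  deg+nots [] = ≡.refl
  deg+nots (nothing ∷ cs) = ≡.trans (ℕP.+-suc _ _) (≡.cong suc (deg+nots cs))
  deg+nots (just j ∷ cs) = ≡.cong suc (deg+nots cs)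

  sort-choices : ∀ {n} A (f : Fin n → V) cs → map (pick A f) cs ↭ map f (justs cs) ++ replicate (nots cs) A
  sort-choices A f [] = ↭-refl
  sort-choices A f (nothing ∷ cs) = ↭-trans (Perm.prep A (sort-choices A f cs)) (↭-sym (shift A (map f (justs cs)) (replicate (nots cs) A)))
  sort-choices A f (just j ∷ cs) = Perm.prep (f j) (sort-choices A f cs)

  ap-sort : ∀ {n} φ A (f : Fin n → V) cs → ap φ (map (pick A f) cs) ≈ ap φ (map f (justs cs) ++ replicate (nots cs) A)
  ap-sort φ A f cs = symm φ (sort-choices A f cs)

  head-choice : ∀ {n} φ A (f : Fin n → V) l N → ap φ (map (pick A f) (just l ∷ replicate N nothing)) ≈ ap φ (f l ∷ replicate N A)
  head-choice φ A f l N = reflexive (≡.cong (λ t → ap φ (f l ∷ t)) (LP.map-replicate (pick A f) N nothing))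

  -- Telescoping over the arguments. `P` holds for the coefficients of positive degree and `Q` is
  -- wanted for the difference; what links them is that multiplication by the coordinates `x l`
  -- turns `P` into `Q`.
  shift-centre : ∀ {p q} (P : Carrier → Set p) (Q : Carrier → Set q) →
    (∀ {x y} → x ≈ y → P x → P y) → (∀ {x y} → P x → P y → P (x + y)) → (∀ {x} → Q x → P x) →
    Q 0# → (∀ {x y} → x ≈ y → Q x → Q y) → (∀ {x y} → Q x → Q y → Q (x + y)) →
    ∀ {n} A (x : Fin n → Carrier) (f : Fin n → V) → (∀ l {z} → P z → Q (x l * z)) →
    ∀ N φ → (∀ cs → length cs ≡ N → 1 ℕ.≤ deg cs → P (ap φ (map (pick A f) cs))) →
    Q (ap φ (replicate N (A +ᵥ lin n x f)) - ap φ (replicate N A))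
  shift-centre P Q P-≈ P-+ Q⊆P Q-0 Q-≈ Q-+ {n} A x f xQ = go
    where
    A' = A +ᵥ lin n x f
    Q-sum' : ∀ k {h : Fin k → Carrier} → (∀ i → Q (h i)) → Q (sumFin k h)
    Q-sum' zero q = Q-0
    Q-sum' (suc k) q = Q-+ (q fzero) (Q-sum' k (λ i → q (fsuc i)))
    go : ∀ N φ → (∀ cs → length cs ≡ N → 1 ℕ.≤ deg cs → P (ap φ (map (pick A f) cs))) → Q (ap φ (replicate N A') - ap φ (replicate N A))
    go zero φ hyp = Q-≈ (sym (-‿inverseʳ _)) Q-0
    go (suc N) φ hyp = Q-≈ (sym eq) (Q-+ (go N (pref (A ∷ []) φ) (λ cs e d → hyp (nothing ∷ cs) (≡.cong suc e) d)) (Q-sum' n (λ l → xQ l (Pl l))))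
      where
      X = ap φ (A ∷ replicate N A')
      Pl : ∀ l → P (ap φ (f l ∷ replicate N A'))
      Pl l = P-≈ (x-y+y _ _) (P-+
        (Q⊆P (go N (pref (f l ∷ []) φ) (λ cs e d → hyp (just l ∷ cs) (≡.cong suc e) (s≤s z≤n))))
        (P-≈ (head-choice φ A f l N) (hyp (just l ∷ replicate N nothing) (≡.cong suc (LP.length-replicate N)) (s≤s z≤n))))
      eq : ap φ (A' ∷ replicate N A') - ap φ (A ∷ replicate N A) ≈
           (X - ap φ (A ∷ replicate N A)) + sumFin n (λ l → x l * ap φ (f l ∷ replicate N A'))
      eq = begin
        ap φ (A' ∷ replicate N A') - ap φ (A ∷ replicate N A) ≈⟨ +-congʳ (hd-+ φ A _ _) ⟩
        (X + ap φ (lin n x f ∷ replicate N A')) - ap φ (A ∷ replicate N A) ≈⟨ +-congʳ (+-congˡ (ap-lin φ n x f (λ _ _ → refl))) ⟩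
        (X + sumFin n _) - ap φ (A ∷ replicate N A) ≈⟨ solve 3 (λ a b d → (a :+ b) :+ d := (a :+ d) :+ b) refl X _ _ ⟩
        (X - ap φ (A ∷ replicate N A)) + sumFin n (λ l → x l * ap φ (f l ∷ replicate N A')) ∎

  perturb : ∀ {n} A (x : Fin n → Carrier) (f : Fin n → V) M → ¬ (M ≈ 0#) → (∀ l → x l ◁ 1#) → ∀ N φ →
    (∀ cs → length cs ≡ N → 1 ℕ.≤ deg cs → ap φ (map (pick A f) cs) ⊴ M) →
    ap φ (replicate N (A +ᵥ lin n x f)) - ap φ (replicate N A) ◁ M
  perturb A x f M M≉0 xs = shift-centre (_⊴ M) (_◁ M) (λ e → ⊴-resp e refl) +-⊴ ◁⇒⊴ (≉0⇒0◁ M≉0) (λ e → ◁-resp e refl) +-◁ A x f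
    (λ l p → ◁-resp refl (*-identityˡ M) (*-mono-◁⊴ (xs l) p M≉0))

  first-order : ∀ A B M → ¬ (M ≈ 0#) → ∀ N φ →
    (∀ (cs : List (Maybe (Fin 1))) → length cs ≡ N → 1 ℕ.≤ deg cs → ap φ (map (pick A (λ _ → B)) cs) ◁ M) →
    ap φ (replicate N (A +ᵥ B)) - ap φ (replicate N A) ◁ M
  first-order A B M M≉0 N φ hyp = ◁-resp (+-congʳ (ap-cong φ (rep-cong N (λ i _ → +-congˡ (trans (+-identityʳ _) (*-identityˡ _)))))) refl
    (shift-centre (_◁ M) (_◁ M) (λ e → ◁-resp e refl) +-◁ (λ p → p) (≉0⇒0◁ M≉0) (λ e → ◁-resp e refl) +-◁ {1} A (λ _ → 1#) (λ _ → B)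
      (λ l p → ◁-resp (sym (*-identityˡ _)) refl p) N φ hyp)

  -- The first argument is split: with `A` in it induction applies, with `B` in it only terms of
  -- positive degree in the others are left to discard. The factor `nat (suc N)` counts the
  -- positions of the single `B`.
  second-order : ∀ A B M → ¬ (M ≈ 0#) → ∀ N φ →
    (∀ (cs : List (Maybe (Fin 1))) → length cs ≡ suc N → 2 ℕ.≤ deg cs → ap φ (map (pick A (λ _ → B)) cs) ◁ M) →
    ap φ (replicate (suc N) (A +ᵥ B)) - (ap φ (replicate (suc N) A) + nat (suc N) * ap φ (B ∷ replicate N A)) ◁ M
  second-order A B M M≉0 zero φ hyp = ◁-resp (sym (trans (+-cong (hd-+ φ A B []) (-‿cong (+-congˡ (trans (*-congʳ (+-identityʳ 1#)) (*-identityˡ _))))) (-‿inverseʳ _))) refl (≉0⇒0◁ M≉0)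
  second-order A B M M≉0 (suc N) φ hyp = ◁-resp (sym eq) refl (+-◁
      (second-order A B M M≉0 N (pref (A ∷ []) φ) (λ cs e d → hyp (nothing ∷ cs) (≡.cong suc e) d))
      (first-order A B M M≉0 (suc N) (pref (B ∷ []) φ) (λ cs e d → hyp (just fzero ∷ cs) (≡.cong suc e) (s≤s d))))
    where
    A' = A +ᵥ B
    X = ap φ (A ∷ replicate (suc N) A')
    Y = ap φ (B ∷ replicate (suc N) A')
    a = ap φ (A ∷ A ∷ replicate N A)
    b = ap φ (B ∷ A ∷ replicate N A)
    b' = ap φ (A ∷ B ∷ replicate N A)
    k = nat (suc N)
    eq : ap φ (A' ∷ replicate (suc N) A') - (a + (1# + k) * b) ≈ (X - (a + k * b')) + (Y - b)
    eq = begin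
      ap φ (A' ∷ replicate (suc N) A') - (a + (1# + k) * b) ≈⟨ +-cong (hd-+ φ A B _) (-‿cong (trans (solve 4 (λ a o k b → a :+ (o :+ k) :* b := (a :+ k :* b) :+ o :* b) refl a 1# k b)
         (+-cong (+-congˡ (*-congˡ (symm φ (Perm.swap B A ↭-refl)))) (*-identityˡ b)))) ⟩
      (X + Y) - ((a + k * b') + b) ≈⟨ +-congˡ (sym (RP.-‿+-comm _ _)) ⟩
      (X + Y) + (- (a + k * b') + - b) ≈⟨ solve 4 (λ x y u w → (x :+ y) :+ (u :+ w) := (x :+ u) :+ (y :+ w)) refl X Y _ _ ⟩
      (X - (a + k * b')) + (Y - b) ∎

  -- Kernels of linear differential operators

  ∂≉0 : ∀ {x} → ¬ (x ≈ 0#) → x ◁ 1# → ¬ (∂ x ≈ 0#)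
  ∂≉0 n p e = 1≉0 (⊴0⇒≈0 (⊴-resp refl (trans (*-congʳ e) (zeroˡ _)) (1⊴† n (◁1⇒≁1 p))))

  -- Reduction of order: division by `k₀` turns one solution into 1, and the derivatives of the
  -- other quotients are killed by an operator on one coordinate fewer. Max 0 keeps these
  -- derivatives nonzero and asymptoticity keeps their values distinct, which replaces linear
  -- independence over the constants.
  kernel-count : ∀ n (τ : V → Carrier) → (∀ {x y} → (∀ i → i ℕ.< n → x i ≈ y i) → τ x ≈ τ y) →
    (∀ x y → τ (x +ᵥ y) ≈ τ x + τ y) → (∀ a x → τ (a *ᵥ x) ≈ a * τ x) → ¬ (∀ x → τ x ≈ 0#) →
    (k : Fin n → Carrier) → (∀ i → ¬ (k i ≈ 0#)) → (∀ i j → toℕ i ℕ.< toℕ j → k j ◁ k i) → (∀ i → τ (jet (k i)) ≈ 0#) → ⊥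
  kernel-count zero τ cg ad sc nz k k≉0 dec ker = nz λ x → trans (cg {x} {0# *ᵥ x} (λ i ())) (trans (sc 0# x) (zeroˡ _))
  kernel-count (suc n) τ cg ad sc nz k k≉0 dec ker = kernel-count n τ' cg' ad' sc' nz' t t≉0 dec' ker'
    where
    k₀ = k fzero
    k₀≉0 = k≉0 fzero
    x₁ : Fin n → Carrier
    x₁ i = k (fsuc i) * k₀ ⁻¹
    x₁≉0 : ∀ i → ¬ (x₁ i ≈ 0#)
    x₁≉0 i = *-≉0 (k≉0 (fsuc i)) (⁻¹-≉0 k₀≉0)
    x₁◁1 : ∀ i → x₁ i ◁ 1#
    x₁◁1 i = ◁-resp refl (inverseʳ k₀ k₀≉0) (*-monoʳ-◁ (k₀ ⁻¹) (⁻¹-≉0 k₀≉0) (dec fzero (fsuc i) (s≤s z≤n)))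
    t : Fin n → Carrier
    t i = ∂ (x₁ i)
    t≉0 : ∀ i → ¬ (t i ≈ 0#)
    t≉0 i = ∂≉0 (x₁≉0 i) (x₁◁1 i)
    dec' : ∀ i j → toℕ i ℕ.< toℕ j → t j ◁ t i
    dec' i j p = ∂-mono◁ (x₁≉0 j) (x₁≉0 i) (*-monoʳ-◁ (k₀ ⁻¹) (⁻¹-≉0 k₀≉0) (dec (fsuc i) (fsuc j) (s≤s p))) (x₁◁1 i)
    τ' : V → Carrier
    τ' x = τ (mulJet k₀ (0# ∷∞ x))
    cg' : ∀ {x y} → (∀ i → i ℕ.< n → x i ≈ y i) → τ' x ≈ τ' y
    cg' {x} {y} e = cg λ i p → mulJet-cong i refl λ { zero q → refl ; (suc i') q → e i' (ℕP.≤-trans q (ℕP.≤-pred p)) }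
    ad' : ∀ x y → τ' (x +ᵥ y) ≈ τ' x + τ' y
    ad' x y = trans (cg λ i _ → trans (mulJet-cong i refl λ { zero _ → sym (+-identityˡ 0#) ; (suc _) _ → refl }) (mulJet-+ʳ k₀ (0# ∷∞ x) (0# ∷∞ y) i)) (ad _ _)
    sc' : ∀ a x → τ' (a *ᵥ x) ≈ a * τ' x
    sc' a x = trans (cg λ i _ → trans (mulJet-cong i refl λ { zero _ → sym (zeroʳ a) ; (suc _) _ → refl }) (mulJet-*ʳ k₀ a (0# ∷∞ x) i)) (sc a _)
    -- The coordinate 0 of `z` contributes a multiple of `τ (jet k₀)`, which is 0.
    split : ∀ z → τ (mulJet k₀ z) ≈ τ' (σ z)
    split z = begin
      τ (mulJet k₀ z) ≈⟨ cg (λ i _ → trans (mulJet-cong i {z} {(z zero *ᵥ unit 0) +ᵥ (0# ∷∞ σ z)} refl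
                            λ { zero _ → sym (trans (+-identityʳ _) (*-identityʳ _)) ; (suc _) _ → sym (trans (+-congʳ (zeroʳ _)) (+-identityˡ _)) })
                            (trans (mulJet-+ʳ k₀ _ _ i) (+-congʳ (mulJet-*ʳ k₀ _ _ i)))) ⟩
      τ ((z zero *ᵥ mulJet k₀ (unit 0)) +ᵥ mulJet k₀ (0# ∷∞ σ z)) ≈⟨ ad _ _ ⟩
      τ (z zero *ᵥ mulJet k₀ (unit 0)) + τ' (σ z) ≈⟨ +-congʳ (sc _ _) ⟩
      z zero * τ (mulJet k₀ (unit 0)) + τ' (σ z) ≈⟨ +-congʳ (*-congˡ (trans (cg λ i _ → trans (mulJet-cong i refl (λ i _ → sym (jet1 i)))
            (trans (mulJet-jet k₀ 1# i) (∂^-cong i (*-identityʳ k₀)))) (ker fzero))) ⟩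
      z zero * 0# + τ' (σ z) ≈⟨ trans (+-congʳ (zeroʳ _)) (+-identityˡ _) ⟩
      τ' (σ z) ∎
    nz' : ¬ (∀ x → τ' x ≈ 0#)
    nz' h = nz λ x → trans (cg λ i _ → trans (sym (mulJet-1 x i)) (trans (mulJet-cong i (sym (inverseʳ k₀ k₀≉0)) (λ _ _ → refl)) (mulJet-assoc k₀ (k₀ ⁻¹) x i)))
      (trans (split (mulJet (k₀ ⁻¹) x)) (h _))
    ker' : ∀ i → τ' (jet (t i)) ≈ 0#
    ker' i = begin
      τ' (jet (t i)) ≈⟨ cg' (λ j _ → ∂^-∂ j (x₁ i)) ⟩
      τ' (σ (jet (x₁ i))) ≈⟨ sym (split (jet (x₁ i))) ⟩
      τ (mulJet k₀ (jet (x₁ i))) ≈⟨ cg (λ j _ → trans (mulJet-jet k₀ (x₁ i) j) (∂^-cong j (trans (*-comm _ _) (cancel-inv' _ _ k₀≉0)))) ⟩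
      τ (jet (k (fsuc i))) ≈⟨ ker (fsuc i) ⟩
      0# ∎

-- The ground field as a subset of its extension.

module GroundField {c ℓ g gℓ} (F : ValuedDifferentialField c ℓ g gℓ)
  (hasy : ValuedDifferentialField.HAsymptotic F) (max0 : ValuedDifferentialField.Max0 F) where

  open MaxZero F hasy max0

  -- A predicate on the larger field, so that all computation takes place in one field. Existence is
  -- doubly negated because hypotheses in terms of `⊴`, as in `henselian`, can be read in K only
  -- under a double negation.
  record Ground (p : Level) : Set (c ⊔ ℓ ⊔ gℓ ⊔ lsuc p) where
    field
      𝒦 : Carrier → Set p
      𝒦-≈ : ∀ {x y} → x ≈ y → 𝒦 x → 𝒦 y
      𝒦-0 : 𝒦 0#
      𝒦-1 : 𝒦 1#
      𝒦-+ : ∀ {x y} → 𝒦 x → 𝒦 y → 𝒦 (x + y)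
      𝒦-* : ∀ {x y} → 𝒦 x → 𝒦 y → 𝒦 (x * y)
      𝒦-neg : ∀ {x} → 𝒦 x → 𝒦 (- x)
      𝒦-inv : ∀ {x} → ¬ (x ≈ 0#) → 𝒦 x → 𝒦 (x ⁻¹)
      𝒦-∂ : ∀ {x} → 𝒦 x → 𝒦 (∂ x)
      henselian : ∀ r d (P : DiffPoly r d) → (∀ e → 𝒦 (P e)) → (∀ e → P e ⊴ 1#) →
        (∀ e → totalDeg e ≡ 0 → P e ◁ 1#) → (∃ λ e → totalDeg e ≡ 1 × P e ~ 1#) →
        ¬ ¬ (∃ λ y → 𝒦 y × y ◁ 1# × evalDP P y ≈ 0#)
      exp-int : ∀ {f} → 𝒦 f → ¬ ¬ (∃ λ z → 𝒦 z × ¬ (z ≈ 0#) × z † ≈ f)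
      root : ∀ {x} n → 𝒦 x → ¬ (x ≈ 0#) → ¬ ¬ (∃ λ z → 𝒦 z × ¬ (z ≈ 0#) × pow z (suc n) ~ x)
      residue : ∀ {x} → x ⊴ 1# → ¬ ¬ (∃ λ y → 𝒦 y × y - x ◁ 1#)

    𝒦-sub : ∀ {x y} → 𝒦 x → 𝒦 y → 𝒦 (x - y)
    𝒦-sub a b = 𝒦-+ a (𝒦-neg b)
    𝒦-∂^ : ∀ {x} n → 𝒦 x → 𝒦 (∂^ n x)
    𝒦-∂^ zero a = a
    𝒦-∂^ (suc n) a = 𝒦-∂ (𝒦-∂^ n a)
    𝒦-sum : ∀ n {f} → (∀ i → 𝒦 (f i)) → 𝒦 (sumFin n f)
    𝒦-sum zero a = 𝒦-0
    𝒦-sum (suc n) a = 𝒦-+ (a _) (𝒦-sum n (λ i → a _))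
    𝒦-pow : ∀ {x} n → 𝒦 x → 𝒦 (pow x n)
    𝒦-pow zero a = 𝒦-1
    𝒦-pow (suc n) a = 𝒦-* a (𝒦-pow n a)

-- Differential-henselianity for multilinear forms.

module HenselForms {c ℓ g gℓ p} (F : ValuedDifferentialField c ℓ g gℓ)
  (hasy : ValuedDifferentialField.HAsymptotic F) (max0 : ValuedDifferentialField.Max0 F) (K : GroundField.Ground F hasy max0 p) (r : ℕ) where

  open Expansion F hasy max0 r public
  open GroundField.Ground K public
  open Sol using (solve; _:*_; _:+_; _:=_)
  open import Relation.Binary.Reasoning.Setoid setoid

  -- Coefficients of x ↦ φ ((A + Σ xⱼ fⱼ)ᴺ)

  -- Coefficients of the product of `C` with the j-th variable. Exponents range over all naturals
  -- here and are cut off only when `ev` evaluates.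
  shiftC : ∀ {n} → Fin n → (Vec ℕ n → Carrier) → Vec ℕ n → Carrier
  shiftC fzero C (zero ∷ es) = 0#
  shiftC fzero C (suc e ∷ es) = C (e ∷ es)
  shiftC (fsuc j) C (e ∷ es) = shiftC j (λ es' → C (e ∷ es')) es

  vsum : ∀ {n} → Vec ℕ n → ℕ
  vsum [] = 0
  vsum (e ∷ es) = e ℕ.+ vsum es

  shiftC-ind : ∀ {q n} (P : Carrier → Set q) → P 0# → ∀ (j : Fin n) C es →
    (∀ es' → (∀ l → lookup es l ℕ.≤ suc (lookup es' l)) → vsum es ≡ suc (vsum es') → P (C es')) → P (shiftC j C es)
  shiftC-ind P P0 fzero C (zero ∷ es) h = P0
  shiftC-ind P P0 fzero C (suc e ∷ es) h = h (e ∷ es) (λ { fzero → ℕP.≤-refl ; (fsuc l) → ℕP.n≤1+n _ }) ≡.refl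
  shiftC-ind P P0 (fsuc j) C (e ∷ es) h = shiftC-ind P P0 j _ es (λ es' a b → h (e ∷ es')
    (λ { fzero → ℕP.n≤1+n _ ; (fsuc l) → a l }) (≡.trans (≡.cong (e ℕ.+_) b) (ℕP.+-suc e _)))

  zeroC : ∀ {n} → Carrier → Vec ℕ n → Carrier
  zeroC x [] = x
  zeroC x (zero ∷ es) = zeroC x es
  zeroC x (suc _ ∷ es) = 0#

  zeroC-ind : ∀ {q n} (P : Carrier → Set q) → P 0# → ∀ x (es : Vec ℕ n) → (vsum es ≡ 0 → P x) → P (zeroC x es)
  zeroC-ind P P0 x [] h = h ≡.refl
  zeroC-ind P P0 x (zero ∷ es) h = zeroC-ind P P0 x es h
  zeroC-ind P P0 x (suc _ ∷ es) h = P0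

  ev : ∀ d n → (Vec ℕ n → Carrier) → (Fin n → Carrier) → Carrier
  ev d n C xs = evalAux {d} n (λ e → C (Vec.map toℕ e)) xs

  sum-last : ∀ d (H : ℕ → Carrier) → sumFin (suc d) (λ i → H (toℕ i)) ≈ sumFin d (λ i → H (toℕ i)) + H d
  sum-last zero H = trans (+-identityʳ _) (sym (+-identityˡ _))
  sum-last (suc d) H = trans (+-congˡ (sum-last d (H ∘ suc))) (sym (+-assoc _ _ _))

  ev-zeroC : ∀ d n x xs → ev d n (zeroC x) xs ≈ x
  ev-zeroC d zero x xs = refl
  ev-zeroC d (suc n) x xs = trans (+-cong (trans (*-identityˡ _) (ev-zeroC d n x _)) (sumFin-0 d (λ i → trans (*-congˡ (evalAux-0 n (λ _ → refl))) (zeroʳ _)))) (+-identityʳ x)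

  -- Multiplication by a variable raises exponents; the vanishing hypothesis ensures that none is
  -- pushed past the bound `d`, where `ev` would lose it.
  ev-shiftC : ∀ d n (j : Fin n) C xs → (∀ es → d ℕ.≤ lookup es j → C es ≈ 0#) → ev d n (shiftC j C) xs ≈ xs j * ev d n C xs
  ev-shiftC d (suc n) fzero C xs van = begin
    1# * evalAux n (λ es → 0#) (xs ∘ fsuc) + sumFin d (λ i → pow x (suc (toℕ i)) * G (toℕ i))
      ≈⟨ trans (+-congʳ (trans (*-congˡ (evalAux-0 n (λ _ → refl))) (zeroʳ _))) (+-identityˡ _) ⟩
    sumFin d (λ i → (x * pow x (toℕ i)) * G (toℕ i)) ≈⟨ sumFin-cong d (λ i → *-assoc _ _ _) ⟩
    sumFin d (λ i → x * (pow x (toℕ i) * G (toℕ i))) ≈⟨ sumFin-*ˡ d x _ ⟩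
    x * sumFin d (λ i → pow x (toℕ i) * G (toℕ i)) ≈⟨ *-congˡ (sym (trans (sum-last d (λ i → pow x i * G i)) (trans (+-congˡ (trans (*-congˡ (evalAux-0 n (λ es → van _ ℕP.≤-refl))) (zeroʳ _))) (+-identityʳ _)))) ⟩
    x * sumFin (suc d) (λ i → pow x (toℕ i) * G (toℕ i)) ∎
    where
    x = xs fzero
    G : ℕ → Carrier
    G i = evalAux {d} n (λ es → C (i ∷ Vec.map toℕ es)) (xs ∘ fsuc)
  ev-shiftC d (suc n) (fsuc j) C xs van = begin
    sumFin (suc d) (λ i → pow (xs fzero) (toℕ i) * ev d n (shiftC j (λ es → C (toℕ i ∷ es))) (xs ∘ fsuc))
      ≈⟨ sumFin-cong (suc d) (λ i → trans (*-congˡ {pow (xs fzero) (toℕ i)} (ev-shiftC d n j (λ es → C (toℕ i ∷ es)) (xs ∘ fsuc) (λ es p → van (toℕ i ∷ es) p))) (solve 3 (λ a b d → a :* (b :* d) := b :* (a :* d)) refl (pow (xs fzero) (toℕ i)) _ _)) ⟩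
    sumFin (suc d) (λ i → xs (fsuc j) * (pow (xs fzero) (toℕ i) * ev d n (λ es → C (toℕ i ∷ es)) (xs ∘ fsuc)))
      ≈⟨ sumFin-*ˡ (suc d) _ (λ i → pow (xs fzero) (toℕ i) * ev d n (λ es → C (toℕ i ∷ es)) (xs ∘ fsuc)) ⟩
    xs (fsuc j) * ev d (suc n) C xs ∎

  module Coeff (n : ℕ) (A : V) (f : Fin n → V) where
    cf : ℕ → Form → Vec ℕ n → Carrier
    cf zero φ e = zeroC (ap φ []) e
    cf (suc N) φ e = cf N (pref (A ∷ []) φ) e + sumFin n (λ j → shiftC j (cf N (pref (f j ∷ []) φ)) e)

    cf-vanish : ∀ N φ es j → N ℕ.< lookup es j → cf N φ es ≈ 0#
    cf-vanish zero φ es j p = zeroC-ind (_≈ 0#) refl _ es (λ e → ⊥-elim (lem es j e p))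
      where
      lem : ∀ {n} (es : Vec ℕ n) j → vsum es ≡ 0 → 0 ℕ.< lookup es j → ⊥
      lem (zero ∷ es) fzero e ()
      lem (zero ∷ es) (fsuc j) e p = lem es j e p
      lem (suc _ ∷ es) j () p
    cf-vanish (suc N) φ es j p = trans (+-cong (cf-vanish N _ es j (ℕP.<-trans ℕP.≤-refl p)) (sumFin-0 n (λ l → shiftC-ind (_≈ 0#) refl l _ es
      (λ es' a b → cf-vanish N _ es' j (ℕP.≤-pred (ℕP.≤-trans p (a j))))))) (+-identityˡ _)

    ev-cf : ∀ d N φ xs → N ℕ.≤ d → ev d n (cf N φ) xs ≈ ap φ (replicate N (A +ᵥ lin n xs f))
    ev-cf d zero φ xs le = ev-zeroC d n _ xs
    ev-cf d (suc N) φ xs le = begin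
      ev d n (cf (suc N) φ) xs ≈⟨ evalAux-+ n _ _ xs ⟩
      ev d n (cf N (pref (A ∷ []) φ)) xs + ev d n (λ e → sumFin n (λ j → shiftC j (cf N (pref (f j ∷ []) φ)) e)) xs
        ≈⟨ +-cong (ev-cf d N _ xs (ℕP.<⇒≤ le)) (trans (evalAux-sum n n (λ j e → shiftC j (cf N (pref (f j ∷ []) φ)) (Vec.map toℕ e)) xs) (sumFin-cong n (λ j →
             trans (ev-shiftC d n j _ xs (λ es q → cf-vanish N _ es j (ℕP.≤-trans le q))) (*-congˡ (ev-cf d N _ xs (ℕP.<⇒≤ le)))))) ⟩
      ap φ (A ∷ replicate N A') + sumFin n (λ j → xs j * ap φ (f j ∷ replicate N A')) ≈⟨ +-congˡ (sym (ap-lin φ n xs f (λ _ _ → refl))) ⟩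
      ap φ (A ∷ replicate N A') + ap φ (lin n xs f ∷ replicate N A') ≈⟨ sym (hd-+ φ A _ _) ⟩
      ap φ (A' ∷ replicate N A') ∎
      where A' = A +ᵥ lin n xs f

    -- A coefficient is a sum of values of `φ`, one for each way of filling some arguments with
    -- directions and the others with `A`, so additive properties pass from the values to it.
    cf-ind : ∀ {q} (P : Carrier → Set q) → P 0# → (∀ {x y} → P x → P y → P (x + y)) → ∀ N φ es →
      (∀ cs → length cs ≡ N → deg cs ≡ vsum es → P (ap φ (map (pick A f) cs))) → P (cf N φ es)
    cf-ind P P0 P+ zero φ es h = zeroC-ind P P0 _ es (λ e → h [] ≡.refl (≡.sym e))
    cf-ind P P0 P+ (suc N) φ es h = P+ (cf-ind P P0 P+ N _ es (λ cs a b → h (nothing ∷ cs) (≡.cong suc a) b))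
      (P-sum n (λ j → shiftC-ind P P0 j _ es (λ es' _ b → cf-ind P P0 P+ N _ es' (λ cs a d → h (just j ∷ cs) (≡.cong suc a) (≡.trans (≡.cong suc d) (≡.sym b))))))
      where
      P-sum : ∀ k {h : Fin k → Carrier} → (∀ i → P (h i)) → P (sumFin k h)
      P-sum zero q = P0
      P-sum (suc k) q = P+ (q fzero) (P-sum k (λ i → q (fsuc i)))

    zeros : ∀ k → Vec ℕ k
    zeros zero = []
    zeros (suc k) = 0 ∷ zeros k

    one : ∀ {k} → Fin k → Vec ℕ k
    one {suc k} fzero = 1 ∷ zeros k
    one (fsuc j) = 0 ∷ one j

    shiftC-zeros : ∀ {k} (j : Fin k) C → shiftC j C (zeros k) ≈ 0#
    shiftC-zeros fzero C = refl
    shiftC-zeros (fsuc j) C = shiftC-zeros j _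

    shiftC-one : ∀ {k} (j : Fin k) C → shiftC j C (one j) ≈ C (zeros k)
    shiftC-one fzero C = refl
    shiftC-one (fsuc j) C = shiftC-one j _

    shiftC-one' : ∀ {k} (j l : Fin k) C → ¬ (j ≡ l) → shiftC l C (one j) ≈ 0#
    shiftC-one' fzero fzero C n = ⊥-elim (n ≡.refl)
    shiftC-one' fzero (fsuc l) C n = shiftC-zeros l _
    shiftC-one' (fsuc j) fzero C n = refl
    shiftC-one' (fsuc j) (fsuc l) C n = shiftC-one' j l _ (n ∘ ≡.cong fsuc)

    cf-zeros : ∀ N φ → cf N φ (zeros n) ≈ ap φ (replicate N A)
    cf-zeros zero φ = go n
      where
      go : ∀ k → zeroC (ap φ []) (zeros k) ≈ ap φ []
      go zero = refl
      go (suc k) = go k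
    cf-zeros (suc N) φ = trans (+-cong (cf-zeros N _) (sumFin-0 n (λ j → shiftC-zeros j _))) (+-identityʳ _)

    cf-one : ∀ N φ j → cf (suc N) φ (one j) ≈ nat (suc N) * ap φ (f j ∷ replicate N A)
    cf-one N φ j = trans (+-congˡ (trans (sumFin-single n j _ (λ l ne → shiftC-one' j l _ ne)) (trans (shiftC-one j _) (cf-zeros N _)))) (go N)
      where
      z : ∀ {k} (j : Fin k) x → zeroC x (one j) ≈ 0#
      z fzero x = refl
      z (fsuc j) x = z j x
      go : ∀ N → cf N (pref (A ∷ []) φ) (one j) + ap φ (f j ∷ replicate N A) ≈ nat (suc N) * ap φ (f j ∷ replicate N A)
      go zero = trans (+-congʳ (z j _)) (trans (+-identityˡ _) (sym (trans (*-congʳ (+-identityʳ 1#)) (*-identityˡ _))))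
      go (suc N) = trans (+-congʳ (trans (cf-one N (pref (A ∷ []) φ) j) (*-congˡ (symm φ (Perm.swap A (f j) ↭-refl)))))
        (trans (+-comm _ _) (trans (+-congʳ (sym (*-identityˡ _))) (sym (distribʳ _ _ _))))

  vsum-totalDeg : ∀ {k n} (e : Vec (Fin k) n) → vsum (Vec.map toℕ e) ≡ totalDeg e
  vsum-totalDeg [] = ≡.refl
  vsum-totalDeg (e ∷ es) = ≡.cong (toℕ e ℕ.+_) (vsum-totalDeg es)

  -- After division by `τ` the polynomial has integral coefficients and infinitesimal constant term,
  -- and its coefficient at the linear monomial of index `j*` is `nat (suc N)`, a unit.
  hensel-form : ∀ N φ A h M j* → let f = fh h in
    (∀ cs → length cs ≡ suc N → 𝒦 (ap φ (map (pick A f) cs))) →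
    ap φ (replicate (suc N) A) ◁ M → (∀ cs → length cs ≡ suc N → 1 ℕ.≤ deg cs → ap φ (map (pick A f) cs) ⊴ M) →
    M ⊴ ap φ (f j* ∷ replicate N A) →
    ¬ ¬ (∃ λ x → 𝒦 x × x ◁ 1# × ap φ (replicate (suc N) (A +ᵥ lin m (λ l → ∂^ (toℕ l) x) f)) ≈ 0#)
  hensel-form N φ A h M j* rat small bdd big k =
    henselian r (suc N) P P𝒦 (λ e → scaled (cf-ind (_⊴ M) 0⊴ +-⊴ (suc N) φ (Vec.map toℕ e) (λ cs a _ → all⊴ cs a)))
      (λ e d → scaled◁ (cf-ind (_◁ M) (≉0⇒0◁ M≉0) +-◁ (suc N) φ (Vec.map toℕ e) (λ cs a b → deg0 cs a (≡.trans b (≡.trans (vsum-totalDeg e) d)))))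
      (oneF j* , oneF-deg j* , P-one)
      λ { (x , Kx , x◁1 , ev0) → k (x , Kx , x◁1 , (begin
        ap φ (replicate (suc N) (A +ᵥ lin m (λ l → ∂^ (toℕ l) x) f)) ≈⟨ sym (ev-cf (suc N) (suc N) φ (λ l → ∂^ (toℕ l) x) ℕP.≤-refl) ⟩
        ev (suc N) m (cf (suc N) φ) (λ l → ∂^ (toℕ l) x) ≈⟨ sym (cancel-inv' _ τ τ≉0) ⟩
        (ev (suc N) m (cf (suc N) φ) (λ l → ∂^ (toℕ l) x) * τ ⁻¹) * τ ≈⟨ *-congʳ (trans (sym (evalAux-*ʳ {suc N} m (λ e → cf (suc N) φ (Vec.map toℕ e)) (τ ⁻¹) (λ l → ∂^ (toℕ l) x))) ev0) ⟩
        0# * τ ≈⟨ zeroˡ _ ⟩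
        0# ∎)) }
    where
    f = fh h
    open Coeff m A f
    M≉0 = ◁⇒≉0 small
    -- The normalisation is by a value of the form because this lies in 𝒦; of `M` only the size is
    -- known.
    τ = ap φ (f j* ∷ replicate N A)
    τ≉0 = ⊴-≉0 big M≉0
    P : DiffPoly r (suc N)
    P e = cf (suc N) φ (Vec.map toℕ e) * τ ⁻¹
    τ𝒦 : 𝒦 τ
    τ𝒦 = 𝒦-≈ (head-choice φ A f j* N) (rat (just j* ∷ replicate N nothing) (≡.cong suc (LP.length-replicate N)))
    P𝒦 : ∀ e → 𝒦 (P e)
    P𝒦 e = 𝒦-* (cf-ind 𝒦 𝒦-0 𝒦-+ (suc N) φ (Vec.map toℕ e) (λ cs a _ → rat cs a)) (𝒦-inv τ≉0 τ𝒦)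
    deg0 : ∀ cs → length cs ≡ suc N → deg cs ≡ 0 → ap φ (map (pick A f) cs) ◁ M
    deg0 cs a d = ◁-resp (sym (trans (ap-sort φ A f cs) (reflexive (lem (justs cs) d)))) refl small
      where
      lem : ∀ js → length js ≡ 0 → ap φ (map f js List.++ replicate (nots cs) A) ≡ ap φ (replicate (suc N) A)
      lem [] _ = ≡.cong (λ t → ap φ (replicate t A)) (≡.trans (≡.trans (≡.sym (≡.cong (ℕ._+ nots cs) d)) (deg+nots cs)) a)
    all⊴ : ∀ cs → length cs ≡ suc N → ap φ (map (pick A f) cs) ⊴ M
    all⊴ cs a with deg cs in eq
    ... | zero = ◁⇒⊴ (deg0 cs a eq)
    ... | suc _ = bdd cs a (≡.subst (1 ℕ.≤_) (≡.sym eq) (s≤s z≤n))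
    scaled : ∀ {x} → x ⊴ M → x * τ ⁻¹ ⊴ 1#
    scaled q = ⊴-trans (*-monoʳ-⊴ (τ ⁻¹) (⊴-trans q big)) (⊴-reflexive (inverseʳ τ τ≉0))
    scaled◁ : ∀ {x} → x ◁ M → x * τ ⁻¹ ◁ 1#
    scaled◁ q = ◁-⊴-trans (*-monoʳ-◁ (τ ⁻¹) (⁻¹-≉0 τ≉0) (◁-⊴-trans q big)) (⊴-reflexive (inverseʳ τ τ≉0))
    zerosF : ∀ k → Vec (Fin (suc (suc N))) k
    zerosF zero = []
    zerosF (suc k) = fzero ∷ zerosF k
    oneF : ∀ {k} → Fin k → Vec (Fin (suc (suc N))) k
    oneF {suc k} fzero = fsuc fzero ∷ zerosF k
    oneF (fsuc j) = fzero ∷ oneF j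
    zerosF≡ : ∀ k → Vec.map toℕ (zerosF k) ≡ zeros k
    zerosF≡ zero = ≡.refl
    zerosF≡ (suc k) = ≡.cong (0 ∷_) (zerosF≡ k)
    oneF≡ : ∀ {k} (j : Fin k) → Vec.map toℕ (oneF j) ≡ one j
    oneF≡ {suc k} fzero = ≡.cong (1 ∷_) (zerosF≡ k)
    oneF≡ (fsuc j) = ≡.cong (0 ∷_) (oneF≡ j)
    zerosF-deg : ∀ k → totalDeg (zerosF k) ≡ 0
    zerosF-deg zero = ≡.refl
    zerosF-deg (suc k) = zerosF-deg k
    oneF-deg : ∀ {k} (j : Fin k) → totalDeg (oneF j) ≡ 1
    oneF-deg {suc k} fzero = ≡.cong suc (zerosF-deg k)
    oneF-deg (fsuc j) = oneF-deg j
    P-one : P (oneF j*) ~ 1#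
    P-one = ~-trans (~-reflexive (begin
      cf (suc N) φ (Vec.map toℕ (oneF j*)) * τ ⁻¹ ≈⟨ *-congʳ (trans (reflexive (≡.cong (cf (suc N) φ) (oneF≡ j*))) (cf-one N φ j*)) ⟩
      (nat (suc N) * τ) * τ ⁻¹ ≈⟨ cancel-inv _ τ τ≉0 ⟩
      nat (suc N) ∎)) (nat~1 N)

-- Elements without a best approximation: the cut and Taylor coefficients along it.

module Cuts {c ℓ g gℓ p} (F : ValuedDifferentialField c ℓ g gℓ)
  (hasy : ValuedDifferentialField.HAsymptotic F) (max0 : ValuedDifferentialField.Max0 F) (K : GroundField.Ground F hasy max0 p) (r : ℕ) where

  open HenselForms F hasy max0 K r public
  open import Relation.Binary.Reasoning.Setoid setoid

  _/_ : Carrier → Carrier → Carrier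
  x / z = x * z ⁻¹

  /-* : ∀ {x z} → ¬ (z ≈ 0#) → x ≈ z * (x / z)
  /-* {x} {z} n = trans (sym (cancel-inv' x z n)) (*-comm _ _)

  /-◁1 : ∀ {x z} → x ◁ z → x / z ◁ 1#
  /-◁1 {x} {z} q = ◁-resp refl (inverseʳ z n) (*-monoʳ-◁ (z ⁻¹) (⁻¹-≉0 n) q)
    where n = ◁⇒≉0 q

  /-≉0 : ∀ {x z} → ¬ (x ≈ 0#) → ¬ (z ≈ 0#) → ¬ (x / z ≈ 0#)
  /-≉0 n k = *-≉0 n (⁻¹-≉0 k)

  𝒦-/ : ∀ {x z} → ¬ (z ≈ 0#) → 𝒦 x → 𝒦 z → 𝒦 (x / z)
  𝒦-/ n a b = 𝒦-* a (𝒦-inv n b)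

  module Cut (y : Carrier) (no-best : ∀ a → 𝒦 a → ¬ ¬ (∃ λ b → 𝒦 b × y - b ◁ y - a)) where

    -- The cut of y over 𝒦

    S : Carrier → Set (c ⊔ gℓ ⊔ p)
    S h = 𝒦 h × ∃ λ a → 𝒦 a × y - a ◁ h

    S-≉0 : ∀ {h} → S h → ¬ (h ≈ 0#)
    S-≉0 (_ , _ , _ , q) = ◁⇒≉0 q

    S-up : ∀ {h h'} → S h → 𝒦 h' → h ⊴ h' → S h'
    S-up (_ , a , Ka , q) Kh' le = Kh' , a , Ka , ◁-⊴-trans q le

    -- The two differences agree up to the smaller distance `y - b`. So distances from `y` to 𝒦 have
    -- values in 𝒦, and each improvement of an approximation yields a new radius of the cut.
    S-diff : ∀ {a b} → 𝒦 a → 𝒦 b → y - b ◁ y - a → S (b - a) × (b - a ~ y - a)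
    S-diff {a} {b} Ka Kb q = (𝒦-sub Kb Ka , b , Kb , ◁-⊴-trans q (proj₂ e)) , e
      where
      e : b - a ~ y - a
      e = close⇒~ (◁-resp (begin
          - (y - b) ≈⟨ neg-sub y b ⟩
          b - y ≈⟨ sym (sub-sub b a y) ⟩
          (b - a) + (a - y) ≈⟨ +-congˡ (sym (neg-sub y a)) ⟩
          (b - a) - (y - a) ∎) refl (neg-◁ q))

    S-next : ∀ {h} → S h → ¬ ¬ (∃ λ h' → S h' × h' ◁ h)
    S-next (Kh , a , Ka , q) k = no-best a Ka λ { (b , Kb , q') →
      let Sh , e = S-diff Ka Kb q' in k (b - a , Sh , ⊴-◁-trans (proj₁ e) q) }

    ŷ : V
    ŷ = hat y

    𝒦V : V → Set p
    𝒦V x = ∀ i → 𝒦 (x i)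

    Rat : Form → Set (c ⊔ p)
    Rat φ = ∀ zs → All 𝒦V zs → 𝒦 (ap φ zs)

    unit-𝒦 : ∀ j i → 𝒦 (unit j i)
    unit-𝒦 zero zero = 𝒦-1
    unit-𝒦 zero (suc i) = 𝒦-0
    unit-𝒦 (suc j) zero = 𝒦-0
    unit-𝒦 (suc j) (suc i) = unit-𝒦 j i

    mulJet-𝒦 : ∀ {h x} i → 𝒦 h → 𝒦V x → 𝒦 (mulJet h x i)
    mulJet-𝒦 zero a b = 𝒦-* a (b zero)
    mulJet-𝒦 (suc i) a b = 𝒦-+ (mulJet-𝒦 i (𝒦-∂ a) b) (mulJet-𝒦 i a (b ∘ suc))

    fh-𝒦 : ∀ {h} j → 𝒦 h → 𝒦V (fh h j)
    fh-𝒦 j a zero = 𝒦-0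
    fh-𝒦 j a (suc i) = mulJet-𝒦 i a (unit-𝒦 (toℕ j))

    hat-𝒦 : ∀ {a} → 𝒦 a → 𝒦V (hat a)
    hat-𝒦 Ka zero = 𝒦-1
    hat-𝒦 Ka (suc i) = 𝒦-∂^ i Ka

    pref-Rat : ∀ {xs φ} → All 𝒦V xs → Rat φ → Rat (pref xs φ)
    pref-Rat a R zs b = R _ (AllP.++⁺ a b)

    words-𝒦 : ∀ {h} (i : Word) → 𝒦 h → All 𝒦V (map (fh h) i)
    words-𝒦 [] Kh = []
    words-𝒦 (j ∷ i) Kh = fh-𝒦 j Kh ∷ words-𝒦 i Kh

    rep-𝒦 : ∀ {A} N → 𝒦V A → All 𝒦V (replicate N A)
    rep-𝒦 zero a = []
    rep-𝒦 (suc N) a = a ∷ rep-𝒦 N a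

    picks-𝒦 : ∀ {h A} (cs : List (Maybe (Fin m))) → 𝒦 h → 𝒦V A → All 𝒦V (map (pick A (fh h)) cs)
    picks-𝒦 [] Kh a = []
    picks-𝒦 (nothing ∷ cs) Kh a = a ∷ picks-𝒦 cs Kh a
    picks-𝒦 (just j ∷ cs) Kh a = fh-𝒦 j Kh ∷ picks-𝒦 cs Kh a

    NZ : Form → ℕ → Set (c ⊔ ℓ)
    NZ φ N = ¬ (∀ zs → length zs ≡ N → ap φ zs ≈ 0#)

    -- Up to a binomial coefficient, a Taylor coefficient at the centre A in the scale h.
    val : V → Form → ℕ → Carrier → Word → Carrier
    val A φ N h i = ap φ (map (fh h) i ++ replicate (N ℕ.∸ length i) A)

    -- φ does not vanish on the ball of radius h around y, for the reason that its constant term there is dominant.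
    ConstDom : Form → ℕ → Carrier → Set gℓ
    ConstDom φ N h = ∀ i → 1 ℕ.≤ length i → length i ℕ.≤ N → val ŷ φ N h i ◁ ap φ (replicate N ŷ)

    unif : ∀ {h h' κ w} → h' ≈ h * κ → ¬ (κ ≈ 0#) → 1# ⊴ w → κ † ⊴ w → ∀ φ i B →
      (∀ i' → length i' ≡ length i → ap φ (map (fh h) i') ⊴ B) → ap φ (map (fh h') i) ⊴ pow (κ * pow w r) (length i) * B
    unif {h} {h'} {κ} {w} e n p q φ i B hyp = ⊴-resp (trans (*-identityˡ _) (trans (*-congˡ (R1 i)) (*-identityʳ _))) refl
      (scale (Bnd⊴ (κ * pow w r) B) i φ 1# (λ i' le → ⊴-resp (sym (trans (*-identityˡ _) (trans (*-congˡ (R1 i')) (*-identityʳ _)))) (sym (*-identityˡ B)) (hyp i' (≤w-len le))))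
      where
      open Scale (Smat κ) (fh h) (fh h') (λ j → λ i le → trans (fh-cong j e i le) (fh-expand h κ j i le)) (S-tri κ) (λ _ → 1#) (κ * pow w r)
        (λ j l _ → ⊴-resp (sym (*-identityʳ _)) (sym (*-identityʳ _)) (S-unif n p q j l))
      R1 : ∀ i → R i ≈ 1#
      R1 [] = refl
      R1 (j ∷ i) = trans (*-identityˡ _) (R1 i)

    -- What one letter gains when the radius shrinks by the factor `κ`, after the crude loss of
    -- `pow (κ †) r`. By `x†ⁿ◁` it is infinitesimal whenever `κ` is.
    s⟨_⟩ : Carrier → Carrier
    s⟨ κ ⟩ = κ * pow (κ †) r

    s◁1 : ∀ {κ} → ¬ (κ ≈ 0#) → κ ◁ 1# → s⟨ κ ⟩ ◁ 1#
    s◁1 n q = x†ⁿ◁ r n q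

    val-sort : ∀ A φ N h cs → length cs ≡ N → ap φ (map (pick A (fh h)) cs) ≈ val A φ N h (justs cs)
    val-sort A φ N h cs e = trans (ap-sort φ A (fh h) cs) (reflexive (≡.cong (λ t → ap φ (map (fh h) (justs cs) ++ replicate t A)) lem))
      where
      lem : nots cs ≡ N ℕ.∸ length (justs cs)
      lem = ≡.trans (≡.sym (ℕP.m+n∸m≡n (deg cs) (nots cs))) (≡.cong (ℕ._∸ deg cs) (≡.trans (deg+nots cs) e))

    val-pref : ∀ A φ N h i js → length i ℕ.≤ N → val A (pref (map (fh h) i) φ) (N ℕ.∸ length i) h js ≈ val A φ N h (i ++ js)
    val-pref A φ N h i js le = reflexive (≡.cong (ap φ) (≡.trans (≡.sym (LP.++-assoc (map (fh h) i) _ _))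
      (≡.cong₂ _++_ (≡.sym (LP.map-++ (fh h) i js)) (≡.cong (λ t → replicate t A) (≡.trans (ℕP.∸-+-assoc N (length i) (length js)) (≡.cong (N ℕ.∸_) (≡.sym (LP.length-++ i))))))))

    hat-shift : ∀ {h} z → ¬ (h ≈ 0#) → hat z ≈ᵥ (ŷ +ᵥ lin m (λ l → ∂^ (toℕ l) ((z - y) / h)) (fh h))
    hat-shift {h} z n zero le = sym (trans (+-congˡ (sumFin-0 m (λ l → zeroʳ (∂^ (toℕ l) ((z - y) / h))))) (+-identityʳ 1#))
    hat-shift {h} z n (suc i) le = begin
      ∂^ i z ≈⟨ ∂^-cong i (sym (trans (+-comm _ _) (x-y+y z y))) ⟩
      ∂^ i (y + (z - y)) ≈⟨ ∂^-+ i _ _ ⟩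
      ∂^ i y + ∂^ i (z - y) ≈⟨ +-congˡ (trans (∂^-cong i (/-* n)) (jet-expand h ((z - y) / h) (suc i) le)) ⟩
      ∂^ i y + lin m (λ l → ∂^ (toℕ l) ((z - y) / h)) (fh h) (suc i) ∎

    -- Measured in the scale `h`, the displacement `z - y` is infinitesimal, and so are its
    -- derivatives because the derivation is small; `perturb` applies with these as coordinates.
    recentre : ∀ {h z} M → ¬ (M ≈ 0#) → y - z ◁ h → ∀ N φ → (∀ i → 1 ℕ.≤ length i → length i ℕ.≤ N → val ŷ φ N h i ⊴ M) →
      ap φ (replicate N (hat z)) - ap φ (replicate N ŷ) ◁ M
    recentre {h} {z} M M≉0 q N φ hyp = ◁-resp (+-congʳ (ap-cong φ (rep-cong N (λ i le → sym (hat-shift z n i le))))) refl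
      (perturb ŷ _ (fh h) M M≉0 (λ l → ∂^-◁1 (toℕ l) (/-◁1 (⊴-◁-trans (proj₁ (sub-~ z y)) q))) N φ
        (λ cs e d → ⊴-resp (sym (val-sort ŷ φ N h cs e)) refl (hyp (justs cs) d (≡.subst (deg cs ℕ.≤_) (≡.trans (deg+nots cs) e) (ℕP.m≤m+n _ _)))))
      where n = ◁⇒≉0 q

    recentre-word : ∀ {h z} M → ¬ (M ≈ 0#) → y - z ◁ h → ∀ N φ → (∀ i → 1 ℕ.≤ length i → length i ℕ.≤ N → val ŷ φ N h i ⊴ M) →
      ∀ i → length i ℕ.≤ N → val (hat z) φ N h i - val ŷ φ N h i ◁ M
    recentre-word {h} {z} M M≉0 q N φ hyp i le = recentre M M≉0 q (N ℕ.∸ length i) (pref (map (fh h) i) φ)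
      (λ js d d' → ⊴-resp (sym (val-pref ŷ φ N h i js le)) refl (hyp (i ++ js)
        (≡.subst (1 ℕ.≤_) (≡.sym (LP.length-++ i)) (ℕP.≤-trans d (ℕP.m≤n+m _ _)))
        (≡.subst (ℕ._≤ N) (≡.sym (LP.length-++ i)) (≡.subst (length i ℕ.+ length js ℕ.≤_) (ℕP.m+[n∸m]≡n le) (ℕP.+-monoʳ-≤ (length i) d')))))

    -- As `h` is invertible, `ŷ` and the vectors `fh h j` span all jets, and a multilinear form is
    -- determined by its values on a spanning set.
    span : ∀ {h} → ¬ (h ≈ 0#) → ∀ N φ → (∀ cs → length cs ≡ N → ap φ (map (pick ŷ (fh h)) cs) ≈ 0#) → ∀ zs → length zs ≡ N → ap φ zs ≈ 0#
    span n zero φ hyp [] e = hyp [] ≡.refl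
    span {h} n (suc N) φ hyp (z ∷ zs) e = begin
      ap φ (z ∷ zs) ≈⟨ hd-cong φ ex ⟩
      ap φ (((z zero) *ᵥ ŷ) +ᵥ lin m a (fh h) ∷ zs) ≈⟨ hd-+ φ _ _ zs ⟩
      ap φ (((z zero) *ᵥ ŷ) ∷ zs) + ap φ (lin m a (fh h) ∷ zs) ≈⟨ +-cong (trans (hd-* φ _ _ zs) (*-congˡ (sub nothing))) (trans (ap-lin φ m a (fh h) (λ _ _ → refl)) (sumFin-0 m (λ l → trans (*-congˡ {a l} (sub (just l))) (zeroʳ _)))) ⟩
      z zero * 0# + 0# ≈⟨ trans (+-identityʳ _) (zeroʳ _) ⟩
      0# ∎
      where
      sub : ∀ c → ap φ (pick ŷ (fh h) c ∷ zs) ≈ 0#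
      sub c = span n N (pref (pick ŷ (fh h) c ∷ []) φ) (λ cs e' → hyp (c ∷ cs) (≡.cong suc e')) zs (ℕP.suc-injective e)
      u : V
      u i = z (suc i) - z zero * ∂^ i y
      a : Fin m → Carrier
      a l = mulJet (h ⁻¹) u (toℕ l)
      ex : z ≈ᵥ (((z zero) *ᵥ ŷ) +ᵥ lin m a (fh h))
      ex zero le = sym (trans (+-cong (*-identityʳ _) (sumFin-0 m (λ l → zeroʳ (a l)))) (+-identityʳ _))
      ex (suc i) le = sym (begin
        z zero * ∂^ i y + lin m a (fh h) (suc i) ≈⟨ +-congˡ (sym (hat0-expand h (mulJet (h ⁻¹) u) (suc i) le)) ⟩
        z zero * ∂^ i y + mulJet h (mulJet (h ⁻¹) u) i ≈⟨ +-congˡ (trans (sym (mulJet-assoc h (h ⁻¹) u i)) (trans (mulJet-cong i (inverseʳ h n) (λ _ _ → refl)) (mulJet-1 u i))) ⟩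
        z zero * ∂^ i y + (z (suc i) - z zero * ∂^ i y) ≈⟨ trans (+-comm _ _) (x-y+y _ _) ⟩
        z (suc i) ∎)

    record MinimalForm (D' : ℕ) (Φ : Form) : Set (c ⊔ ℓ ⊔ gℓ ⊔ p) where
      field
        ratΦ : Rat Φ
        nzΦ : NZ Φ (suc D')
        minimal : ∀ N ψ → N ℕ.≤ D' → Rat ψ → NZ ψ N → ¬ ¬ (∃ λ h → S h × ConstDom ψ N h)
        nonconst : ∀ h → S h → ¬ ConstDom Φ (suc D') h

-- Forms of minimal degree, and the case of a dominant linear part.

module LinearCase {c ℓ g gℓ p} (F : ValuedDifferentialField c ℓ g gℓ)
  (hasy : ValuedDifferentialField.HAsymptotic F) (max0 : ValuedDifferentialField.Max0 F) (K : GroundField.Ground F hasy max0 p) (r : ℕ) where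

  open Cuts F hasy max0 K r public
  open Sol using (solve; _:*_; _:+_; _:=_)
  open import Relation.Binary.Reasoning.Setoid setoid

  pow⊴s : ∀ {s} e B → 1 ℕ.≤ e → s ⊴ 1# → pow s e * B ⊴ s * B
  pow⊴s (suc e) B _ q = *-monoʳ-⊴ B (pow-suc⊴ e q)

  module Core (y : Carrier) (no-best : ∀ a → 𝒦 a → ¬ ¬ (∃ λ b → 𝒦 b × y - b ◁ y - a))
    (D' : ℕ) (Φ : Form) (minΦ : Cut.MinimalForm y no-best D' Φ) where
    open Cut y no-best
    open MinimalForm minΦ

    D = suc D'

    T : Carrier → Word → Carrier
    T h i = val ŷ Φ D h i

    T1 : Carrier → Fin m → Carrier
    T1 h j = T h (j ∷ [])

    T0 : Carrier
    T0 = ap Φ (replicate D ŷ)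

    val-unif : ∀ {h h' κ w} → h' ≈ h * κ → ¬ (κ ≈ 0#) → 1# ⊴ w → κ † ⊴ w → ∀ φ N i B →
      (∀ i' → length i' ≡ length i → val ŷ φ N h i' ⊴ B) → val ŷ φ N h' i ⊴ pow (κ * pow w r) (length i) * B
    val-unif {h} e n a b φ N i B hyp = unif e n a b (suff (replicate (N ℕ.∸ length i) ŷ) φ) i B
      (λ i' q → ⊴-resp (reflexive (≡.cong (λ t → ap φ (map (fh h) i' ++ replicate (N ℕ.∸ t) ŷ)) q)) refl (hyp i' q))

    val↓ : ∀ {h h'} → ¬ (h' ≈ 0#) → h' ◁ h → ∀ φ N i B →
      (∀ i' → length i' ≡ length i → val ŷ φ N h i' ⊴ B) → val ŷ φ N h' i ⊴ pow s⟨ h' / h ⟩ (length i) * B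
    val↓ {h} {h'} n q = val-unif (/-* h≉0) (/-≉0 n h≉0) (1⊴† (/-≉0 n h≉0) (◁1⇒≁1 (/-◁1 q))) ⊴-refl
      where h≉0 = ◁⇒≉0 q

    s◁ : ∀ {h h'} → ¬ (h' ≈ 0#) → h' ◁ h → s⟨ h' / h ⟩ ◁ 1#
    s◁ n q = s◁1 (/-≉0 n (◁⇒≉0 q)) (/-◁1 q)

    -- Weak dominance, so that a partial derivative that vanishes identically is included. The
    -- direction is measured at the fixed scale `b` while the ball `g` may shrink.
    CDl : Carrier → Fin m → Carrier → Set gℓ
    CDl b l g = ∀ i → 1 ℕ.≤ length i → length i ℕ.≤ D' → val ŷ (pref (fh b l ∷ []) Φ) D' g i ⊴ T1 b l

    CD : Carrier → Carrier → Set gℓ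
    CD b g = ∀ l → CDl b l g

    CDl-down : ∀ {b g g'} l → ¬ (g' ≈ 0#) → g' ◁ g → CDl b l g → CDl b l g'
    CDl-down {b} l n q cd i a d = ⊴-trans (val↓ n q (pref (fh b l ∷ []) Φ) D' i (T1 b l)
        (λ i' e → cd i' (≡.subst (1 ℕ.≤_) (≡.sym e) a) (≡.subst (ℕ._≤ D') (≡.sym e) d)))
      (⊴-trans (*-monoʳ-⊴ _ (pow⊴1 (length i) (◁⇒⊴ (s◁ n q)))) (⊴-reflexive (*-identityˡ _)))

    meet : ∀ {a} n (P : Fin n → Carrier → Set a) → (∀ l {g g'} → S g → S g' → g' ◁ g → P l g → P l g') →
      (∀ l → ¬ ¬ (∃ λ g → S g × P l g)) → ∀ {g₀} → S g₀ → ¬ ¬ (∃ λ g → S g × g ◁ g₀ × (∀ l → P l g))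
    meet zero P dn h S₀ k = S-next S₀ λ { (g , Sg , q) → k (g , Sg , q , λ ()) }
    meet (suc n) P dn h S₀ k = meet n (P ∘ fsuc) (dn ∘ fsuc) (h ∘ fsuc) S₀ λ { (g₁ , S₁ , q₁ , p₁) → h fzero λ { (g₂ , S₂ , p₂) →
      cmp g₁ g₂ λ
        { (inj₁ lt) → k (g₁ , S₁ , q₁ , λ { fzero → dn fzero S₂ S₁ lt p₂ ; (fsuc l) → p₁ l })
        ; (inj₂ ge) → S-next S₂ λ { (g₃ , S₃ , lt) → let lt' = ◁-⊴-trans lt ge in
            k (g₃ , S₃ , ◁-trans lt' q₁ , λ { fzero → dn fzero S₂ S₃ lt p₂ ; (fsuc l) → dn (fsuc l) S₁ S₃ lt' (p₁ l) }) } } } }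

    CD-exists : ∀ {b} → 𝒦 b → ∀ {g₀} → S g₀ → ¬ ¬ (∃ λ g → S g × g ◁ g₀ × CD b g)
    CD-exists {b} Kb {g₀} S₀ = meet m (λ l g → CDl b l g) (λ l _ S' q → CDl-down {b} l (S-≉0 S') q) one-l S₀
      where
      one-l : ∀ l → ¬ ¬ (∃ λ g → S g × CDl b l g)
      one-l l k = em (∀ zs → length zs ≡ D' → ap (pref (fh b l ∷ []) Φ) zs ≈ 0#) λ
        { (inj₁ z) → k (g₀ , S₀ , λ i a d → ⊴-trans (⊴-reflexive (z _ (len i d))) 0⊴)
        ; (inj₂ nz) → minimal D' (pref (fh b l ∷ []) Φ) ℕP.≤-refl (pref-Rat {fh b l ∷ []} {Φ} (fh-𝒦 l Kb ∷ []) ratΦ) nz λ { (h , Sh , cd) →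
            k (h , Sh , λ i a d → ◁⇒⊴ (cd i a d)) } }
        where
        len : ∀ i → length i ℕ.≤ D' → length (map (fh g₀) i ++ replicate (D' ℕ.∸ length i) ŷ) ≡ D'
        len i d = ≡.trans (LP.length-++ (map (fh g₀) i)) (≡.trans (≡.cong₂ ℕ._+_ (LP.length-map (fh g₀) i) (LP.length-replicate _)) (ℕP.m+[n∸m]≡n d))

    -- The first letter is expanded in the scale `b`, which produces partial derivatives of `Φ`. The
    -- remaining letters, at least one, give Taylor coefficients of such a derivative, bounded on
    -- the ball `g` by its constant term `T1 b l`; shrinking to `h'` gains `s⟨ h' / g ⟩`.
    bigdeg : ∀ {b g h' k Xb} → CD b g → ¬ (h' ≈ 0#) → h' ◁ g → h' ≈ b * k → (∀ j l → Smat k j l * T1 b l ⊴ Xb) →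
      ∀ i → 2 ℕ.≤ length i → length i ℕ.≤ D → T h' i ⊴ s⟨ h' / g ⟩ * Xb
    bigdeg {b} {g} {h'} {k} {Xb} cd n q e bd (j ∷ i) (s≤s a) (s≤s d) =
      ⊴-trans (⊴-reflexive (ap-lin Φ m (Smat k j) (fh b) (λ t le → trans (fh-cong j e t le) (fh-expand b k j t le))))
        (sumFin-⊴ m (λ l → ⊴-trans (*-monoˡ-⊴ (Smat k j l) (lem l)) (⊴-trans
          (⊴-reflexive (solve 3 (λ S s T → S :* (s :* T) := s :* (S :* T)) refl (Smat k j l) s⟨ h' / g ⟩ (T1 b l))) (*-monoˡ-⊴ _ (bd j l)))))
      where
      lem : ∀ l → ap Φ (fh b l ∷ map (fh h') i ++ replicate (D' ℕ.∸ length i) ŷ) ⊴ s⟨ h' / g ⟩ * T1 b l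
      lem l = ⊴-trans (val↓ n q (pref (fh b l ∷ []) Φ) D' i (T1 b l)
        (λ i' e → cd l i' (≡.subst (1 ℕ.≤_) (≡.sym e) a) (≡.subst (ℕ._≤ D') (≡.sym e) d))) (pow⊴s (length i) _ a (◁⇒⊴ (s◁ n q)))

    -- If the linear coefficients vanished in one scale, dominance in the partial derivatives would
    -- make all Taylor coefficients of positive degree vanish on some ball. Then `nonconst` would
    -- force the constant term to vanish too, and `span` would make `Φ` zero.
    T1-nz : ∀ {h g₀} → 𝒦 h → ¬ (h ≈ 0#) → S g₀ → ¬ (∀ j → T1 h j ≈ 0#)
    T1-nz {h} Kh h≉0 S₀ z = CD-exists Kh S₀ λ { (g , Sg , _ , cd) →
      let k = g / h
          e : g ≈ h * k
          e = /-* h≉0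
          Tz : ∀ i → 1 ℕ.≤ length i → length i ℕ.≤ D → T g i ≈ 0#
          Tz = λ { (j ∷ i) a (s≤s d) → trans (ap-lin Φ m (Smat k j) (fh h) (λ t le → trans (fh-cong j e t le) (fh-expand h k j t le)))
                     (sumFin-0 m (λ l → trans (*-congˡ {Smat k j l} (tail g cd l i d)) (zeroʳ _))) }
          cs0 : T0 ≈ 0# → ∀ cs → length cs ≡ D → ap Φ (map (pick ŷ (fh g)) cs) ≈ 0#
          cs0 t0 cs le = trans (val-sort ŷ Φ D g cs le) (pos (justs cs) t0 Tz (≡.subst (deg cs ℕ.≤_) (≡.trans (deg+nots cs) le) (ℕP.m≤m+n _ _)))
      in T0≈0 Sg Tz λ t0 → nzΦ (span (S-≉0 Sg) D Φ (cs0 t0)) }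
      where
      tail : ∀ g → CD h g → ∀ l i → length i ℕ.≤ D' → ap Φ (fh h l ∷ map (fh g) i ++ replicate (D' ℕ.∸ length i) ŷ) ≈ 0#
      tail g cd l [] d = z l
      tail g cd l (j ∷ i) d = ⊴0⇒≈0 (⊴-trans (cd l (j ∷ i) (s≤s z≤n) d) (⊴-reflexive (z l)))
      pos : ∀ {g} js → T0 ≈ 0# → (∀ i → 1 ℕ.≤ length i → length i ℕ.≤ D → T g i ≈ 0#) → length js ℕ.≤ D → val ŷ Φ D g js ≈ 0#
      pos [] t0 Tz d = t0
      pos (j ∷ js) t0 Tz d = Tz (j ∷ js) (s≤s z≤n) d
      T0≈0 : ∀ {g} → S g → (∀ i → 1 ℕ.≤ length i → length i ℕ.≤ D → T g i ≈ 0#) → ¬ ¬ (T0 ≈ 0#)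
      T0≈0 Sg Tz k = nonconst _ Sg λ i a d → ◁-resp (sym (Tz i a d)) refl (≉0⇒0◁ k)

    LIN : Carrier → Set gℓ
    LIN h = ∃ λ j* → (∀ j → T1 h j ⊴ T1 h j*) × (∀ i → 2 ℕ.≤ length i → length i ℕ.≤ D → T h i ◁ T1 h j*)

    max-nz : ∀ {h g₀} j* → 𝒦 h → ¬ (h ≈ 0#) → S g₀ → (∀ j → T1 h j ⊴ T1 h j*) → ¬ (T1 h j* ≈ 0#)
    max-nz j* Kh n S₀ mx e = T1-nz Kh n S₀ (λ j → ⊴0⇒≈0 (⊴-trans (mx j) (⊴-reflexive e)))

    T1-up : ∀ {b h' k w} → ¬ (k ≈ 0#) → h' ≈ b * k → 1# ⊴ w → k † ⊴ w → ∀ j* → (∀ j → T1 h' j ⊴ T1 h' j*) → ∀ l → T1 b l ⊴ (k ⁻¹ * pow w r) * T1 h' j*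
    T1-up {b} {h'} {k} {w} n e a q j* mx l = ⊴-trans
      (val-unif (trans (sym (cancel-inv b k n)) (*-congʳ (sym e))) (⁻¹-≉0 n) a (⊴-trans (⊴-reflexive (†-inv n)) (neg-⊴ q)) Φ D (l ∷ []) (T1 h' j*)
        (λ { (j ∷ []) _ → mx j }))
      (⊴-reflexive (*-congʳ (*-identityʳ _)))

    -- Going from `h'` to `b` in `bigdeg` costs `pow w r`, and estimating the coefficients at `b` by
    -- those at `h'` costs the same again, while the factors `k` and `k ⁻¹` cancel. The gain
    -- `s⟨ h' / g ⟩` has to beat both losses.
    lin-crit : ∀ {b g h' w} → 𝒦 b → ¬ (b ≈ 0#) → CD b g → S h' → h' ◁ g → 1# ⊴ w → (h' / b) † ⊴ w →
      s⟨ h' / g ⟩ * (pow w r * pow w r) ◁ 1# → LIN h'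
    lin-crit {b} {g} {h'} {w} Kb b≉0 cd Sh q a kq small = j* , mx , λ i i2 id → ⊴-◁-trans
        (⊴-trans (bigdeg cd n q (/-* b≉0) (λ j l → *-mono-⊴ (S-unif k≉0 a kq j l) (T1-up k≉0 (/-* b≉0) a kq j* mx l)) i i2 id)
          (⊴-reflexive (begin
            s * ((k * W) * ((k ⁻¹ * W) * t)) ≈⟨ solve 5 (λ s k W ki t → s :* ((k :* W) :* ((ki :* W) :* t)) := (s :* (W :* W)) :* ((k :* ki) :* t)) refl s k W (k ⁻¹) t ⟩
            (s * (W * W)) * ((k * k ⁻¹) * t) ≈⟨ *-congˡ (trans (*-congʳ (inverseʳ k k≉0)) (*-identityˡ t)) ⟩
            (s * (W * W)) * t ∎)))
        (◁-⊴-trans (*-monoʳ-◁ t (max-nz j* (proj₁ Sh) n Sh mx) small) (⊴-reflexive (*-identityˡ t)))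
      where
      n = S-≉0 Sh
      k = h' / b
      k≉0 = /-≉0 n b≉0
      s = s⟨ h' / g ⟩
      W = pow w r
      am = argmax (T1 h')
      j* = proj₁ am
      mx = proj₂ am
      t = T1 h' j*

    -- Degrees from 2 on gain the square of `κ * pow w r`, whereas the comparison of linear
    -- coefficients costs `κ ⁻¹ * pow w r`. What remains is `κ` times the 3r-th power of `w`,
    -- infinitesimal by `x†ⁿ◁`.
    lin-down : ∀ {h h'} → 𝒦 h → S h' → h' ◁ h → LIN h → LIN h'
    lin-down {h} {h'} Kh Sh' q (j₀ , mx₀ , dom) = j* , mx , λ i i2 id → ⊴-◁-trans (lem i i2 id) (◁-⊴-trans
        (*-monoˡ-◁ t t≉0 (x†ⁿ◁ (r ℕ.+ (r ℕ.+ r)) κ≉0 (/-◁1 q))) (⊴-reflexive (*-identityʳ t)))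
      where
      n = S-≉0 Sh'
      h≉0 = ◁⇒≉0 q
      κ = h' / h
      κ≉0 = /-≉0 n h≉0
      w = κ †
      1⊴w = 1⊴† κ≉0 (◁1⇒≁1 (/-◁1 q))
      W = pow w r
      s = s⟨ κ ⟩
      am = argmax (T1 h')
      j* = proj₁ am
      mx = proj₂ am
      t = T1 h' j*
      t≉0 = max-nz j* (proj₁ Sh') n Sh' mx
      lem : ∀ i → 2 ℕ.≤ length i → length i ℕ.≤ D → T h' i ⊴ t * (κ * pow w (r ℕ.+ (r ℕ.+ r)))
      lem i i2 id = ⊴-trans (val↓ n q Φ D i (T1 h j₀) (λ i' e → ◁⇒⊴ (dom i' (≡.subst (2 ℕ.≤_) (≡.sym e) i2) (≡.subst (ℕ._≤ D) (≡.sym e) id))))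
        (⊴-trans (*-mono-⊴ (pw i2) (T1-up κ≉0 (/-* h≉0) 1⊴w ⊴-refl j* mx j₀)) (⊴-reflexive (begin
          (s * s) * ((κ ⁻¹ * W) * t) ≈⟨ solve 4 (λ k W ki t → ((k :* W) :* (k :* W)) :* ((ki :* W) :* t) := (t :* (k :* (W :* (W :* W)))) :* (k :* ki)) refl κ W (κ ⁻¹) t ⟩
          (t * (κ * (W * (W * W)))) * (κ * κ ⁻¹) ≈⟨ trans (*-congˡ (inverseʳ κ κ≉0)) (*-identityʳ _) ⟩
          t * (κ * (W * (W * W))) ≈⟨ *-congˡ (*-congˡ (sym (trans (pow-+ w r (r ℕ.+ r)) (*-congˡ (pow-+ w r r))))) ⟩
          t * (κ * pow w (r ℕ.+ (r ℕ.+ r))) ∎)))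
        where
        pw : ∀ {e} → 2 ℕ.≤ e → pow s e ⊴ s * s
        pw (s≤s (s≤s {n = e} z≤n)) = *-monoˡ-⊴ s (pow-suc⊴ e (◁⇒⊴ (s◁1 κ≉0 (/-◁1 q))))

    record Good (h : Carrier) : Set gℓ where
      field
        j* : Fin m
        mx : ∀ j → T1 h j ⊴ T1 h j*
        dom : ∀ i → 2 ℕ.≤ length i → length i ℕ.≤ D → T h i ◁ T1 h j*
        T0◁ : T0 ◁ T1 h j*
      M = T1 h j*
      M≉0 : ¬ (M ≈ 0#)
      M≉0 = ◁⇒≉0 T0◁
      le : ∀ i → 1 ℕ.≤ length i → length i ℕ.≤ D → T h i ⊴ M
      le (j ∷ []) _ _ = mx j
      le (j ∷ j' ∷ i) _ d = ◁⇒⊴ (dom (j ∷ j' ∷ i) (s≤s (s≤s z≤n)) d)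
      at : ∀ {z} → y - z ◁ h → ∀ i → length i ℕ.≤ D → val (hat z) Φ D h i - T h i ◁ M
      at q = recentre-word M M≉0 q D Φ le
      at0 : ∀ {z} → y - z ◁ h → ap Φ (replicate D (hat z)) ◁ M
      at0 q = ◁-resp (x-y+y _ _) refl (+-◁ (at q [] z≤n) T0◁)
      at≥1 : ∀ {z} → y - z ◁ h → ∀ i → 1 ℕ.≤ length i → length i ℕ.≤ D → val (hat z) Φ D h i ⊴ M
      at≥1 q i a d = ⊴-resp (x-y+y _ _) refl (+-⊴ (◁⇒⊴ (at q i d)) (le i a d))
      at≥2 : ∀ {z} → y - z ◁ h → ∀ i → 2 ℕ.≤ length i → length i ℕ.≤ D → val (hat z) Φ D h i ◁ M
      at≥2 q i a d = ◁-resp (x-y+y _ _) refl (+-◁ (at q i d) (dom i a d))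
      at* : ∀ {z} → y - z ◁ h → val (hat z) Φ D h (j* ∷ []) ~ M
      at* q = close⇒~ (at q (j* ∷ []) (s≤s z≤n))

    -- On a strictly smaller ball the leading linear coefficient is strictly smaller, and `nonconst`
    -- there bounds the constant term by it, since higher degrees stay below it.
    good : ∀ {h} → S h → LIN h → ¬ ¬ Good h
    good {h} Sh L@(j* , mx , dom) k = S-next Sh λ { (h' , Sh' , q) →
      let j' , mx' , dom' = lin-down (proj₁ Sh) Sh' q L
          n = S-≉0 Sh'
          T1' : T1 h' j' ◁ T1 h j*
          T1' = ⊴-◁-trans (⊴-trans (val↓ n q Φ D (j' ∷ []) (T1 h j*) (λ { (j ∷ []) _ → mx j })) (pow⊴s 1 _ (s≤s z≤n) (◁⇒⊴ (s◁ n q))))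
                  (◁-⊴-trans (*-monoʳ-◁ _ (max-nz j* (proj₁ Sh) (S-≉0 Sh) Sh mx) (s◁ n q)) (⊴-reflexive (*-identityˡ _)))
      in nonconst h' Sh' λ i a d → ◁-by λ T0⊴ → k (record { j* = j* ; mx = mx ; dom = dom ; T0◁ = ⊴-◁-trans (⊴-trans T0⊴ (le' h' j' mx' dom' i a d)) T1' }) }
      where
      le' : ∀ h' j' → (∀ j → T1 h' j ⊴ T1 h' j') → (∀ i → 2 ℕ.≤ length i → length i ℕ.≤ D → T h' i ◁ T1 h' j') → ∀ i → 1 ℕ.≤ length i → length i ℕ.≤ D → T h' i ⊴ T1 h' j'
      le' h' j' mx' dom' (j ∷ []) _ _ = mx' j
      le' h' j' mx' dom' (j ∷ j₂ ∷ i) _ d = ◁⇒⊴ (dom' (j ∷ j₂ ∷ i) (s≤s (s≤s z≤n)) d)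

    module LinCase (h₀ : Carrier) (S₀ : S h₀) (L₀ : LIN h₀) where

      good↓ : ∀ {h} → S h → h ◁ h₀ → ¬ ¬ Good h
      good↓ Sh q = good Sh (lin-down (proj₁ S₀) Sh q L₀)

      zero-in : ∀ {h} → S h → h ◁ h₀ → ¬ ¬ (∃ λ z → 𝒦 z × ap Φ (replicate D (hat z)) ≈ 0# × y - z ◁ h)
      zero-in {h} Sh@(Kh , a , Ka , q) lt k = good↓ Sh lt λ G →
        let open Good G in
        hensel-form D' Φ (hat a) h M j*
          (λ cs _ → ratΦ _ (picks-𝒦 cs Kh (hat-𝒦 Ka)))
          (at0 q)
          (λ cs e d → ⊴-resp (sym (val-sort (hat a) Φ D h cs e)) refl (at≥1 q (justs cs) d (≡.subst (deg cs ℕ.≤_) (≡.trans (deg+nots cs) e) (ℕP.m≤m+n _ _))))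
          (proj₂ (at* q))
          λ { (x , Kx , x◁1 , e) → k (a + h * x , 𝒦-+ Ka (𝒦-* Kh Kx) ,
                trans (ap-cong Φ (rep-cong D (vec x))) e ,
                ◁-resp (lem x) refl (+-◁ q (neg-◁ (◁-resp (*-comm _ _) (*-identityˡ h) (*-monoʳ-◁ h (S-≉0 Sh) x◁1))))) }
        where
        lem : ∀ x → (y - a) - h * x ≈ y - (a + h * x)
        lem x = trans (+-assoc _ _ _) (+-congˡ (RP.-‿+-comm a (h * x)))
          where import Algebra.Properties.Ring ring as RP
        vec : ∀ x → hat (a + h * x) ≈ᵥ (hat a +ᵥ lin m (λ l → ∂^ (toℕ l) x) (fh h))
        vec x zero le = sym (trans (+-congˡ (sumFin-0 m (λ l → zeroʳ (∂^ (toℕ l) x)))) (+-identityʳ 1#))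
        vec x (suc i) le = trans (∂^-+ i _ _) (+-congˡ (jet-expand h x (suc i) le))

      record Zeros (n : ℕ) (h : Carrier) : Set (c ⊔ ℓ ⊔ gℓ ⊔ p) where
        field
          z : Carrier
          zs : Fin n → Carrier
          Kz : 𝒦 z
          Kzs : ∀ i → 𝒦 (zs i)
          root-z : ap Φ (replicate D (hat z)) ≈ 0#
          root-zs : ∀ i → ap Φ (replicate D (hat (zs i))) ≈ 0#
          z◁h : y - z ◁ h
          zs◁h : ∀ i → y - zs i ◁ h
          z◁zs : ∀ i → y - z ◁ y - zs i
          dec : ∀ i j → toℕ i ℕ.< toℕ j → y - zs j ◁ y - zs i

      zeros-chain : ∀ n {h} → S h → h ◁ h₀ → ¬ ¬ Zeros n h
      zeros-chain zero Sh lt k = zero-in Sh lt λ { (z , Kz , e , q) → k (record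
        { z = z ; zs = λ () ; Kz = Kz ; Kzs = λ () ; root-z = e ; root-zs = λ () ; z◁h = q ; zs◁h = λ () ; z◁zs = λ () ; dec = λ () }) }
      zeros-chain (suc n) {h} Sh lt k = zero-in Sh lt λ { (z₀ , K₀ , e₀ , q₀) → no-best z₀ K₀ λ { (b , Kb , q) →
        -- The radius `b - z₀` has the size of `y - z₀`, so zeros found in that ball are strictly
        -- closer to `y` than `z₀`.
        let Sh' , (le , ge) = S-diff K₀ Kb q
            h'◁h = ⊴-◁-trans le q₀
        in zeros-chain n Sh' (◁-trans h'◁h lt) λ Z → let open Zeros Z in k (record
          { z = z
          ; zs = λ { fzero → z₀ ; (fsuc i) → zs i }
          ; Kz = Kz
          ; Kzs = λ { fzero → K₀ ; (fsuc i) → Kzs i }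
          ; root-z = root-z
          ; root-zs = λ { fzero → e₀ ; (fsuc i) → root-zs i }
          ; z◁h = ◁-trans z◁h h'◁h
          ; zs◁h = λ { fzero → q₀ ; (fsuc i) → ◁-trans (zs◁h i) h'◁h }
          ; z◁zs = λ { fzero → ◁-⊴-trans z◁h le ; (fsuc i) → z◁zs i }
          ; dec = λ { fzero (fsuc j) _ → ◁-⊴-trans (zs◁h j) le ; (fsuc i) (fsuc j) (s≤s lt') → dec i j lt' } }) } }

      τ : Carrier → V → Carrier
      τ z x = ap Φ ((0# ∷∞ x) ∷ replicate D' (hat z))

      fh-zero : ∀ u i → fh u fzero (suc i) ≈ ∂^ i u
      fh-zero u i = trans (mulJet-cong i refl (λ t _ → sym (jet1 t))) (trans (mulJet-jet u 1# i) (∂^-cong i (*-identityʳ u)))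

      -- A zero z' of Φ near z yields the approximate solution z' - z of the linear part at z, which d-henselianity makes exact.
      kernel-elt : ∀ {z z'} → 𝒦 z → 𝒦 z' → ap Φ (replicate D (hat z)) ≈ 0# → ap Φ (replicate D (hat z')) ≈ 0# →
        S (z' - z) → z' - z ◁ h₀ → y - z ◁ z' - z → ¬ ¬ (∃ λ k → k ~ z' - z × τ z (jet k) ≈ 0# × ¬ (∀ x → τ z x ≈ 0#))
      kernel-elt {z} {z'} Kz Kz' e e' Su lt q κ = good↓ Su lt λ G →
        let open Good G
            so = second-order (hat z) (fh u fzero) M M≉0 D' Φ (λ cs el d2 → ◁-resp (sym (conv cs el)) refl
                   (at≥2 q (map (λ _ → fzero) (justs cs)) (≡.subst (2 ℕ.≤_) (≡.sym (LP.length-map _ (justs cs))) d2)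
                     (≡.subst (ℕ._≤ D) (≡.sym (LP.length-map _ (justs cs))) (≡.subst (deg cs ℕ.≤_) (≡.trans (deg+nots cs) el) (ℕP.m≤m+n _ _)))))
            -- `Φ` vanishes at both centres, so the second-order expansion leaves only a numerical
            -- multiple of `t₀` and terms below `M`.
            small : t₀ ◁ M
            small = ⊴-◁-trans (⊴-resp (*-identityˡ _) refl (*-monoʳ-⊴ t₀ (proj₂ (nat~1 D'))))
                      (◁-resp (trans (-‿cong (trans (+-cong (trans (ap-cong Φ (rep-cong D (λ i le → sym (vec i le)))) e') (-‿cong (trans (+-congʳ e) (+-identityˡ _)))) (+-identityˡ _))) (RP.-‿involutive _)) refl (neg-◁ so))
        -- Here the form is the linear operator `τ z`, centred at the jet of `u`; the exact solution
        -- found is `u * (1# + x)`.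
        in hensel-form 0 φ (fh u fzero) u M j*
             (λ cs _ → ratΦ _ (AllP.++⁺ (picks-𝒦 cs Ku (fh-𝒦 fzero Ku)) (rep-𝒦 D' (hat-𝒦 Kz))))
             small
             (λ { (just j ∷ []) _ _ → at≥1 q (j ∷ []) (s≤s z≤n) (s≤s z≤n) })
             (proj₂ (at* q))
             λ { (x , Kx , x◁1 , ex) → κ (u * (1# + x) , u~ x x◁1 , trans (hd-cong Φ (vec2 x)) ex ,
                   λ all → M≉0 (⊴0⇒≈0 (⊴-trans (proj₂ (at* q)) (⊴-reflexive (all _))))) }
        where
        import Algebra.Properties.Ring ring as RP
        u = z' - z
        Ku = 𝒦-sub Kz' Kz
        t₀ = ap Φ (fh u fzero ∷ replicate D' (hat z))
        φ = suff (replicate D' (hat z)) Φ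
        conv : ∀ (cs : List (Maybe (Fin 1))) → length cs ≡ D → ap Φ (map (pick (hat z) (λ _ → fh u fzero)) cs) ≈ val (hat z) Φ D u (map (λ _ → fzero) (justs cs))
        conv cs el = trans (ap-sort Φ (hat z) (λ _ → fh u fzero) cs) (reflexive (≡.cong (ap Φ) (≡.cong₂ _++_ (LP.map-∘ (justs cs)) (≡.cong (λ t → replicate t (hat z)) lem))))
          where
          lem : nots cs ≡ D ℕ.∸ length (map {B = Fin m} (λ _ → fzero) (justs cs))
          lem = ≡.trans (≡.sym (ℕP.m+n∸m≡n (deg cs) (nots cs))) (≡.cong₂ ℕ._∸_ (≡.trans (deg+nots cs) el) (≡.sym (LP.length-map _ (justs cs))))
        vec : hat z' ≈ᵥ (hat z +ᵥ fh u fzero)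
        vec zero le = sym (+-identityʳ 1#)
        vec (suc i) le = trans (∂^-cong i (sym (trans (+-comm _ _) (x-y+y z' z)))) (trans (∂^-+ i _ _) (+-congˡ (sym (fh-zero u i))))
        vec2 : ∀ x → (0# ∷∞ jet (u * (1# + x))) ≈ᵥ (fh u fzero +ᵥ lin m (λ l → ∂^ (toℕ l) x) (fh u))
        vec2 x zero le = sym (trans (+-congˡ (sumFin-0 m (λ l → zeroʳ (∂^ (toℕ l) x)))) (+-identityʳ 0#))
        vec2 x (suc i) le = trans (∂^-cong i (trans (distribˡ u 1# x) (+-congʳ (*-identityʳ u)))) (trans (∂^-+ i _ _) (+-cong (sym (fh-zero u i)) (jet-expand u x (suc i) le)))
        u~ : ∀ x → x ◁ 1# → u * (1# + x) ~ u
        u~ x x◁1 = ~-trans (*-mono-~ ~-refl (~-trans (~-reflexive (+-comm _ _)) (+-absorb x◁1))) (~-reflexive (*-identityʳ u))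

      -- The linear operator involves derivatives up to order `r` only, so `m`, that is r + 1,
      -- kernel elements of distinct values are one too many.
      contradiction : ⊥
      contradiction = S-next S₀ λ { (h , Sh , lt) → zeros-chain m Sh lt λ Z →
        let open Zeros Z
            u~ : ∀ i → zs i - z ~ y - zs i
            u~ i = ~-trans (sub-~ (zs i) z) (proj₂ (S-diff (Kzs i) Kz (z◁zs i)))
            z◁u : ∀ i → y - z ◁ zs i - z
            z◁u i = ◁-⊴-trans (z◁zs i) (proj₂ (u~ i))
        in fin-¬¬ m (λ i → kernel-elt Kz (Kzs i) root-z (root-zs i) (𝒦-sub (Kzs i) Kz , z , Kz , z◁u i) (◁-trans (⊴-◁-trans (proj₁ (u~ i)) (zs◁h i)) lt) (z◁u i)) λ ks →
          let k~ : ∀ i → proj₁ (ks i) ~ y - zs i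
              k~ i = ~-trans (proj₁ (proj₂ (ks i))) (u~ i)
          in kernel-count m (τ z)
            (λ e → hd-cong Φ (λ { zero _ → refl ; (suc i) le → e i le }))
            (λ x x' → trans (hd-cong Φ (λ { zero _ → sym (+-identityˡ 0#) ; (suc i) _ → refl })) (hd-+ Φ (0# ∷∞ x) (0# ∷∞ x') _))
            (λ a x → trans (hd-cong Φ (λ { zero _ → sym (zeroʳ a) ; (suc i) _ → refl })) (hd-* Φ a (0# ∷∞ x) _))
            (proj₂ (proj₂ (proj₂ (ks fzero))))
            (λ i → proj₁ (ks i))
            (λ i → ⊴-≉0 (proj₂ (k~ i)) (◁⇒≉0 (z◁zs i)))
            (λ i j lt' → ⊴-◁-trans (proj₁ (k~ j)) (◁-⊴-trans (dec i j lt') (proj₂ (k~ i))))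
            (λ i → proj₁ (proj₂ (proj₂ (ks i)))) }

-- The case in which a higher degree competes with the linear part.

module NonlinearCase {c ℓ g gℓ p} (F : ValuedDifferentialField c ℓ g gℓ)
  (hasy : ValuedDifferentialField.HAsymptotic F) (max0 : ValuedDifferentialField.Max0 F) (K : GroundField.Ground F hasy max0 p) (r : ℕ) where

  open LinearCase F hasy max0 K r public
  open Sol using (solve; _:*_; _:+_; _:=_)
  open import Relation.Binary.Reasoning.Setoid setoid

  least : ∀ {a} (P : ℕ → Set a) n → P n → ¬ ¬ (∃ λ k → P k × (∀ k' → k' ℕ.< k → ¬ P k'))
  least P n pn k = <-rec (λ n → ¬ P n) (λ n rec pn → k (n , pn , λ k' lt → rec lt)) n pn

  argmaxW : ∀ e (f : Word → Carrier) → ∃ λ i → length i ≡ e × (∀ i' → length i' ≡ e → f i' ⊴ f i)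
  argmaxW zero f = [] , ≡.refl , λ { [] _ → ⊴-refl }
  argmaxW (suc e) f = j ∷ best j , ≡.cong suc (proj₁ (proj₂ (rec j))) ,
      λ { (j' ∷ i') q → ⊴-trans (proj₂ (proj₂ (rec j')) i' (ℕP.suc-injective q)) (proj₂ am j') }
    where
    rec : ∀ j → _
    rec j = argmaxW e (λ i → f (j ∷ i))
    best : Fin m → Word
    best j = proj₁ (rec j)
    am = argmax (λ j → f (j ∷ best j))
    j = proj₁ am

  wt-bound : ∀ i → wt i ℕ.≤ length i ℕ.* m
  wt-bound [] = z≤n
  wt-bound (j ∷ i) = ℕP.+-mono-≤ (ℕP.<⇒≤ (FP.toℕ<n j)) (wt-bound i)

  module NotLin (y : Carrier) (no-best : ∀ a → 𝒦 a → ¬ ¬ (∃ λ b → 𝒦 b × y - b ◁ y - a))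
    (D' : ℕ) (Φ : Form) (minΦ : Cut.MinimalForm y no-best D' Φ)
    (notlin : ∀ h → Cut.S y no-best h → ¬ Core.LIN y no-best D' Φ minΦ h) where
    open Cut y no-best
    open MinimalForm minΦ
    open Core y no-best D' Φ minΦ

    -- Beyond g, the scale relative to b varies so slowly that its logarithmic derivative is W up to ≍.
    record Base (b g : Carrier) : Set (c ⊔ ℓ ⊔ gℓ ⊔ p) where
      field
        Kb : 𝒦 b
        b≉0 : ¬ (b ≈ 0#)
        Sg : S g
        cd : CD b g
      W : Carrier
      W = (g / b) †
      field
        slow : ∀ {h} → S h → h ◁ g → (h / g) † ◁ W
        same : ∀ {h} → S h → h ◁ g → (h / b) † ~ W
        h≁b : ∀ {h} → S h → h ◁ g → ¬ (h / b ~ 1#)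

      1◁W : 1# ◁ W
      1◁W = ◁-¬¬ λ k → S-next Sg λ { (h , Sh , q) → k (⊴-◁-trans (1⊴† (/-≉0 (S-≉0 Sh) (S-≉0 Sg)) (◁1⇒≁1 (/-◁1 q))) (slow Sh q)) }
      1⊴W = ◁⇒⊴ 1◁W
      W≉0 = ◁⇒≉0 1◁W

    -- If `(h / g) †` were not below `(h / b) †`, the gain in `lin-crit` would beat both losses by
    -- `x†ⁿ◁`, and the linear part would dominate at `h`. Since `(g / b) †` and `(h / b) †` differ
    -- by `(h / g) †`, it follows that they have the same size.
    mk-base : ∀ {b g} → 𝒦 b → ¬ (b ≈ 0#) → S g → CD b g → (∀ {h} → S h → h ◁ g → ¬ (h / b ~ 1#)) → Base b g
    mk-base {b} {g} Kb b≉0 Sg cd ≁1 = record { Kb = Kb ; b≉0 = b≉0 ; Sg = Sg ; cd = cd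
      ; slow = λ Sh q → ◁-⊴-trans (lt Sh q) (proj₂ (W~ Sh q))
      ; same = λ Sh q → ~-sym (W~ Sh q)
      ; h≁b = ≁1 }
      where
      lt : ∀ {h} → S h → h ◁ g → (h / g) † ◁ (h / b) †
      lt {h} Sh q = ◁-by λ le → notlin h Sh (lin-crit Kb b≉0 cd Sh q (1⊴† k≉0 (≁1 Sh q)) ⊴-refl
          (⊴-◁-trans (⊴-trans (*-monoˡ-⊴ _ (*-mono-⊴ (pow-mono r le) (pow-mono r le))) (⊴-reflexive (trans (*-assoc _ _ _)
            (*-congˡ (sym (trans (pow-+ w r (r ℕ.+ r)) (*-congˡ (pow-+ w r r))))))))
            (x†ⁿ◁ (r ℕ.+ (r ℕ.+ r)) κ≉0 (/-◁1 q))))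
        where
        k≉0 = /-≉0 (S-≉0 Sh) b≉0
        κ≉0 = /-≉0 (S-≉0 Sh) (S-≉0 Sg)
        w = (h / g) †
      W~ : ∀ {h} → S h → h ◁ g → (g / b) † ~ (h / b) †
      W~ {h} Sh q = close⇒~ (◁-resp (begin
          - ((h / g) †) ≈⟨ -‿cong (†-/ h≉0 g≉0) ⟩
          - (h † - g †) ≈⟨ neg-sub _ _ ⟩
          g † - h † ≈⟨ sym (sub-sub (g †) (b †) (h †)) ⟩
          (g † - b †) + (b † - h †) ≈⟨ +-cong (sym (†-/ g≉0 b≉0)) (trans (sym (neg-sub (h †) (b †))) (-‿cong (sym (†-/ h≉0 b≉0)))) ⟩
          (g / b) † - (h / b) † ∎) refl (neg-◁ (lt Sh q)))
        where
        h≉0 = S-≉0 Sh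
        g≉0 = S-≉0 Sg

    -- To avoid `h / b ~ 1#`, the radii below `g` must lie on one side of `b`: above it if `b` is
    -- not a radius of the cut; otherwise `g` is taken below `b`.
    base-exists : ∀ {b g₀} → 𝒦 b → ¬ (b ≈ 0#) → S g₀ → ¬ ¬ (∃ λ g → g ◁ g₀ × Base b g)
    base-exists {b} {g₀} Kb b≉0 S₀ k = CD-exists Kb S₀ λ { (g₁ , S₁ , q₁ , cd) → em (S b) λ
      { (inj₂ ¬Sb) → k (g₁ , q₁ , mk-base Kb b≉0 S₁ cd (λ {h} Sh _ e → ⊴◁⊥ (proj₁ e) (1◁/ (◁-by (λ le → ¬Sb (S-up Sh Kb le))))))
      ; (inj₁ Sb) → cmp g₁ b λ
        { (inj₁ lt) → k (g₁ , q₁ , mk-base Kb b≉0 S₁ cd (λ Sh q → ◁1⇒≁1 (/-◁1 (◁-trans q lt))))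
        ; (inj₂ ge) → S-next Sb λ { (g₂ , S₂ , lt) → let lt' = ◁-⊴-trans lt ge in
            k (g₂ , ◁-trans lt' q₁ , mk-base Kb b≉0 S₂ (λ l → CDl-down {b} l (S-≉0 S₂) lt' (cd l)) (λ Sh q → ◁1⇒≁1 (/-◁1 (◁-trans q lt)))) } } } }
      where
      1◁/ : ∀ {h} → b ◁ h → 1# ◁ h / b
      1◁/ q = ◁-resp (inverseʳ b b≉0) refl (*-monoʳ-◁ (b ⁻¹) (⁻¹-≉0 b≉0) q)

    -- Leading words

    tw : Carrier → Carrier → Word → Carrier
    tw b W i = T b i * pow W (wt i)

    -- Ties are broken in favour of the greater weight: apart from its diagonal part, the triangular
    -- change of scale brings in only heavier words, and `strict` makes these negligible.
    record Lead (e : ℕ) (b W : Carrier) (i* : Word) : Set (ℓ ⊔ gℓ) where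
      field
        len : length i* ≡ e
        nz : ¬ (T b i* ≈ 0#)
        top : ∀ i → length i ≡ e → tw b W i ⊴ tw b W i*
        strict : ∀ i → length i ≡ e → wt i* ℕ.< wt i → tw b W i ◁ tw b W i*

    lead-exists : ∀ {e b W} → ¬ (W ≈ 0#) → ¬ (∀ i → length i ≡ e → T b i ≈ 0#) → ¬ ¬ (∃ λ i* → Lead e b W i*)
    lead-exists {e} {b} {W} W≉0 nz k = go (e ℕ.* m) i₀ l₀ mx₀ (ℕP.m≤n+m _ _)
      where
      a = argmaxW e (tw b W)
      i₀ = proj₁ a
      l₀ = proj₁ (proj₂ a)
      mx₀ = proj₂ (proj₂ a)
      -- `n` bounds the number of times a heavier word can still take over, weights being at most
      -- `e * m`.
      go : ∀ n i → length i ≡ e → (∀ i' → length i' ≡ e → tw b W i' ⊴ tw b W i) → e ℕ.* m ℕ.≤ wt i ℕ.+ n → ⊥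
      go n i l mx bd = em (∃ λ i' → length i' ≡ e × wt i ℕ.< wt i' × tw b W i ⊴ tw b W i') λ
        { (inj₂ none) → k (i , record { len = l
            ; nz = λ z → nz λ i' l' → ⊴0⇒≈0 (*-cancelʳ-⊴ (pow W (wt i')) (pow-≉0 (wt i') W≉0) (⊴-trans (mx i' l') (⊴-reflexive (trans (*-congʳ z) (trans (zeroˡ _) (sym (zeroˡ _)))))))
            ; top = mx ; strict = λ i' l' lt → ◁-by λ le → none (i' , l' , lt , le) })
        ; (inj₁ (i' , l' , lt , le)) → step n i' l' lt le bd }
        where
        step : ∀ n i' → length i' ≡ e → wt i ℕ.< wt i' → tw b W i ⊴ tw b W i' → e ℕ.* m ℕ.≤ wt i ℕ.+ n → ⊥
        step zero i' l' lt le bd = ℕP.<-irrefl ≡.refl (ℕP.<-≤-trans lt (ℕP.≤-trans (wt-bound i') (≡.subst₂ ℕ._≤_ (≡.cong (ℕ._* m) (≡.sym l')) (ℕP.+-identityʳ _) bd)))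
        step (suc n) i' l' lt le bd = go n i' l' (λ i'' l'' → ⊴-trans (mx i'' l'') le) (ℕP.≤-trans bd (ℕP.≤-trans (ℕP.≤-reflexive (ℕP.+-suc _ _)) (ℕP.+-monoˡ-≤ n lt)))

    module Stable {b g} (B : Base b g) {e i*} (L : Lead e b (Base.W B) i*) {h} (Sh : S h) (q : h ◁ g) where
      open Base B
      open Lead L
      k = h / b
      h≉0 = S-≉0 Sh
      k≉0 = /-≉0 h≉0 b≉0
      φ = suff (replicate (D ℕ.∸ e) ŷ) Φ
      open Scale (Smat k) (fh b) (fh h) (λ j → λ t le → trans (fh-cong j (/-* b≉0) t le) (fh-expand b k j t le)) (S-tri k)
        (λ j → pow W (toℕ j)) k (S-wt k≉0 1⊴W (proj₁ (same Sh q)))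
      R≈ : ∀ i → R i ≈ pow W (wt i)
      R≈ [] = refl
      R≈ (j ∷ i) = trans (*-congˡ (R≈ i)) (sym (pow-+ W (toℕ j) (wt i)))
      T≈ : ∀ b i → length i ≡ e → ap φ (map (fh b) i) ≈ T b i
      T≈ b i l = reflexive (≡.cong (λ t → ap Φ (map (fh b) i ++ replicate (D ℕ.∸ t) ŷ)) (≡.sym l))
      tw≈ : ∀ b i → length i ≡ e → 1# * (ap φ (map (fh b) i) * R i) ≈ tw b W i
      tw≈ b i l = trans (*-identityˡ _) (*-cong (T≈ b i l) (R≈ i))
      B* = tw b W i*
      B*≉0 : ¬ (B* ≈ 0#)
      B*≉0 = *-≉0 nz (pow-≉0 (wt i*) W≉0)
      pw : ∀ (i : Word) → length i ≡ e → pow k (length i) * B* ≈ pow k e * B*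
      pw i l = *-congʳ (reflexive (≡.cong (pow k) l))

      top' : ∀ i → length i ≡ e → tw h W i ⊴ pow k e * B*
      top' i l = ⊴-resp (tw≈ h i l) (pw i l) (scale (Bnd⊴ k B*) i φ 1#
        (λ i' le → let l' = ≡.trans (≤w-len le) l in ⊴-resp (sym (tw≈ b i' l')) (sym (*-identityˡ _)) (top i' l')))

      strict' : ∀ i → length i ≡ e → wt i* ℕ.< wt i → tw h W i ◁ pow k e * B*
      strict' i l lt = ◁-resp (tw≈ h i l) (pw i l) (scale (Bnd◁ k B* k≉0 B*≉0) i φ 1#
        (λ i' le → let l' = ≡.trans (≤w-len le) l in ◁-resp (sym (tw≈ b i' l')) (sym (*-identityˡ _)) (strict i' l' (ℕP.<-≤-trans lt (≤w-wt le)))))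

      -- With the weights `pow W j` one letter costs just `k`, the diagonal entry. The error in
      -- `exact` is therefore below the main term.
      stable : T h i* ~ pow k e * T b i*
      stable = close⇒~ (*-cancelʳ-◁ (pow W (wt i*)) (◁-resp
        (trans (*-identityˡ _) (*-cong (+-cong (T≈ h i* len) (-‿cong (*-cong (reflexive (≡.cong (pow k) len)) (T≈ b i* len)))) (R≈ i*)))
        (trans (pw i* len) (sym (*-assoc _ _ _)))
        (exact (S-diag k) k≉0 B*≉0 i* φ 1# (λ i' le lt → let l' = ≡.trans (≤w-len le) len in ◁-resp (sym (tw≈ b i' l')) refl (strict i' l' lt)))))

      -- Passing to a later base can only lower the weight of the leading word.
      module Next {g'} (B' : Base h g') (g'◁h : g' ◁ h) where
        W' = Base.W B'
        W'≉0 = Base.W≉0 B'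
        W'◁W : W' ◁ W
        W'◁W = ◁-resp (†-cong (trans (*-congʳ (*-comm g κ')) (cancel-inv κ' g g≉0))) refl (slow Shh hh◁g)
          where
          g≉0 = ◁⇒≉0 q
          Sg' = Base.Sg B'
          κ' = g' / h
          -- Chosen so that `hh / g` is `g' / h`, which makes `slow` at the old base speak about
          -- `W'`. It remains in the cut because `h ◁ g` puts it above `g'`.
          hh = g * κ'
          hh◁g : hh ◁ g
          hh◁g = ◁-resp refl (*-identityʳ g) (*-monoˡ-◁ g g≉0 (/-◁1 g'◁h))
          Shh : S hh
          Shh = S-up Sg' (𝒦-* (proj₁ Sg) (𝒦-/ h≉0 (proj₁ Sg') (proj₁ Sh))) (⊴-trans (⊴-reflexive (/-* h≉0)) (*-monoʳ-⊴ κ' (◁⇒⊴ q)))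
        u = W' / W
        W'≈ : W' ≈ W * u
        W'≈ = /-* W≉0
        u≉0 = /-≉0 W'≉0 W≉0
        u⊴1 = ◁⇒⊴ (/-◁1 W'◁W)
        tw' : ∀ i → tw h W' i ≈ tw h W i * pow u (wt i)
        tw' i = trans (*-congˡ (trans (pow-cong (wt i) W'≈) (pow-* W u (wt i)))) (sym (*-assoc _ _ _))
        twk : pow k e * B* * pow u (wt i*) ⊴ tw h W' i*
        twk = ⊴-trans (⊴-reflexive (trans (*-congʳ (sym (*-assoc _ _ _))) (trans (*-assoc _ _ _) (*-congˡ (sym (trans (pow-cong (wt i*) W'≈) (pow-* W u (wt i*))))))))
          (*-monoʳ-⊴ (pow W' (wt i*)) (proj₂ stable))

        -- Replacing `W` by the smaller `W'` multiplies a weighted coefficient by `pow u (wt i)`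
        -- with `u ⊴ 1#`, so heavy words lose at least as much as light ones.
        strict'' : ∀ i → length i ≡ e → wt i* ℕ.< wt i → tw h W' i ◁ tw h W' i*
        strict'' i l lt = ⊴-◁-trans (⊴-reflexive (tw' i)) (◁-⊴-trans (*-monoʳ-◁ _ (pow-≉0 (wt i) u≉0) (strict' i l lt))
          (⊴-trans (*-monoˡ-⊴ _ (pow-anti u⊴1 (ℕP.<⇒≤ lt))) twk))

        wt-≤ : ∀ {i'} → Lead e h W' i' → wt i' ℕ.≤ wt i*
        wt-≤ {i'} L' = ℕP.≮⇒≥ λ lt → ⊴◁⊥ (Lead.top L' i* len) (strict'' i' (Lead.len L') lt)

        same-lead : ∀ {i'} → Lead e h W' i' → wt i' ≡ wt i* → Lead e h W' i*
        same-lead {i'} L' eq = record { len = len ; nz = ⊴-≉0 (proj₂ stable) (*-≉0 (pow-≉0 e k≉0) nz)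
          ; top = λ i l → ⊴-trans (Lead.top L' i l) le ; strict = strict'' }
          where
          le : tw h W' i' ⊴ tw h W' i*
          le = ⊴-trans (⊴-reflexive (tw' i')) (⊴-trans (*-monoʳ-⊴ _ (top' i' (Lead.len L'))) (⊴-trans (⊴-reflexive (*-congˡ (reflexive (≡.cong (pow u) eq)))) twk))

    -- Degrees competing with the linear part

    Compete : ℕ → Carrier → Set gℓ
    Compete d h = ∃ λ i → length i ≡ d × (∀ j → T1 h j ⊴ T h i)

    compete : ∀ {h} → S h → ¬ ¬ (∃ λ d → 2 ℕ.≤ d × d ℕ.≤ D × Compete d h)
    compete {h} Sh k = notlin h Sh (proj₁ am , proj₂ am , λ i i2 id → ◁-by λ le → k (length i , i2 , id , i , ≡.refl , λ j → ⊴-trans (proj₂ am j) le))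
      where am = argmax (T1 h)

    Cofinal : ℕ → Set (c ⊔ gℓ ⊔ p)
    Cofinal d = ∀ {h} → S h → ¬ ¬ (∃ λ h' → S h' × h' ◁ h × Compete d h')

    -- Pigeonhole on the finitely many degrees: if each stopped competing on some ball, none would
    -- compete on a common smaller ball, against `compete`.
    cofinal : ∀ {g₀} → S g₀ → ¬ ¬ (∃ λ d → 2 ℕ.≤ d × d ℕ.≤ D × Cofinal d)
    cofinal S₀ k = meet (suc D) (λ d g → ∀ {h'} → S h' → h' ◁ g → ¬ (2 ℕ.≤ toℕ d × Compete (toℕ d) h'))
      (λ d _ _ lt f Sh' q → f Sh' (◁-trans q lt))
      (λ d k' → em (2 ℕ.≤ toℕ d) λ
        { (inj₂ no2) → k' (_ , S₀ , λ _ _ cc → no2 (proj₁ cc))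
        ; (inj₁ d2) → k (toℕ d , d2 , ℕP.≤-pred (FP.toℕ<n d) , λ {h} Sh kk → k' (h , Sh , λ {h'} Sh' q cc → kk (h' , Sh' , q , proj₂ cc))) })
      S₀ λ { (g , Sg , _ , f) → S-next Sg λ { (h' , Sh' , q) → compete Sh' λ { (d , d2 , dD , cc) →
        f (fromℕ< (s≤s dD)) Sh' q (≡.subst (λ t → 2 ℕ.≤ t × Compete t h') (≡.sym (FP.toℕ-fromℕ< (s≤s dD))) (d2 , cc)) } } }

    T-zero : ∀ {b h} d → ¬ (b ≈ 0#) → ¬ (h ≈ 0#) → (∀ i → length i ≡ d → T b i ≈ 0#) → ∀ i → length i ≡ d → T h i ≈ 0#
    T-zero {b} {h} d b≉0 h≉0 z i l = ⊴0⇒≈0 (⊴-resp refl (zeroʳ _) (go (⊴-total 1# (k †))))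
      where
      k = h / b
      k≉0 = /-≉0 h≉0 b≉0
      hyp : ∀ i' → length i' ≡ length i → T b i' ⊴ 0#
      hyp i' e = ⊴-reflexive (z i' (≡.trans e l))
      w : 1# ⊴ k † ⊎ k † ⊴ 1# → Carrier
      w (inj₁ _) = k †
      w (inj₂ _) = 1#
      go : (x : 1# ⊴ k † ⊎ k † ⊴ 1#) → T h i ⊴ pow (k * pow (w (⊴-total 1# (k †))) r) (length i) * 0#
      go x with ⊴-total 1# (k †)
      ... | inj₁ q = val-unif (/-* b≉0) k≉0 q ⊴-refl Φ D i 0# hyp
      ... | inj₂ q = val-unif (/-* b≉0) k≉0 ⊴-refl q Φ D i 0# hyp

    -- By minimality of the degree, the Taylor coefficients at y have valuations in that of 𝒦.
    𝒦-value : ∀ {b} i → 𝒦 b → 1 ℕ.≤ length i → length i ℕ.≤ D → ¬ (T b i ≈ 0#) → ¬ ¬ (∃ λ a → 𝒦 a × ¬ (a ≈ 0#) × a ~ T b i)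
    𝒦-value {b} i Kb i1 iD nz k = minimal N ψ N≤ (pref-Rat {map (fh b) i} {Φ} (words-𝒦 i Kb) ratΦ) (λ z → nz (z (replicate N ŷ) (LP.length-replicate N)))
      λ { (h , (Kh , a , Ka , q) , cd) → let e = close⇒~ (recentre {h} {a} (T b i) nz q N ψ (λ j a b → ◁⇒⊴ (cd j a b))) in
        k (ap ψ (replicate N (hat a)) , pref-Rat {map (fh b) i} {Φ} (words-𝒦 i Kb) ratΦ _ (rep-𝒦 N (hat-𝒦 Ka)) , ⊴-≉0 (proj₂ e) nz , e) }
      where
      N = D ℕ.∸ length i
      ψ = pref (map (fh b) i) Φ
      N≤ : N ℕ.≤ D'
      N≤ = ℕP.∸-monoʳ-≤ D i1

    -- By `wt-≤`, a move to a later base never raises either weight. At a state of least `measure`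
    -- both weights are therefore constant, and `same-lead` keeps the old words leading.
    record State (d n : ℕ) : Set (c ⊔ ℓ ⊔ gℓ ⊔ p) where
      field
        b gₛ : Carrier
        base : Base b gₛ
        i₁ iₙ : Word
        lead₁ : Lead 1 b (Base.W base) i₁
        leadₙ : Lead d b (Base.W base) iₙ
        measure : wt i₁ ℕ.+ wt iₙ ≡ n

    leads : ∀ {d b g} → (B : Base b g) → Cofinal d → ¬ ¬ ((∃ λ i → Lead 1 b (Base.W B) i) × (∃ λ i → Lead d b (Base.W B) i))
    leads {d} {b} {g} B cof k = lead-exists {1} {b} (Base.W≉0 B) (λ z → T1-nz (Base.Kb B) (Base.b≉0 B) (Base.Sg B) (λ j → z (j ∷ []) ≡.refl)) λ L₁ →
      lead-exists {d} {b} (Base.W≉0 B) (λ z → cof (Base.Sg B) λ { (h' , Sh' , _ , i , l , le) →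
        T1-nz (proj₁ Sh') (S-≉0 Sh') Sh' (λ j → ⊴0⇒≈0 (⊴-trans (le j) (⊴-reflexive (T-zero d (Base.b≉0 B) (S-≉0 Sh') z i l)))) }) λ Lₙ → k (L₁ , Lₙ)

    module Final (e : ℕ) (d≤D : suc (suc e) ℕ.≤ D) (cof : Cofinal (suc (suc e))) where

      d = suc (suc e)

      -- `qq` is the scale at which the two leading coefficients balance: with `t = h' / qq` one has
      -- `pow t (suc e) * t₁ ~ tₙ`, where `suc e` is d - 1. Competition bounds `t₁` by `tₙ` and
      -- minimality, through `bigdeg`, bounds `tₙ` by `t₁`, each up to `pow W' N`. So `t` or its
      -- inverse is an infinitesimal not small enough for `x†ⁿ◁`, because `W' ⊴ t †`.
      finish : ∀ {n} → State d n → (∀ n' → n' ℕ.< n → ¬ State d n') → ⊥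
      finish {n} st least-n =
        𝒦-value i₁ (Base.Kb base) (≡.subst (1 ℕ.≤_) (≡.sym (Lead.len lead₁)) ℕP.≤-refl) (≡.subst (ℕ._≤ D) (≡.sym (Lead.len lead₁)) (s≤s z≤n)) (Lead.nz lead₁) λ { (k₁ , Kk₁ , k₁≉0 , k₁~) →
        𝒦-value iₙ (Base.Kb base) (≡.subst (1 ℕ.≤_) (≡.sym (Lead.len leadₙ)) (s≤s z≤n)) (≡.subst (ℕ._≤ D) (≡.sym (Lead.len leadₙ)) d≤D) (Lead.nz leadₙ) λ { (kₙ , Kkₙ , kₙ≉0 , kₙ~) →
        root e (𝒦-* (𝒦-pow (suc e) (Base.Kb base)) (𝒦-/ kₙ≉0 Kk₁ Kkₙ)) (*-≉0 (pow-≉0 (suc e) b≉0) (/-≉0 k₁≉0 kₙ≉0)) λ { (qq , Kq , q≉0 , q~) →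
        -- The base at `qq` controls `t †` and keeps `t` away from 1; the base at `h`, further along
        -- the cut, supplies the smaller `W'`.
        base-exists Kq q≉0 (Base.Sg base) λ { (h , h◁g , Bq) →
        base-exists (proj₁ (Base.Sg Bq)) (S-≉0 (Base.Sg Bq)) (Base.Sg Bq) λ { (g' , g'◁h , Bh) →
        leads Bh cof λ { ((i₁' , L₁') , (iₙ' , Lₙ')) →
        cof (Base.Sg Bh) λ { (h' , Sh' , h'◁g' , ic , lc , le) →
        main k₁ kₙ kₙ≉0 k₁≉0 k₁~ kₙ~ qq q≉0 q~ h h◁g Bq g' g'◁h Bh i₁' L₁' iₙ' Lₙ' h' Sh' h'◁g' ic lc le } } } } } } }
        where
        open State st
        open Base base using (b≉0)
        main : ∀ k₁ kₙ → ¬ (kₙ ≈ 0#) → ¬ (k₁ ≈ 0#) → k₁ ~ T b i₁ → kₙ ~ T b iₙ → ∀ qq → ¬ (qq ≈ 0#) → pow qq (suc e) ~ pow b (suc e) * (k₁ / kₙ) →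
          ∀ h → h ◁ gₛ → (Bq : Base qq h) → ∀ g' → g' ◁ h → (Bh : Base h g') → ∀ i₁' → Lead 1 h (Base.W Bh) i₁' → ∀ iₙ' → Lead d h (Base.W Bh) iₙ' →
          ∀ h' → S h' → h' ◁ g' → ∀ ic → length ic ≡ d → (∀ j → T1 h' j ⊴ T h' ic) → ⊥
        main k₁ kₙ kₙ≉0 k₁≉0 k₁~ kₙ~ qq q≉0 q~ h h◁g Bq g' g'◁h Bh i₁' L₁' iₙ' Lₙ' h' Sh' h'◁g' ic lc le = go (⊴-total t 1#)
          where
          Sh = Base.Sg Bq
          module S₁ = Stable base lead₁ Sh h◁g
          module Sₙ = Stable base leadₙ Sh h◁g
          module N₁ = S₁.Next Bh g'◁h
          module Nₙ = Sₙ.Next Bh g'◁h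
          W' = Base.W Bh
          1⊴W' = Base.1⊴W Bh
          w≥ : wt i₁ ℕ.+ wt iₙ ℕ.≤ wt i₁' ℕ.+ wt iₙ'
          w≥ = ℕP.≮⇒≥ λ lt → least-n _ (≡.subst (wt i₁' ℕ.+ wt iₙ' ℕ.<_) measure lt)
            (record { b = h ; gₛ = g' ; base = Bh ; i₁ = i₁' ; iₙ = iₙ' ; lead₁ = L₁' ; leadₙ = Lₙ' ; measure = ≡.refl })
          w₁ = N₁.wt-≤ L₁'
          wₙ = Nₙ.wt-≤ Lₙ'
          L₁ : Lead 1 h W' i₁
          L₁ = N₁.same-lead L₁' (ℕP.≤-antisym w₁ (ℕP.+-cancelʳ-≤ (wt iₙ') _ _ (ℕP.≤-trans (ℕP.+-monoʳ-≤ (wt i₁) wₙ) w≥)))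
          Lₙ : Lead d h W' iₙ
          Lₙ = Nₙ.same-lead Lₙ' (ℕP.≤-antisym wₙ (ℕP.+-cancelˡ-≤ (wt i₁') _ _ (ℕP.≤-trans (ℕP.+-monoˡ-≤ (wt iₙ) w₁) w≥)))
          module R₁ = Stable Bh L₁ Sh' h'◁g'
          module Rₙ = Stable Bh Lₙ Sh' h'◁g'
          h'≉0 = S-≉0 Sh'
          h≉0 = S-≉0 Sh
          κ = h' / h
          κ≉0 = /-≉0 h'≉0 h≉0
          t₁ = T h' i₁
          tₙ = T h' iₙ
          J₁ = wt i₁
          Jₙ = wt iₙ
          N = J₁ ℕ.+ Jₙ
          WN⊵ : ∀ {n} → n ℕ.≤ N → pow W' n ⊴ pow W' N
          WN⊵ = pow-≤ 1⊴W'
          ⊴tw : ∀ i → T h' i ⊴ tw h' W' i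
          ⊴tw i = ⊴-resp (*-identityʳ _) refl (*-monoˡ-⊴ (T h' i) (1⊴pow (wt i) 1⊴W'))
          T-i₁ : ∀ i → length i ≡ 1 → T h' i ⊴ T h' ic
          T-i₁ (j ∷ []) _ = le j
          t₁≉0 : ¬ (t₁ ≈ 0#)
          t₁≉0 = ⊴-≉0 (proj₂ R₁.stable) (*-≉0 (pow-≉0 1 R₁.k≉0) (Lead.nz L₁))
          A : t₁ ⊴ tₙ * pow W' N
          A = ⊴-trans (T-i₁ i₁ (Lead.len L₁)) (⊴-trans (⊴tw ic) (⊴-trans (Rₙ.top' ic lc) (⊴-trans (⊴-reflexive (sym (*-assoc _ _ _)))
                (*-mono-⊴ (proj₂ Rₙ.stable) (WN⊵ (ℕP.m≤n+m Jₙ J₁))))))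
          bd : ∀ j l → Smat κ j l * T1 h l ⊴ κ * (T h i₁ * pow W' J₁)
          bd j l with toℕ j ℕ.≤? toℕ l
          ... | no ¬le = ⊴-trans (⊴-reflexive (trans (*-congʳ (S-tri κ j l (ℕP.≰⇒> ¬le))) (zeroˡ _))) 0⊴
          ... | yes jl = ⊴-trans (*-monoʳ-⊴ (T1 h l) (⊴-trans (⊴-resp (*-identityʳ _) refl (*-monoˡ-⊴ (Smat κ j l) (1⊴pow (toℕ j) 1⊴W')))
                           (S-wt κ≉0 1⊴W' (proj₁ (Base.same Bh Sh' h'◁g')) j l jl)))
                         (⊴-trans (⊴-reflexive (trans (*-assoc _ _ _) (*-congˡ (trans (*-comm _ _) (*-congˡ (reflexive (≡.cong (pow W') (≡.sym (ℕP.+-identityʳ (toℕ l))))))))))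
                           (*-monoˡ-⊴ κ (Lead.top L₁ (l ∷ []) ≡.refl)))
          C : tₙ ⊴ t₁ * pow W' N
          C = ⊴-trans (bigdeg (Base.cd Bh) h'≉0 h'◁g' (/-* h≉0) bd iₙ (≡.subst (2 ℕ.≤_) (≡.sym (Lead.len Lₙ)) (s≤s (s≤s z≤n))) (≡.subst (ℕ._≤ D) (≡.sym (Lead.len Lₙ)) d≤D))
                (⊴-trans (⊴-resp refl (*-identityˡ _) (*-monoʳ-⊴ _ (◁⇒⊴ (s◁ h'≉0 h'◁g'))))
                (⊴-trans (⊴-reflexive (trans (sym (*-assoc _ _ _)) (*-congʳ (*-congʳ (sym (*-identityʳ κ))))))
                  (*-mono-⊴ (proj₂ R₁.stable) (WN⊵ (ℕP.m≤m+n J₁ Jₙ)))))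
          t = h' / qq
          t≉0 = /-≉0 h'≉0 q≉0
          κb = h' / b
          κb≈ : ∀ {x} → κ * (h / b * x) ≈ κb * x
          κb≈ {x} = trans (solve 5 (λ h' hi h bi x → (h' :* hi) :* ((h :* bi) :* x) := (h' :* bi) :* x :* (hi :* h)) refl h' (h ⁻¹) h (b ⁻¹) x)
                      (trans (*-congˡ (inverseˡ' h h≉0)) (*-identityʳ _))
          κκ≈ : κ * (h / b) ≈ κb
          κκ≈ = trans (*-congˡ (sym (*-identityʳ _))) (trans κb≈ (*-identityʳ _))
          t₁~ : t₁ ~ κb * k₁
          t₁~ = ~-trans R₁.stable (~-trans (*-mono-~ (~-reflexive (*-identityʳ κ)) (~-trans S₁.stable (*-mono-~ (~-reflexive (*-identityʳ _)) (~-sym k₁~)))) (~-reflexive κb≈))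
          tₙ~ : tₙ ~ pow κb d * kₙ
          tₙ~ = ~-trans Rₙ.stable (~-trans (*-mono-~ (~-refl {pow κ d}) (~-trans Sₙ.stable (*-mono-~ (~-refl {pow (h / b) d}) (~-sym kₙ~))))
                  (~-reflexive (trans (sym (*-assoc _ _ _)) (*-congʳ (trans (sym (pow-* κ (h / b) d)) (pow-cong d κκ≈))))))
          tq : t * qq ≈ h'
          tq = cancel-inv' h' qq q≉0
          bκ : h' ≈ b * κb
          bκ = /-* b≉0
          rel : pow t (suc e) * t₁ ~ tₙ
          rel = *-cancelʳ-~ (pow qq (suc e)) (pow-≉0 (suc e) q≉0) (~-trans (~-reflexive (begin
              (pow t (suc e) * t₁) * pow qq (suc e) ≈⟨ solve 3 (λ a b d → (a :* b) :* d := (a :* d) :* b) refl (pow t (suc e)) t₁ (pow qq (suc e)) ⟩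
              (pow t (suc e) * pow qq (suc e)) * t₁ ≈⟨ *-congʳ (trans (sym (pow-* t qq (suc e))) (trans (pow-cong (suc e) (trans tq bκ)) (pow-* b κb (suc e)))) ⟩
              (pow b (suc e) * pow κb (suc e)) * t₁ ∎)) (~-trans (*-mono-~ ~-refl t₁~) (~-trans (~-reflexive (begin
              (pow b (suc e) * pow κb (suc e)) * (κb * k₁) ≈⟨ *-congˡ (*-congˡ (sym (cancel-inv' k₁ kₙ kₙ≉0))) ⟩
              (pow b (suc e) * pow κb (suc e)) * (κb * ((k₁ / kₙ) * kₙ)) ≈⟨ solve 5 (λ B K k x y → (B :* K) :* (k :* (x :* y)) := ((k :* K) :* y) :* (B :* x)) refl (pow b (suc e)) (pow κb (suc e)) κb (k₁ / kₙ) kₙ ⟩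
              (pow κb d * kₙ) * (pow b (suc e) * (k₁ / kₙ)) ∎)) (*-mono-~ (~-sym tₙ~) (~-sym q~)))))
          h'◁h = ◁-trans h'◁g' g'◁h
          t†~ : t † ~ Base.W Bq
          t†~ = Base.same Bq Sh' h'◁h
          -- `slow` for the base at `qq`, read at the radius `g'`: there `(g' / h) †` is `W'`, and
          -- `t †` has the size of that base's own `W`.
          W'⊴t† : W' ⊴ t †
          W'⊴t† = ⊴-trans (◁⇒⊴ (Base.slow Bq (Base.Sg Bh) g'◁h)) (proj₂ t†~)
          t≁1 : ¬ (t ~ 1#)
          t≁1 = Base.h≁b Bq Sh' h'◁h
          go : t ⊴ 1# ⊎ 1# ⊴ t → ⊥
          go (inj₁ t⊴1) = cmp t 1# λ
            { (inj₂ ge) → t≁1 (t⊴1 , ge)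
            ; (inj₁ lt) → ⊴◁⊥ (⊴-trans one (*-mono-⊴ (pow-suc⊴ e t⊴1) (pow-mono N W'⊴t†))) (x†ⁿ◁ N t≉0 lt) }
            where
            one : 1# ⊴ pow t (suc e) * pow W' N
            one = *-cancelʳ-⊴ t₁ t₁≉0 (⊴-trans (⊴-reflexive (*-identityˡ _)) (⊴-trans A (⊴-trans (*-monoʳ-⊴ (pow W' N) (proj₂ rel))
                    (⊴-reflexive (solve 3 (λ a b d → (a :* b) :* d := (a :* d) :* b) refl (pow t (suc e)) t₁ (pow W' N))))))
          go (inj₂ 1⊴t) = cmp 1# t λ
            { (inj₂ ge) → t≁1 (ge , 1⊴t)
            ; (inj₁ lt) → ⊴◁⊥ (⊴-trans (⊴-reflexive (sym (inverseˡ' t t≉0))) (*-monoˡ-⊴ (t ⁻¹) (⊴-trans (⊴pow-suc e 1⊴t) (⊴-trans two (pow-mono N W'⊴ti)))))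
                            (x†ⁿ◁ N (⁻¹-≉0 t≉0) (◁-resp refl inv-1 (inv-◁ 1≉0 t≉0 lt))) }
            where
            W'⊴ti : W' ⊴ (t ⁻¹) †
            W'⊴ti = ⊴-trans W'⊴t† (⊴-trans (proj₂ neg-~) (⊴-reflexive (sym (†-inv t≉0))))
            two : pow t (suc e) ⊴ pow W' N
            two = *-cancelʳ-⊴ t₁ t₁≉0 (⊴-trans (proj₁ rel) (⊴-trans C (⊴-reflexive (*-comm _ _))))

    contradiction-from : ∀ {g₀} → S g₀ → ⊥
    contradiction-from S₀ = cofinal S₀ λ { (suc (suc e) , s≤s (s≤s z≤n) , dD , cof) →
      base-exists 𝒦-1 1≉0 S₀ λ { (g , _ , B) → leads B cof λ { ((i₁ , L₁) , (iₙ , Lₙ)) →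
        least (State (suc (suc e))) _ (record { b = 1# ; gₛ = g ; base = B ; i₁ = i₁ ; iₙ = iₙ ; lead₁ = L₁ ; leadₙ = Lₙ ; measure = ≡.refl }) λ { (n , st , lst) →
          Final.finish e dD cof st lst } } } }

-- Existence of best approximations to differentially algebraic elements.

module BestApproximation {c ℓ g gℓ p} (F : ValuedDifferentialField c ℓ g gℓ)
  (hasy : ValuedDifferentialField.HAsymptotic F) (max0 : ValuedDifferentialField.Max0 F) (K : GroundField.Ground F hasy max0 p) (r : ℕ) where

  open NonlinearCase F hasy max0 K r
  open Sol using (solve; _:*_; _:+_; _:=_)
  open import Relation.Binary.Reasoning.Setoid setoid

  -- A differential polynomial as a symmetric multilinear form

  constForm : Carrier → Form
  constForm a = record
    { ap = f ; hd-cong = λ _ → refl ; hd-+ = λ _ _ _ → sym (+-identityˡ 0#) ; hd-* = λ a _ _ → sym (zeroʳ a) ; symm = sy }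
    where
    f : List V → Carrier
    f [] = a
    f (_ ∷ _) = 0#
    sy : ∀ {xs ys} → xs ↭ ys → f xs ≈ f ys
    sy Perm.refl = refl
    sy (Perm.prep x p) = refl
    sy (Perm.swap x y p) = refl
    sy (Perm.trans p q) = trans (sy p) (sy q)

  zeroForm : Form
  zeroForm = record { ap = λ _ → 0# ; hd-cong = λ _ → refl ; hd-+ = λ _ _ _ → sym (+-identityˡ 0#) ; hd-* = λ a _ _ → sym (zeroʳ a) ; symm = λ _ → refl }

  addForm : Form → Form → Form
  addForm φ ψ = record
    { ap = λ zs → ap φ zs + ap ψ zs
    ; hd-cong = λ e → +-cong (hd-cong φ e) (hd-cong ψ e)
    ; hd-+ = λ x y zs → trans (+-cong (hd-+ φ x y zs) (hd-+ ψ x y zs)) (+-interchange _ _ _ _)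
    ; hd-* = λ a x zs → trans (+-cong (hd-* φ a x zs) (hd-* ψ a x zs)) (sym (distribˡ a _ _))
    ; symm = λ q → +-cong (symm φ q) (symm ψ q) }

  sumForm : ∀ n → (Fin n → Form) → Form
  sumForm zero φ = zeroForm
  sumForm (suc n) φ = addForm (φ fzero) (sumForm n (φ ∘ fsuc))

  sumForm-ap : ∀ n (φ : Fin n → Form) zs → ap (sumForm n φ) zs ≈ sumFin n (λ i → ap (φ i) zs)
  sumForm-ap zero φ zs = refl
  sumForm-ap (suc n) φ zs = +-congˡ (sumForm-ap n (φ ∘ fsuc) zs)

  -- Symmetrised product with the n-th coordinate.
  pr : ℕ → (List V → Carrier) → List V → Carrier
  pr n ψ [] = 0#
  pr n ψ (x ∷ xs) = x n * ψ xs + pr n (λ zs → ψ (x ∷ zs)) xs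

  pr-cong : ∀ n {ψ ψ'} xs → (∀ zs → ψ zs ≈ ψ' zs) → pr n ψ xs ≈ pr n ψ' xs
  pr-cong n [] e = refl
  pr-cong n (x ∷ xs) e = +-cong (*-congˡ (e xs)) (pr-cong n xs (λ zs → e (x ∷ zs)))

  pr-+ : ∀ n ψ ψ' xs → pr n (λ zs → ψ zs + ψ' zs) xs ≈ pr n ψ xs + pr n ψ' xs
  pr-+ n ψ ψ' [] = sym (+-identityˡ 0#)
  pr-+ n ψ ψ' (x ∷ xs) = trans (+-cong (distribˡ _ _ _) (pr-+ n _ _ xs)) (+-interchange _ _ _ _)

  pr-* : ∀ n a ψ xs → pr n (λ zs → a * ψ zs) xs ≈ a * pr n ψ xs
  pr-* n a ψ [] = sym (zeroʳ a)
  pr-* n a ψ (x ∷ xs) = trans (+-cong (solve 3 (λ x a b → x :* (a :* b) := a :* (x :* b)) refl _ _ _) (pr-* n a _ xs)) (sym (distribˡ a _ _))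

  pr-symm : ∀ n ψ → (∀ {xs ys} → xs ↭ ys → ψ xs ≈ ψ ys) → ∀ {xs ys} → xs ↭ ys → pr n ψ xs ≈ pr n ψ ys
  pr-symm n ψ s Perm.refl = refl
  pr-symm n ψ s (Perm.prep x p) = +-cong (*-congˡ (s p)) (pr-symm n _ (λ q → s (Perm.prep x q)) p)
  pr-symm n ψ s {xs = x ∷ y ∷ xs} {ys = _ ∷ _ ∷ ys} (Perm.swap x y p) = begin
    x n * ψ (y ∷ xs) + (y n * ψ (x ∷ xs) + pr n (λ zs → ψ (x ∷ y ∷ zs)) xs)
      ≈⟨ solve 3 (λ a b d → a :+ (b :+ d) := b :+ (a :+ d)) refl _ _ _ ⟩
    y n * ψ (x ∷ xs) + (x n * ψ (y ∷ xs) + pr n (λ zs → ψ (x ∷ y ∷ zs)) xs)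
      ≈⟨ +-cong (*-congˡ (s (Perm.prep x p))) (+-cong (*-congˡ (s (Perm.prep y p))) (trans (pr-cong n xs (λ zs → s (Perm.swap x y ↭-refl))) (pr-symm n _ (λ q → s (Perm.prep y (Perm.prep x q))) p))) ⟩
    y n * ψ (x ∷ ys) + (x n * ψ (y ∷ ys) + pr n (λ zs → ψ (y ∷ x ∷ zs)) ys) ∎
  pr-symm n ψ s (Perm.trans p q) = trans (pr-symm n ψ s p) (pr-symm n ψ s q)

  prodForm : ∀ n → n ℕ.≤ m → Form → Form
  prodForm n le φ = record
    { ap = pr n (ap φ)
    ; hd-cong = λ {x} {y} {zs} e → +-cong (*-congʳ (e n le)) (pr-cong n zs (λ ws → hd-cong φ e))
    ; hd-+ = λ x y zs → trans (+-cong (distribʳ _ _ _) (trans (pr-cong n zs (λ ws → hd-+ φ x y ws)) (pr-+ n _ _ zs))) (+-interchange _ _ _ _)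
    ; hd-* = λ a x zs → trans (+-cong (*-assoc _ _ _) (trans (pr-cong n zs (λ ws → hd-* φ a x ws)) (pr-* n a _ zs))) (sym (distribˡ a _ _))
    ; symm = pr-symm n (ap φ) (symm φ) }

  pr-diag : ∀ n ψ N x → pr n ψ (replicate (suc N) x) ≈ nat (suc N) * (x n * ψ (replicate N x))
  pr-diag n ψ zero x = trans (+-identityʳ _) (sym (trans (*-congʳ (+-identityʳ 1#)) (*-identityˡ _)))
  pr-diag n ψ (suc N) x = trans (+-cong (sym (*-identityˡ _)) (pr-diag n (λ zs → ψ (x ∷ zs)) N x)) (sym (distribʳ _ _ _))

  powForm : ∀ n → n ℕ.≤ m → ℕ → Form → Form
  powForm n le zero φ = φ
  powForm n le (suc e) φ = prodForm n le (powForm n le e φ)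

  -- The rising factorial (N + 1)⋯(N + e), which accumulates from `pr-diag`.
  rise : ℕ → ℕ → Carrier
  rise N zero = 1#
  rise N (suc e) = nat (suc (e ℕ.+ N)) * rise N e

  rise-+ : ∀ N a e → rise (a ℕ.+ N) e * rise N a ≈ rise N (e ℕ.+ a)
  rise-+ N a zero = *-identityˡ _
  rise-+ N a (suc e) = trans (*-assoc _ _ _) (*-cong (reflexive (≡.cong (λ t → nat (suc t)) (≡.sym (ℕP.+-assoc e a N)))) (rise-+ N a e))

  rise-≉0 : ∀ N e → ¬ (rise N e ≈ 0#)
  rise-≉0 N zero = 1≉0
  rise-≉0 N (suc e) = *-≉0 (char0 (e ℕ.+ N)) (rise-≉0 N e)

  powForm-diag : ∀ n le e φ N x → ap (powForm n le e φ) (replicate (e ℕ.+ N) x) ≈ pow (x n) e * (rise N e * ap φ (replicate N x))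
  powForm-diag n le zero φ N x = sym (trans (*-identityˡ _) (*-identityˡ _))
  powForm-diag n le (suc e) φ N x = trans (pr-diag n (ap (powForm n le e φ)) (e ℕ.+ N) x) (trans (*-congˡ (*-congˡ (powForm-diag n le e φ N x)))
    (solve 5 (λ k x p r a → k :* (x :* (p :* (r :* a))) := (x :* p) :* ((k :* r) :* a)) refl _ _ _ _ _))

  -- Each variable contributes degree exactly `d`, its exponent being completed by powers of the
  -- homogenising coordinate; `o` counts the variables already treated, so the next one sits in
  -- coordinate `suc o`.
  build : ∀ {d} k o → k ℕ.+ o ≡ m → (Vec (Fin (suc d)) k → Carrier) → Form
  summand : ∀ {d} k o → suc k ℕ.+ o ≡ m → (Vec (Fin (suc d)) (suc k) → Carrier) → Fin (suc d) → Form

  build zero o e cf = constForm (cf [])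
  build {d} (suc k) o e cf = sumForm (suc d) (summand k o e cf)

  summand {d} k o e cf i = powForm (suc o) (≡.subst (suc o ℕ.≤_) e (s≤s (ℕP.m≤n+m o k))) (toℕ i)
    (powForm 0 z≤n (d ℕ.∸ toℕ i) (build k (suc o) (≡.trans (ℕP.+-suc k o) e) (λ es → cf (i ∷ es))))

  -- By the completion to degree `d` and `rise-+`, the numerical factor is the same for all exponent
  -- vectors, so it can be divided out of the whole polynomial.
  factor : ℕ → ℕ → Carrier
  factor d zero = 1#
  factor d (suc k) = rise (k ℕ.* d) d * factor d k

  factor-≉0 : ∀ d k → ¬ (factor d k ≈ 0#)
  factor-≉0 d zero = 1≉0
  factor-≉0 d (suc k) = *-≉0 (rise-≉0 _ d) (factor-≉0 d k)

  build-diag : ∀ {d} k o e (cf : Vec (Fin (suc d)) k → Carrier) x → x 0 ≈ 1# →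
    ap (build k o e cf) (replicate (k ℕ.* d) x) ≈ factor d k * evalAux k cf (λ i → x (suc (toℕ i ℕ.+ o)))
  build-diag zero o e cf x x0 = sym (*-identityˡ _)
  build-diag {d} (suc k) o e cf x x0 = trans (sumForm-ap (suc d) (summand k o e cf) (replicate (d ℕ.+ k ℕ.* d) x)) (trans (sumFin-cong (suc d) {λ i → ap (summand k o e cf i) (replicate (d ℕ.+ k ℕ.* d) x)} {λ i → factor d (suc k) * sl i} term) (sumFin-*ˡ (suc d) (factor d (suc k)) sl))
    where
    N = k ℕ.* d
    e' = ≡.trans (ℕP.+-suc k o) e
    le : suc o ℕ.≤ m
    le = ≡.subst (suc o ℕ.≤_) e (s≤s (ℕP.m≤n+m o k))
    sl : Fin (suc d) → Carrier
    sl i = pow (x (suc o)) (toℕ i) * evalAux k (λ es → cf (i ∷ es)) (λ i → x (suc (suc (toℕ i) ℕ.+ o)))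
    term : ∀ i → ap (summand k o e cf i) (replicate (d ℕ.+ N) x) ≈ factor d (suc k) * sl i
    term i = begin
      ap (powForm (suc o) le ti (powForm 0 z≤n a B)) (replicate (d ℕ.+ N) x)
        ≈⟨ reflexive (≡.cong (λ t → ap (powForm (suc o) le ti (powForm 0 z≤n a B)) (replicate t x)) (≡.trans (≡.cong (ℕ._+ N) (≡.sym (ℕP.m+[n∸m]≡n ti≤))) (ℕP.+-assoc ti a N))) ⟩
      ap (powForm (suc o) le ti (powForm 0 z≤n a B)) (replicate (ti ℕ.+ (a ℕ.+ N)) x)
        ≈⟨ trans (powForm-diag (suc o) le ti (powForm 0 z≤n a B) (a ℕ.+ N) x) (*-congˡ (*-congˡ (powForm-diag 0 z≤n a B N x))) ⟩
      X * (rise (a ℕ.+ N) ti * (pow (x 0) a * (rise N a * ap B (replicate N x))))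
        ≈⟨ *-congˡ (*-congˡ (trans (*-congʳ (trans (pow-cong a x0) (1pow a))) (*-identityˡ _))) ⟩
      X * (rise (a ℕ.+ N) ti * (rise N a * ap B (replicate N x)))
        ≈⟨ *-congˡ (trans (sym (*-assoc _ _ _)) (*-cong (trans (rise-+ N a ti) (reflexive (≡.cong (rise N) (ℕP.m+[n∸m]≡n ti≤)))) (build-diag k (suc o) e' (λ es → cf (i ∷ es)) x x0))) ⟩
      X * (rise N d * (factor d k * evalAux k (λ es → cf (i ∷ es)) (λ i → x (suc (toℕ i ℕ.+ suc o)))))
        ≈⟨ *-congˡ (*-congˡ (*-congˡ (evalAux-cong k (λ _ → refl) (λ i → reflexive (≡.cong (x ∘ suc) (ℕP.+-suc (toℕ i) o)))))) ⟩
      X * (rise N d * (factor d k * E)) ≈⟨ solve 4 (λ X r f E → X :* (r :* (f :* E)) := (r :* f) :* (X :* E)) refl X (rise N d) (factor d k) E ⟩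
      factor d (suc k) * sl i ∎
      where
      ti = toℕ i
      ti≤ : ti ℕ.≤ d
      ti≤ = ℕP.≤-pred (FP.toℕ<n i)
      a = d ℕ.∸ ti
      B = build k (suc o) e' (λ es → cf (i ∷ es))
      X = pow (x (suc o)) ti
      E = evalAux k (λ es → cf (i ∷ es)) (λ i → x (suc (suc (toℕ i) ℕ.+ o)))

  -- Identity theorem for polynomial functions

  small-elt : ¬ ¬ (∃ λ t → ¬ (t ≈ 0#) × t ◁ 1#)
  small-elt k with proj₂ max0
  ... | h , h≉0 , h≭1 , _ = cmp h 1# λ
    { (inj₁ q) → k (h , h≉0 , q)
    ; (inj₂ ge) → cmp 1# h λ
        { (inj₁ q) → k (h ⁻¹ , ⁻¹-≉0 h≉0 , ◁-resp refl inv-1 (inv-◁ 1≉0 h≉0 q))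
        ; (inj₂ le) → ~1⇒¬¬≍1 (le , ge) h≭1 } }

  dominate : ∀ {t} → ¬ (t ≈ 0#) → t ◁ 1# → ∀ n (a : Fin n → Carrier) {a₀} → ¬ (a₀ ≈ 0#) → ∃ λ x → ¬ (x ≈ 0#) × x ⊴ 1# × (∀ i → x * a i ◁ a₀)
  dominate {t} t≉0 t◁1 zero a a₀≉0 = t , t≉0 , ◁⇒⊴ t◁1 , λ ()
  dominate {t} t≉0 t◁1 (suc n) a {a₀} a₀≉0 with argmax a
  ... | i , mx with ⊴-total (a i) a₀
  ... | inj₁ le = t , t≉0 , ◁⇒⊴ t◁1 , λ j → ◁-resp refl (*-identityˡ a₀) (*-mono-◁⊴ t◁1 (⊴-trans (mx j) le) a₀≉0)
  ... | inj₂ ge = t * u , *-≉0 t≉0 (*-≉0 a₀≉0 (⁻¹-≉0 M≉0)) , ⊴-trans (*-mono-⊴ (◁⇒⊴ t◁1) u⊴1) (⊴-reflexive (*-identityˡ 1#)) ,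
      λ j → ⊴-◁-trans (⊴-trans (*-monoˡ-⊴ (t * u) (mx j)) (⊴-reflexive (trans (*-assoc _ _ _) (*-congˡ (cancel-inv' a₀ (a i) M≉0)))))
              (◁-resp refl (*-identityˡ a₀) (*-monoʳ-◁ a₀ a₀≉0 t◁1))
    where
    M≉0 = ⊴-≉0 ge a₀≉0
    u = a₀ * (a i) ⁻¹
    u⊴1 : u ⊴ 1#
    u⊴1 = ⊴-trans (*-monoʳ-⊴ ((a i) ⁻¹) ge) (⊴-reflexive (inverseʳ (a i) M≉0))

  -- At a sufficiently small nonzero `x`, a nonzero constant coefficient would dominate the sum.
  -- Once it is zero, `x` can be cancelled, which is why only nonzero `x` are considered.
  vanish₁ : ∀ n (a : Fin n → Carrier) → (∀ x → ¬ (x ≈ 0#) → sumFin n (λ e → pow x (toℕ e) * a e) ≈ 0#) → ∀ e → ¬ ¬ (a e ≈ 0#)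
  vanish₁ (suc n) a h e k = small-elt λ { (t , t≉0 , t◁1) → lem t t≉0 t◁1 (a fzero ≟0) e k }
    where
    tail : ∀ x → sumFin n (λ i → pow x (suc (toℕ i)) * a (fsuc i)) ≈ x * sumFin n (λ i → pow x (toℕ i) * a (fsuc i))
    tail x = trans (sumFin-cong n (λ i → *-assoc x (pow x (toℕ i)) (a (fsuc i)))) (sumFin-*ˡ n x _)
    lem : ∀ t → ¬ (t ≈ 0#) → t ◁ 1# → Dec (a fzero ≈ 0#) → ∀ e → ¬ ¬ (a e ≈ 0#)
    lem t t≉0 t◁1 (no a₀≉0) _ _ with dominate t≉0 t◁1 n (a ∘ fsuc) a₀≉0
    ... | x , x≉0 , x⊴1 , dom = a₀≉0 (⊴0⇒≈0 (⊴-trans (proj₂ (+-absorb {sumFin n (λ i → pow x (suc (toℕ i)) * a (fsuc i))} small)) (⊴-reflexive (trans (+-comm _ _) (trans (+-congʳ (sym (*-identityˡ _))) (h x x≉0))))))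
      where
      small : sumFin n (λ i → pow x (suc (toℕ i)) * a (fsuc i)) ◁ a fzero
      small = sumFin-◁ n a₀≉0 (λ i → ⊴-◁-trans (*-monoʳ-⊴ (a (fsuc i)) (pow-suc⊴ (toℕ i) x⊴1)) (dom i))
    lem t t≉0 t◁1 (yes z) fzero k = k z
    lem t t≉0 t◁1 (yes z) (fsuc e) k = vanish₁ n (a ∘ fsuc) (λ x x≉0 → cz x x≉0 (trans (sym (tail x))
        (trans (sym (trans (+-congʳ (trans (*-congˡ z) (zeroʳ _))) (+-identityˡ _))) (h x x≉0)))) e k
      where
      cz : ∀ x → ¬ (x ≈ 0#) → ∀ {s} → x * s ≈ 0# → s ≈ 0#
      cz x x≉0 {s} q = trans (sym (cancel-inv s x x≉0)) (trans (*-congʳ (trans (*-comm s x) q)) (zeroˡ _))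

  vanish : ∀ {d} k (cf : Vec (Fin (suc d)) k → Carrier) → (∀ xs → evalAux k cf xs ≈ 0#) → ∀ e → cf e ≈ 0#
  vanish zero cf h [] = h (λ ())
  vanish {d} (suc k) cf h (e ∷ es) = vanish k (λ es → cf (e ∷ es)) (λ xs → dec (vanish₁ (suc d) (λ e → evalAux k (λ es → cf (e ∷ es)) xs)
      (λ x _ → h (λ { fzero → x ; (fsuc i) → xs i })) e)) es
    where
    dec : ∀ {x} → ¬ ¬ (x ≈ 0#) → x ≈ 0#
    dec {x} n with x ≟0
    ... | yes z = z
    ... | no ¬z = ⊥-elim (n ¬z)

  toV : ∀ k → (Fin k → Carrier) → V
  toV zero xs _ = 0#
  toV (suc k) xs zero = xs fzero
  toV (suc k) xs (suc i) = toV k (xs ∘ fsuc) i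

  toV-≈ : ∀ k xs (i : Fin k) → toV k xs (toℕ i) ≈ xs i
  toV-≈ (suc k) xs fzero = refl
  toV-≈ (suc k) xs (fsuc i) = toV-≈ k (xs ∘ fsuc) i

  -- Best approximations

  module _ (y : Carrier) (no-best : ∀ a → 𝒦 a → ¬ ¬ (∃ λ b → 𝒦 b × y - b ◁ y - a)) where
    open Cut y no-best

    𝒦-pr : ∀ n ψ → (∀ zs → All 𝒦V zs → 𝒦 (ψ zs)) → ∀ zs → All 𝒦V zs → 𝒦 (pr n ψ zs)
    𝒦-pr n ψ R [] [] = 𝒦-0
    𝒦-pr n ψ R (z ∷ zs) (a ∷ as) = 𝒦-+ (𝒦-* (a n) (R zs as)) (𝒦-pr n _ (λ ws bs → R (z ∷ ws) (a ∷ bs)) zs as)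

    𝒦-powForm : ∀ n le e φ → Rat φ → Rat (powForm n le e φ)
    𝒦-powForm n le zero φ R = R
    𝒦-powForm n le (suc e) φ R = 𝒦-pr n _ (𝒦-powForm n le e φ R)

    𝒦-sumForm : ∀ n φ → (∀ i → Rat (φ i)) → Rat (sumForm n φ)
    𝒦-sumForm zero φ R zs a = 𝒦-0
    𝒦-sumForm (suc n) φ R zs a = 𝒦-+ (R fzero zs a) (𝒦-sumForm n (φ ∘ fsuc) (R ∘ fsuc) zs a)

    build-Rat : ∀ {d} k o e (cf : Vec (Fin (suc d)) k → Carrier) → (∀ es → 𝒦 (cf es)) → Rat (build k o e cf)
    build-Rat zero o e cf R [] _ = R []
    build-Rat zero o e cf R (_ ∷ _) _ = 𝒦-0
    build-Rat {d} (suc k) o e cf R = 𝒦-sumForm (suc d) (summand k o e cf) (λ i → 𝒦-powForm (suc o) _ (toℕ i) (powForm 0 z≤n (d ℕ.∸ toℕ i) (B i)) (𝒦-powForm 0 z≤n (d ℕ.∸ toℕ i) (B i) (build-Rat k (suc o) _ (λ es → cf (i ∷ es)) (λ es → R (i ∷ es)))))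
      where
      B : Fin (suc d) → Form
      B i = build k (suc o) (≡.trans (ℕP.+-suc k o) e) (λ es → cf (i ∷ es))

    Bad : ℕ → Set (c ⊔ ℓ ⊔ gℓ ⊔ p)
    Bad n = ∃ λ φ → Rat φ × NZ φ n × (∀ h → S h → ¬ ConstDom φ n h)

    -- A bad form of least degree is a `MinimalForm`: leastness says that nonzero forms of smaller
    -- degree are dominated by their constant term on some ball. In degree 0 there is nothing to
    -- dominate.
    no-bad : ∀ n → ¬ Bad n
    no-bad n bad = no-best 0# 𝒦-0 λ { (b , Kb , q) → least Bad n bad λ
      { (zero , (φ , R , nz , nc) , _) → nc _ (proj₁ (S-diff 𝒦-0 Kb q)) (λ { (j ∷ i) _ () })
      ; (suc D' , (φ , R , nz , nc) , lst) →
          let minΦ = record { ratΦ = R ; nzΦ = nz ; nonconst = nc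
                            ; minimal = λ N ψ le Rψ nzψ k → lst N (s≤s le) (ψ , Rψ , nzψ , λ h Sh cd → k (h , Sh , cd)) }
          in em (∃ λ h → S h × Core.LIN y no-best D' φ minΦ h) λ
               { (inj₁ (h , Sh , L)) → Core.LinCase.contradiction y no-best D' φ minΦ h Sh L
               ; (inj₂ none) → NotLin.contradiction-from y no-best D' φ minΦ (λ h Sh L → none (h , Sh , L)) (proj₁ (S-diff 𝒦-0 Kb q)) } } }

    -- Nonvanishing is tested on arbitrary tuples, not only on jets of elements: there the form is a
    -- nonzero multiple of the polynomial, and `vanish` applies.
    form-of : ∀ {d} k → k ℕ.+ 0 ≡ m → (P : Vec (Fin (suc d)) k → Carrier) → (∀ e → 𝒦 (P e)) → (∃ λ e → ¬ (P e ≈ 0#)) →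
      evalAux k P (λ i → ∂^ (toℕ i) y) ≈ 0# → ∃ λ φ → Rat φ × NZ φ (k ℕ.* d) × ap φ (replicate (k ℕ.* d) ŷ) ≈ 0#
    form-of {d} k k≡m P KP (e , Pe≉0) ev0 = φ , build-Rat k 0 k≡m P KP , nzφ , at-y
      where
      φ = build k 0 k≡m P
      at-y : ap φ (replicate (k ℕ.* d) ŷ) ≈ 0#
      at-y = trans (build-diag k 0 k≡m P ŷ refl)
        (trans (*-congˡ (trans (evalAux-cong k (λ _ → refl) (λ i → reflexive (≡.cong (λ t → ∂^ t y) (ℕP.+-identityʳ (toℕ i))))) ev0)) (zeroʳ _))
      nzφ : NZ φ (k ℕ.* d)
      nzφ z = Pe≉0 (vanish k P ev≈0 e)
        where
        ev≈0 : ∀ xs → evalAux k P xs ≈ 0#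
        ev≈0 xs = trans (sym (cancel-inv (evalAux k P xs) (factor d k) (factor-≉0 d k))) (trans (*-congʳ (begin
          evalAux k P xs * factor d k ≈⟨ *-comm _ _ ⟩
          factor d k * evalAux k P xs ≈⟨ *-congˡ (evalAux-cong k (λ _ → refl) (λ i → sym (trans (reflexive (≡.cong (toV k xs) (ℕP.+-identityʳ (toℕ i)))) (toV-≈ k xs i)))) ⟩
          factor d k * evalAux k P (λ i → (1# ∷∞ toV k xs) (suc (toℕ i ℕ.+ 0))) ≈⟨ sym (build-diag k 0 k≡m P (1# ∷∞ toV k xs) refl) ⟩
          ap φ (replicate (k ℕ.* d) (1# ∷∞ toV k xs)) ≈⟨ z _ (LP.length-replicate (k ℕ.* d)) ⟩
          0# ∎)) (zeroˡ _))

    -- The form of a differential polynomial vanishing at y is not dominated by its constant term anywhere on the cut.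
    not-d-algebraic : ∀ d (P : DiffPoly r d) → (∀ e → 𝒦 (P e)) → (∃ λ e → ¬ (P e ≈ 0#)) → ¬ (evalDP P y ≈ 0#)
    not-d-algebraic d P KP nz ev0 = go (m ℕ.* d) (form-of m (ℕP.+-identityʳ m) P KP nz ev0)
      where
      go : ∀ n → (∃ λ φ → Rat φ × NZ φ n × ap φ (replicate n ŷ) ≈ 0#) → ⊥
      go zero (φ , _ , nzφ , at-y) = nzφ λ { [] _ → at-y }
      go (suc n) (φ , R , nzφ , at-y) = no-bad (suc n) (φ , R , nzφ , λ h Sh cd → ◁⇒≉0 (cd (fzero ∷ []) ℕP.≤-refl (s≤s z≤n)) at-y)

-- Chains of logarithmic derivatives with independent values.

module Independence {c ℓ g gℓ p} (F : ValuedDifferentialField c ℓ g gℓ)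
  (hasy : ValuedDifferentialField.HAsymptotic F) (max0 : ValuedDifferentialField.Max0 F) (K : GroundField.Ground F hasy max0 p) where

  open MaxZero F hasy max0
  open GroundField.Ground K
  open Sol using (solve; _:*_; _:+_; _:=_)
  open import Relation.Binary.Reasoning.Setoid setoid

  DAlgebraic : Carrier → Set (c ⊔ ℓ ⊔ p)
  DAlgebraic y = ∃ λ r → ∃ λ d → ∃ λ (P : DiffPoly r d) → (∀ e → 𝒦 (P e)) × (∃ λ e → ¬ (P e ≈ 0#)) × evalDP P y ≈ 0#

  best : ∀ {y} → DAlgebraic y → ¬ ¬ (∃ λ a → 𝒦 a × (∀ b → 𝒦 b → y - a ⊴ y - b))
  best {y} (r , d , P , KP , nz , ev) k = BestApproximation.not-d-algebraic F hasy max0 K r y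
    (λ a Ka k' → k (a , Ka , λ b Kb → ⊴-by λ lt → k' (b , Kb , lt))) d P KP nz ev

  Outer : Carrier → Set (c ⊔ ℓ ⊔ gℓ ⊔ p)
  Outer y = ¬ (y ≈ 0#) × (∀ b → 𝒦 b → ¬ (y ~ b))

  -- If `y - a ~ b` with `b` in 𝒦, equality of the residue fields would give `x` in 𝒦 infinitely
  -- close to `(y - a) * b ⁻¹`, and `a + b * x` would be closer to `y` than `a`.
  best⇒Outer : ∀ {y a} → (∀ x → 𝒦 x → ¬ (x ≈ y)) → 𝒦 a → (∀ b → 𝒦 b → y - a ⊴ y - b) → Outer (y - a)
  best⇒Outer {y} {a} y∉ Ka bst = n , λ b Kb e →
    let b≉0 = ⊴-≉0 (proj₁ e) n in
    residue (⊴-trans (*-monoʳ-⊴ (b ⁻¹) (proj₁ e)) (⊴-reflexive (inverseʳ b b≉0))) λ { (x , Kx , q) →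
      ⊴◁⊥ (⊴-trans (proj₂ e) (bst (a + b * x) (𝒦-+ Ka (𝒦-* Kb Kx))))
        (◁-resp (eq b x b≉0) (*-identityˡ b) (*-monoʳ-◁ b b≉0 (neg-◁ q))) }
    where
    import Algebra.Properties.Ring ring as RP
    n : ¬ (y - a ≈ 0#)
    n z = y∉ a Ka (sym (x-y≈0⇒x≈y z))
    eq : ∀ b x → ¬ (b ≈ 0#) → - (x - (y - a) * b ⁻¹) * b ≈ y - (a + b * x)
    eq b x b≉0 = begin
      - (x - (y - a) * b ⁻¹) * b ≈⟨ *-congʳ (neg-sub _ _) ⟩
      ((y - a) * b ⁻¹ - x) * b ≈⟨ distribʳ _ _ _ ⟩
      ((y - a) * b ⁻¹) * b + (- x) * b ≈⟨ +-cong (cancel-inv' _ b b≉0) (trans (sym (RP.-‿distribˡ-* x b)) (-‿cong (*-comm x b))) ⟩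
      (y - a) - b * x ≈⟨ trans (+-assoc _ _ _) (+-congˡ (RP.-‿+-comm a (b * x))) ⟩
      y - (a + b * x) ∎

  ≁1 : ∀ {y z} → Outer y → 𝒦 z → ¬ (z ≈ 0#) → ¬ (y * z ⁻¹ ~ 1#)
  ≁1 {y} {z} (_ , o) Kz z≉0 e = o z Kz (~-trans (~-reflexive (sym (cancel-inv' y z z≉0))) (~-trans (*-mono-~ e ~-refl) (~-reflexive (*-identityˡ z))))

  -- `y'` is `y †` minus its best approximation `b`. As each `z †` competes with `b`, no quotient of
  -- `y` by an element of 𝒦 has a logarithmic derivative below `y'`.
  record Link (y y' b : Carrier) : Set (c ⊔ ℓ ⊔ gℓ ⊔ p) where
    field
      outer : Outer y
      Kb : 𝒦 b
      dlog : y † ≈ y' + b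
      least : ∀ z → 𝒦 z → ¬ (z ≈ 0#) → y' ⊴ (y * z ⁻¹) †
      large : 1# ◁ y'

  module _ (dalg : ∀ y → DAlgebraic y) where

    next : ∀ {y} → Outer y → ¬ ¬ (∃ λ y' → ∃ λ b → Outer y' × Link y y' b)
    next {y} O@(y≉0 , _) k = best (dalg (y †)) λ { (b , Kb , bst) →
      let O' = best⇒Outer y†∉ Kb bst
          lst : ∀ z → 𝒦 z → ¬ (z ≈ 0#) → y † - b ⊴ (y * z ⁻¹) †
          lst z Kz z≉0 = ⊴-trans (bst (z †) (𝒦-* (𝒦-∂ Kz) (𝒦-inv z≉0 Kz))) (⊴-reflexive (sym (†-/ y≉0 z≉0)))
          -- With `b` written as `z †`, the difference is the logarithmic derivative of `y * z ⁻¹`,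
          -- at least 1 by max 0; size exactly 1 is excluded because its value lies outside that of
          -- 𝒦.
          lrg : 1# ◁ y † - b
          lrg = ◁-by λ le → exp-int Kb λ { (z , Kz , z≉0 , e) → proj₂ O' 1# 𝒦-1
                  (le , ⊴-resp refl (trans (†-/ y≉0 z≉0) (+-congˡ (-‿cong e))) (1⊴† (*-≉0 y≉0 (⁻¹-≉0 z≉0)) (≁1 O Kz z≉0))) }
      in k (y † - b , b , O' , record { outer = O ; Kb = Kb ; dlog = sym (x-y+y _ _) ; least = lst ; large = lrg }) }
      where
      -- If `y †` equalled `z †` with `z` in 𝒦, then `y * z ⁻¹` would be a constant, hence of size
      -- 1.
      y†∉ : ∀ f → 𝒦 f → ¬ (f ≈ y †)
      y†∉ f Kf e = exp-int Kf λ { (z , Kz , z≉0 , ez) →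
        let x≉0 = *-≉0 y≉0 (⁻¹-≉0 z≉0) in
        ≁1 O Kz z≉0 (const~1 x≉0 (trans (∂≈†* x≉0) (trans (*-congʳ (trans (†-/ y≉0 z≉0) (trans (+-congˡ (-‿cong (trans ez e))) (-‿inverseʳ _)))) (zeroˡ _)))) }

    chain : ∀ n {y} → Outer y → ¬ ¬ (∃ λ (ys : ℕ → Carrier) → ∃ λ (bs : ℕ → Carrier) → ys 0 ≈ y × (∀ i → i ℕ.< n → Link (ys i) (ys (suc i)) (bs i)))
    chain zero {y} O k = k ((λ _ → y) , (λ _ → y) , refl , λ _ ())
    chain (suc n) {y} O k = next O λ { (y' , b , O' , L) → chain n O' λ { (ys , bs , e , links) →
      k ((λ { zero → y ; (suc i) → ys i }) , (λ { zero → b ; (suc i) → bs i }) , refl ,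
         λ { zero _ → record { outer = O ; Kb = Link.Kb L ; dlog = trans (Link.dlog L) (+-congʳ (sym e))
                             ; least = λ z Kz z≉0 → ⊴-trans (⊴-reflexive e) (Link.least L z Kz z≉0) ; large = ◁-resp refl (sym e) (Link.large L) }
           ; (suc i) (s≤s lt) → links i lt }) } }

  horner : List Carrier → Carrier → Carrier
  horner [] y = 0#
  horner (q ∷ qs) y = q + y * horner qs y

  horner-tabulate : ∀ n (q : Fin n → Carrier) x → horner (tabulate q) x ≈ sumFin n (λ i → pow x (toℕ i) * q i)
  horner-tabulate zero q x = refl
  horner-tabulate (suc n) q x = +-cong (sym (*-identityˡ _)) (trans (*-congˡ (horner-tabulate n (q ∘ fsuc) x))
    (trans (sym (sumFin-*ˡ n x (λ i → pow x (toℕ i) * q (fsuc i)))) (sumFin-cong n (λ i → sym (*-assoc x (pow x (toℕ i)) (q (fsuc i)))))))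

  -- `evalAux` peels off the lowest derivative, whereas the induction along the chain has to peel
  -- off the highest.
  evalAux-snoc : ∀ {d} k (cf : Vec (Fin (suc d)) (suc k) → Carrier) (xs : Fin (suc k) → Carrier) →
    evalAux (suc k) cf xs ≈ sumFin (suc d) (λ i → pow (xs (fromℕ k)) (toℕ i) * evalAux k (λ es → cf (es ∷ʳ i)) (xs ∘ inject₁))
  evalAux-snoc zero cf xs = refl
  evalAux-snoc {d} (suc k) cf xs = begin
    sumFin (suc d) (λ e → a e * evalAux (suc k) (λ es → cf (e ∷ es)) (xs ∘ fsuc))
      ≈⟨ sumFin-cong (suc d) {λ e → a e * evalAux (suc k) (λ es → cf (e ∷ es)) (xs ∘ fsuc)} {λ e → sumFin (suc d) (λ i → a e * (b i * G e i))}
           (λ e → trans (*-congˡ (evalAux-snoc k (λ es → cf (e ∷ es)) (xs ∘ fsuc))) (sym (sumFin-*ˡ (suc d) (a e) (λ i → b i * G e i)))) ⟩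
    sumFin (suc d) (λ e → sumFin (suc d) (λ i → a e * (b i * G e i))) ≈⟨ sumFin-swap (suc d) (suc d) (λ e i → a e * (b i * G e i)) ⟩
    sumFin (suc d) (λ i → sumFin (suc d) (λ e → a e * (b i * G e i)))
      ≈⟨ sumFin-cong (suc d) {λ i → sumFin (suc d) (λ e → a e * (b i * G e i))} {λ i → b i * sumFin (suc d) (λ e → a e * G e i)}
           (λ i → trans (sumFin-cong (suc d) {λ e → a e * (b i * G e i)} {λ e → b i * (a e * G e i)} (λ e → solve 3 (λ a b g → a :* (b :* g) := b :* (a :* g)) refl (a e) (b i) (G e i)))
                    (sumFin-*ˡ (suc d) (b i) (λ e → a e * G e i))) ⟩
    sumFin (suc d) (λ i → b i * sumFin (suc d) (λ e → a e * G e i)) ∎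
    where
    a : Fin (suc d) → Carrier
    a e = pow (xs fzero) (toℕ e)
    b : Fin (suc d) → Carrier
    b i = pow (xs (fsuc (fromℕ k))) (toℕ i)
    G : Fin (suc d) → Fin (suc d) → Carrier
    G e i = evalAux k (λ es → cf (e ∷ (es ∷ʳ i))) (λ t → xs (fsuc (inject₁ t)))

  unsnoc : ∀ {a} {A : Set a} {k} (v : Vec A (suc k)) → ∃ λ es → ∃ λ i → v ≡ es ∷ʳ i
  unsnoc (x ∷ []) = [] , x , ≡.refl
  unsnoc (x ∷ y ∷ v) with unsnoc (y ∷ v)
  ... | es , i , e = x ∷ es , i , ≡.cong (x ∷_) e

  data LastNZ : List Carrier → Set (c ⊔ ℓ) where
    end : ∀ {q} → ¬ (q ≈ 0#) → LastNZ (q ∷ [])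
    more : ∀ {q qs} → LastNZ qs → LastNZ (q ∷ qs)

  horner-0 : ∀ {qs y} → All (_≈ 0#) qs → horner qs y ≈ 0#
  horner-0 [] = refl
  horner-0 (z ∷ zs) = trans (+-cong z (trans (*-congˡ (horner-0 zs)) (zeroʳ _))) (+-identityˡ _)

  LastNZ⇒¬All0 : ∀ {qs} → LastNZ qs → ¬ All (_≈ 0#) qs
  LastNZ⇒¬All0 (end n) (z ∷ _) = n z
  LastNZ⇒¬All0 (more l) (_ ∷ zs) = LastNZ⇒¬All0 l zs

  -- Coefficients of `p + (m * Y + n) * Q` in powers of `Y`, where `qs` are those of `Q`.
  comb : Carrier → Carrier → Carrier → List Carrier → List Carrier
  comb m n p [] = p ∷ []
  comb m n p (q ∷ qs) = (p + n * q) ∷ comb m n (m * q) qs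

  comb-horner : ∀ m n p qs y → horner (comb m n p qs) y ≈ p + (m * y + n) * horner qs y
  comb-horner m n p [] y = +-congˡ (trans (zeroʳ y) (sym (zeroʳ _)))
  comb-horner m n p (q ∷ qs) y = trans (+-congˡ (*-congˡ (comb-horner m n (m * q) qs y)))
    (solve 6 (λ m n p q y h → (p :+ n :* q) :+ y :* (m :* q :+ (m :* y :+ n) :* h) := p :+ (m :* y :+ n) :* (q :+ y :* h)) refl m n p q y _)

  comb-last : ∀ {m n p qs} → ¬ (m ≈ 0#) → LastNZ qs → LastNZ (comb m n p qs)
  comb-last m≉0 (end q) = more (end (*-≉0 m≉0 q))
  comb-last m≉0 (more l) = more (comb-last m≉0 l)

  module Indep (N : ℕ) (ys bs : ℕ → Carrier) (links : ∀ i → i ℕ.< N → Link (ys i) (ys (suc i)) (bs i)) where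

    mon : ℕ → List ℕ → Carrier
    mon o [] = 1#
    mon o (e ∷ a) = pow (ys o) e * mon (suc o) a

    y≉0 : ∀ i → i ℕ.< N → ¬ (ys i ≈ 0#)
    y≉0 i lt = proj₁ (Link.outer (links i lt))

    -- `least` with `z = 1#` bounds a term by the logarithmic derivative of its predecessor, which
    -- an infinite predecessor dominates.
    y-dec : ∀ i → suc i ℕ.< N → ys (suc (suc i)) ⊴ ys (suc i)
    y-dec i lt = ⊴-trans (Link.least (links (suc i) lt) 1# 𝒦-1 1≉0)
      (⊴-trans (⊴-reflexive (†-cong (trans (*-congˡ inv-1) (*-identityʳ _)))) (◁⇒⊴ (†◁ (Link.large (links i (ℕP.<-trans ℕP.≤-refl lt))))))

    mon-≥1 : ∀ o a → o ℕ.+ length a ℕ.≤ N → 1# ⊴ mon (suc o) a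
    mon-≥1 o [] le = ⊴-refl
    mon-≥1 o (e ∷ a) le = ⊴-resp (*-identityˡ 1#) refl (*-mono-⊴ (1⊴pow e (◁⇒⊴ (Link.large (links o (ℕP.<-≤-trans (ℕP.m<m+n o (s≤s z≤n)) le))))) (mon-≥1 (suc o) a (ℕP.≤-trans (ℕP.≤-reflexive (≡.sym (ℕP.+-suc o _))) le)))

    mon-≤ : ∀ o a → suc o ℕ.+ length a ℕ.≤ N → mon (suc o) a ⊴ pow (ys (suc o)) (sum a)
    mon-≤ o [] le = ⊴-refl
    mon-≤ o (e ∷ a) le = ⊴-trans (*-monoˡ-⊴ _ (⊴-trans (mon-≤ (suc o) a le') (pow-mono (sum a) (y-dec o lt)))) (⊴-reflexive (sym (pow-+ (ys (suc o)) e (sum a))))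
      where
      le' : suc (suc o) ℕ.+ length a ℕ.≤ N
      le' = ℕP.≤-trans (ℕP.≤-reflexive (≡.cong suc (≡.sym (ℕP.+-suc o _)))) le
      lt : suc o ℕ.< N
      lt = ℕP.≤-trans (s≤s (s≤s (ℕP.m≤m+n o (length a)))) le'

    mon-≉0 : ∀ o a → o ℕ.+ length a ℕ.≤ N → ¬ (mon o a ≈ 0#)
    mon-≉0 o [] le = 1≉0
    mon-≉0 o (e ∷ a) le = *-≉0 (pow-≉0 e (y≉0 o (ℕP.<-≤-trans (ℕP.m<m+n o (s≤s z≤n)) le))) (mon-≉0 (suc o) a (ℕP.≤-trans (ℕP.≤-reflexive (≡.sym (ℕP.+-suc o _))) le))

    -- If a nontrivial power of y_o were a monomial in the later, much flatter y's up to 𝒦, then ψ(γ) = o(γ) would fail.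
    gap : ∀ o k a b d → suc o ℕ.+ length a ℕ.≤ N → suc o ℕ.+ length b ℕ.≤ N → 𝒦 d → ¬ (d ≈ 0#) →
      ¬ (pow (ys o) (suc k) * mon (suc o) a ~ d * mon (suc o) b)
    gap o k a b d la lb Kd d≉0 e = root k Kd d≉0 λ { (z , Kz , z≉0 , ez) →
      let x = ys o * z ⁻¹
          x≉0 = *-≉0 yo≉0 (⁻¹-≉0 z≉0)
          x≁1 = ≁1 (Link.outer lk) Kz z≉0
          w⊴ = Link.least lk z Kz z≉0
          rel : pow x (suc k) * A ~ B
          rel = *-cancelʳ-~ (pow z (suc k)) (pow-≉0 (suc k) z≉0) (~-trans (~-reflexive (begin
            (pow x (suc k) * A) * pow z (suc k) ≈⟨ solve 3 (λ a b d → (a :* b) :* d := (a :* d) :* b) refl _ _ _ ⟩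
            (pow x (suc k) * pow z (suc k)) * A ≈⟨ *-congʳ (trans (sym (pow-* x z (suc k))) (pow-cong (suc k) (cancel-inv' _ z z≉0))) ⟩
            pow (ys o) (suc k) * A ∎)) (~-trans e (~-trans (*-mono-~ (~-sym ez) ~-refl) (~-reflexive (*-comm _ _)))))
      -- `ys (suc o)` is at most `x †` and bounds all later terms, so `A` and `B` are at most powers
      -- of `x †`; `x†ⁿ◁` is contradicted at `x` or at its inverse.
      in cmp x 1# λ
        { (inj₁ x◁1) → ⊴◁⊥ (⊴-trans (⊴-trans 1⊴B (proj₂ rel)) (*-mono-⊴ (pow-suc⊴ k (◁⇒⊴ x◁1)) (⊴-trans A⊴ (pow-mono (sum a) w⊴)))) (x†ⁿ◁ (sum a) x≉0 x◁1)
        ; (inj₂ 1⊴x) → cmp 1# x λ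
            { (inj₂ ge) → x≁1 (ge , 1⊴x)
            ; (inj₁ 1◁x) → ⊴◁⊥ (⊴-trans (⊴-reflexive (sym (inverseˡ' x x≉0))) (*-monoˡ-⊴ (x ⁻¹) (⊴-trans (⊴pow-suc k 1⊴x)
                (⊴-trans (⊴-resp (*-identityʳ _) refl (*-monoˡ-⊴ (pow x (suc k)) 1⊴A)) (⊴-trans (proj₁ rel) (⊴-trans B⊴ (pow-mono (sum b)
                  (⊴-trans w⊴ (⊴-trans (proj₂ neg-~) (⊴-reflexive (sym (†-inv x≉0)))))))))))) (x†ⁿ◁ (sum b) (⁻¹-≉0 x≉0) (◁-resp refl inv-1 (inv-◁ 1≉0 x≉0 1◁x))) } } }
      where
      A = mon (suc o) a
      B = mon (suc o) b
      lt : o ℕ.< N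
      lt = ℕP.≤-trans (s≤s (ℕP.m≤m+n o (length a))) la
      lk = links o lt
      yo≉0 = y≉0 o lt
      1⊴A = mon-≥1 o a (ℕP.≤-trans (ℕP.n≤1+n _) la)
      1⊴B = mon-≥1 o b (ℕP.≤-trans (ℕP.n≤1+n _) lb)
      A⊴ = mon-≤ o a la
      B⊴ = mon-≤ o b lb

    independent : ∀ o a b d → length a ≡ length b → o ℕ.+ length a ℕ.≤ N → 𝒦 d → ¬ (d ≈ 0#) → mon o a ~ d * mon o b → a ≡ b
    independent o [] [] d _ le Kd d≉0 e = ≡.refl
    independent o (e₁ ∷ a) (e₂ ∷ b) d l le Kd d≉0 e with ℕP.<-cmp e₁ e₂
    ... | tri≈ _ ≡.refl _ = ≡.cong (e₁ ∷_) (independent (suc o) a b d (ℕP.suc-injective l) le' Kd d≉0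
        (*-cancelʳ-~ P (pow-≉0 e₁ yo≉0) (~-trans (~-reflexive (*-comm _ _)) (~-trans e (~-reflexive (solve 3 (λ d p b → d :* (p :* b) := (d :* b) :* p) refl d P _))))))
      where
      P = pow (ys o) e₁
      le' = ℕP.≤-trans (ℕP.≤-reflexive (≡.sym (ℕP.+-suc o _))) le
      yo≉0 = y≉0 o (ℕP.≤-trans (s≤s (ℕP.m≤m+n o (length a))) le')
    ... | tri> _ _ gt = ⊥-elim (gap o (e₁ ℕ.∸ suc e₂) a b d le' (≡.subst (λ t → suc o ℕ.+ t ℕ.≤ N) (ℕP.suc-injective l) le') Kd d≉0
        (*-cancelʳ-~ P (pow-≉0 e₂ yo≉0) (~-trans (~-reflexive (trans (solve 3 (λ x a p → (x :* a) :* p := (x :* p) :* a) refl _ _ P)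
            (*-congʳ (trans (sym (pow-+ (ys o) (suc (e₁ ℕ.∸ suc e₂)) e₂)) (reflexive (≡.cong (pow (ys o)) (≡.trans (≡.sym (ℕP.+-suc (e₁ ℕ.∸ suc e₂) e₂)) (ℕP.m∸n+n≡m gt))))))))
          (~-trans e (~-reflexive (solve 3 (λ d p b → d :* (p :* b) := (d :* b) :* p) refl d P _))))))
      where
      P = pow (ys o) e₂
      le' = ℕP.≤-trans (ℕP.≤-reflexive (≡.sym (ℕP.+-suc o _))) le
      yo≉0 = y≉0 o (ℕP.≤-trans (s≤s (ℕP.m≤m+n o (length a))) le')
    ... | tri< lt _ _ = ⊥-elim (gap o (e₂ ℕ.∸ suc e₁) b a (d ⁻¹) (≡.subst (λ t → suc o ℕ.+ t ℕ.≤ N) (ℕP.suc-injective l) le') le' (𝒦-inv d≉0 Kd) (⁻¹-≉0 d≉0)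
        (*-cancelʳ-~ P (pow-≉0 e₁ yo≉0) (~-trans (~-reflexive (trans (solve 3 (λ x a p → (x :* a) :* p := (x :* p) :* a) refl _ _ P)
            (*-congʳ (trans (sym (pow-+ (ys o) (suc (e₂ ℕ.∸ suc e₁)) e₁)) (reflexive (≡.cong (pow (ys o)) (≡.trans (≡.sym (ℕP.+-suc (e₂ ℕ.∸ suc e₁) e₁)) (ℕP.m∸n+n≡m lt))))))))
          (~-trans (~-trans (~-reflexive (sym (trans (sym (*-assoc _ _ _)) (trans (*-congʳ (inverseˡ' d d≉0)) (*-identityˡ _))))) (*-mono-~ (~-refl {d ⁻¹}) (~-sym e)))
            (~-reflexive (solve 3 (λ d p b → d :* (p :* b) := (d :* b) :* p) refl (d ⁻¹) P _))))))
      where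
      P = pow (ys o) e₁
      le' = ℕP.≤-trans (ℕP.≤-reflexive (≡.sym (ℕP.+-suc o _))) le
      yo≉0 = y≉0 o (ℕP.≤-trans (s≤s (ℕP.m≤m+n o (length a))) le')

    mon-snoc : ∀ o a e → mon o (a ++ e ∷ []) ≈ mon o a * pow (ys (o ℕ.+ length a)) e
    mon-snoc o [] e = trans (*-identityʳ _) (trans (reflexive (≡.cong (λ t → pow (ys t) e) (≡.sym (ℕP.+-identityʳ o)))) (sym (*-identityˡ _)))
    mon-snoc o (e' ∷ a) e = trans (*-congˡ (mon-snoc (suc o) a e)) (trans (sym (*-assoc _ _ _)) (*-congˡ (reflexive (≡.cong (λ t → pow (ys t) e) (≡.sym (ℕP.+-suc o (length a)))))))

    -- The rings 𝒦[y₀, …, y_{j-1}]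

    R : ℕ → Carrier → Set (c ⊔ ℓ ⊔ p)
    R zero x = Lift (c ⊔ ℓ) (𝒦 x)
    R (suc j) x = ∃ λ qs → All (R j) qs × x ≈ horner qs (ys j)

    R-≈ : ∀ j {x x'} → x ≈ x' → R j x → R j x'
    R-≈ zero e (lift a) = lift (𝒦-≈ e a)
    R-≈ (suc j) e (qs , a , f) = qs , a , trans (sym e) f

    R-0 : ∀ j → R j 0#
    R-0 zero = lift 𝒦-0
    R-0 (suc j) = [] , [] , refl

    R-up : ∀ j {x} → R j x → R (suc j) x
    R-up j {x} a = x ∷ [] , a ∷ [] , sym (trans (+-congˡ (zeroʳ _)) (+-identityʳ x))

    R-𝒦 : ∀ j {x} → 𝒦 x → R j x
    R-𝒦 zero a = lift a
    R-𝒦 (suc j) a = R-up j (R-𝒦 j a)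

    R-y : ∀ j {x} → R (suc j) x → R (suc j) (ys j * x)
    R-y j {x} (qs , a , e) = 0# ∷ qs , R-0 j ∷ a , sym (trans (+-identityˡ _) (*-congˡ (sym e)))

    R-+ : ∀ j {x y} → R j x → R j y → R j (x + y)
    R-+ zero (lift a) (lift b) = lift (𝒦-+ a b)
    R-+ (suc j) {x} {y} (qs , a , e) (ps , b , f) = R-≈ (suc j) (+-cong (sym e) (sym f)) (go qs ps a b)
      where
      go : ∀ qs ps → All (R j) qs → All (R j) ps → R (suc j) (horner qs (ys j) + horner ps (ys j))
      go [] ps a b = ps , b , +-identityˡ _
      go (q ∷ qs) [] a b = q ∷ qs , a , +-identityʳ _
      go (q ∷ qs) (p ∷ ps) (a ∷ as) (b ∷ bs) with go qs ps as bs
      ... | rs , d , h = (q + p) ∷ rs , R-+ j a b ∷ d , trans (solve 5 (λ q y h p k → (q :+ y :* h) :+ (p :+ y :* k) := (q :+ p) :+ y :* (h :+ k)) refl q (ys j) _ p _) (+-congˡ (*-congˡ h))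

    R-* : ∀ j {x y} → R j x → R j y → R j (x * y)
    R-* zero (lift a) (lift b) = lift (𝒦-* a b)
    R-* (suc j) {x} {y} (qs , a , e) Ry = R-≈ (suc j) (*-congʳ (sym e)) (go qs a)
      where
      scl : ∀ q → R j q → ∀ ps → All (R j) ps → R (suc j) (q * horner ps (ys j))
      scl q a [] [] = [] , [] , zeroʳ q
      scl q a (p ∷ ps) (b ∷ bs) with scl q a ps bs
      ... | rs , d , h = (q * p) ∷ rs , R-* j a b ∷ d , trans (solve 4 (λ q p y h → q :* (p :+ y :* h) := q :* p :+ y :* (q :* h)) refl q p (ys j) _) (+-congˡ (*-congˡ h))
      go : ∀ qs → All (R j) qs → R (suc j) (horner qs (ys j) * y)
      go [] [] = R-≈ (suc j) (sym (zeroˡ y)) (R-0 (suc j))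
      go (q ∷ qs) (a ∷ as) = R-≈ (suc j) (solve 4 (λ q z h y → q :* y :+ z :* (h :* y) := (q :+ z :* h) :* y) refl q (ys j) _ y)
        (R-+ (suc j) (R-≈ (suc j) (*-congˡ (sym (proj₂ (proj₂ Ry)))) (scl q a (proj₁ Ry) (proj₁ (proj₂ Ry)))) (R-y j (go qs as)))

    ∂y : ∀ j → j ℕ.< N → ∂ (ys j) ≈ (ys (suc j) + bs j) * ys j
    ∂y j lt = trans (∂≈†* (y≉0 j lt)) (*-congʳ (Link.dlog (links j lt)))

    R-gen : ∀ j → R (suc j) (ys j)
    R-gen j = R-≈ (suc j) (*-identityʳ _) (R-y j (R-𝒦 (suc j) 𝒦-1))

    R-∂ : ∀ j {x} → j ℕ.≤ N → R j x → R (suc j) (∂ x)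
    R-∂ zero le (lift a) = R-𝒦 1 (𝒦-∂ a)
    R-∂ (suc j) le (qs , a , e) = R-≈ (suc (suc j)) (∂-cong (sym e)) (go qs a)
      where
      ∂yR : R (suc (suc j)) (∂ (ys j))
      ∂yR = R-≈ (suc (suc j)) (sym (∂y j le)) (R-* (suc (suc j)) (R-+ (suc (suc j)) (R-gen (suc j)) (R-𝒦 (suc (suc j)) (Link.Kb (links j le)))) (R-up (suc j) (R-gen j)))
      go : ∀ qs → All (R j) qs → R (suc (suc j)) (∂ (horner qs (ys j)))
      go [] [] = R-≈ (suc (suc j)) (sym ∂0) (R-0 (suc (suc j)))
      go (q ∷ qs) (a ∷ as) = R-≈ (suc (suc j)) (sym (trans (∂-+ _ _) (+-congˡ (∂-* _ _))))
        (R-+ (suc (suc j)) (R-up (suc j) (R-∂ j (ℕP.<⇒≤ le) a)) (R-+ (suc (suc j))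
          (R-* (suc (suc j)) ∂yR (R-up (suc j) (qs , as , refl)))
          (R-* (suc (suc j)) (R-up (suc j) (R-gen j)) (go qs as))))

    Val : ℕ → Carrier → Set (c ⊔ ℓ ⊔ gℓ ⊔ p)
    Val j x = ∃ λ d → ∃ λ a → 𝒦 d × ¬ (d ≈ 0#) × length a ≡ j × x ~ d * mon 0 a

    Val-≉0 : ∀ {j x} → j ℕ.≤ N → Val j x → ¬ (x ≈ 0#)
    Val-≉0 le (d , a , Kd , d≉0 , l , e) = ⊴-≉0 (proj₂ e) (*-≉0 d≉0 (mon-≉0 0 a (≡.subst (ℕ._≤ N) (≡.sym l) le)))

    Val-≈ : ∀ {j x x'} → x ~ x' → Val j x → Val j x'
    Val-≈ f (d , a , Kd , d≉0 , l , e) = d , a , Kd , d≉0 , l , ~-trans (~-sym f) e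

    -- Distinct monomials have values that are distinct modulo those of 𝒦, so a nonzero polynomial
    -- has the size of its largest term.
    R-Val : ∀ j {x} → j ℕ.≤ N → R j x → ¬ (x ≈ 0#) → ¬ ¬ Val j x
    horner-Val : ∀ j → suc j ℕ.≤ N → ∀ qs → All (R j) qs → ¬ ¬ (All (_≈ 0#) qs ⊎ Val (suc j) (horner qs (ys j)))

    R-Val zero {x} le (lift a) n k = k (x , [] , a , n , ≡.refl , ~-reflexive (sym (*-identityʳ x)))
    R-Val (suc j) {x} le (qs , a , e) n k = horner-Val j le qs a λ
      { (inj₁ z) → n (trans e (horner-0 z)) ; (inj₂ v) → k (Val-≈ (~-reflexive (sym e)) v) }

    horner-Val j le [] [] k = k (inj₁ [])
    horner-Val j le (q ∷ qs) (a ∷ as) k = horner-Val j le qs as λ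
      { (inj₁ z) → tail0 z (q ≟0)
      ; (inj₂ v@(d , b , Kd , d≉0 , l , e)) → tailV d b Kd d≉0 l e (unsnocL b l) (q ≟0) }
      where
      y = ys j
      H = horner qs y
      put : Val j q → Val (suc j) q
      put (d , b , Kd , d≉0 , l , e) = d , b ++ 0 ∷ [] , Kd , d≉0 , ≡.trans (LP.length-++ b) (≡.trans (ℕP.+-comm _ 1) (≡.cong suc l)) ,
        ~-trans e (~-reflexive (*-congˡ (sym (trans (mon-snoc 0 b 0) (*-identityʳ _)))))
      tail0 : All (_≈ 0#) qs → Dec (q ≈ 0#) → ⊥
      tail0 z (yes q0) = k (inj₁ (q0 ∷ z))
      tail0 z (no qn) = R-Val j (ℕP.<⇒≤ le) a qn λ v → k (inj₂ (Val-≈ (~-reflexive (sym (trans (+-congˡ (trans (*-congˡ (horner-0 z)) (zeroʳ _))) (+-identityʳ q)))) (put v)))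
      unsnocL : ∀ (b : List ℕ) {j} → length b ≡ suc j → ∃ λ b' → ∃ λ f → b ≡ b' ++ f ∷ [] × length b' ≡ j
      unsnocL (f ∷ []) ≡.refl = [] , f , ≡.refl , ≡.refl
      unsnocL (f ∷ f' ∷ b) ≡.refl with unsnocL (f' ∷ b) ≡.refl
      ... | b' , t , e , l = f ∷ b' , t , ≡.cong (f ∷_) e , ≡.cong suc l
      tailV : ∀ d b → 𝒦 d → ¬ (d ≈ 0#) → length b ≡ suc j → H ~ d * mon 0 b → (∃ λ b' → ∃ λ f → b ≡ b' ++ f ∷ [] × length b' ≡ j) → Dec (q ≈ 0#) → ⊥
      tailV d b Kd d≉0 l e (b' , f , ≡.refl , l') dq = go dq
        where
        b⁺ = b' ++ suc f ∷ []
        l⁺ : length b⁺ ≡ suc j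
        l⁺ = ≡.trans (LP.length-++ b') (≡.trans (ℕP.+-comm _ 1) (≡.cong suc l'))
        yH : y * H ~ d * mon 0 b⁺
        yH = ~-trans (*-mono-~ (~-refl {y}) e) (~-reflexive (begin
          y * (d * mon 0 b) ≈⟨ *-congˡ (*-congˡ (mon-snoc 0 b' f)) ⟩
          y * (d * (mon 0 b' * pow (ys (length b')) f)) ≈⟨ *-cong (reflexive (≡.cong ys (≡.sym l'))) refl ⟩
          ys (length b') * (d * (mon 0 b' * pow (ys (length b')) f)) ≈⟨ solve 4 (λ y d m p → y :* (d :* (m :* p)) := d :* (m :* (y :* p))) refl _ _ _ _ ⟩
          d * (mon 0 b' * pow (ys (length b')) (suc f)) ≈⟨ *-congˡ (sym (mon-snoc 0 b' (suc f))) ⟩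
          d * mon 0 b⁺ ∎))
        Vy : Val (suc j) (y * H)
        Vy = d , b⁺ , Kd , d≉0 , l⁺ , yH
        go : Dec (q ≈ 0#) → ⊥
        go (yes q0) = k (inj₂ (Val-≈ (~-reflexive (sym (trans (+-congʳ q0) (+-identityˡ _)))) Vy))
        go (no qn) = R-Val j (ℕP.<⇒≤ le) a qn λ { v@(d₂ , b₂ , Kd₂ , d₂≉0 , l₂ , e₂) →
          cmp q (y * H) λ
            { (inj₁ lt) → k (inj₂ (Val-≈ (~-sym (+-absorb lt)) Vy))
            ; (inj₂ ge) → cmp (y * H) q λ
                { (inj₁ lt) → k (inj₂ (Val-≈ (~-sym (~-trans (~-reflexive (+-comm _ _)) (+-absorb lt))) (put v)))
                ; (inj₂ ge') → clash d₂ b₂ Kd₂ d₂≉0 l₂ e₂ (ge' , ge) } } }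
          where
          -- The exponent of `ys j` is 0 in `q` and `suc f` in `y * H`, so equal sizes would
          -- contradict `independent`.
          clash : ∀ d₂ b₂ → 𝒦 d₂ → ¬ (d₂ ≈ 0#) → length b₂ ≡ j → q ~ d₂ * mon 0 b₂ → q ~ y * H → ⊥
          clash d₂ b₂ Kd₂ d₂≉0 l₂ e₂ eq = snoc-≢ (independent 0 (b₂ ++ 0 ∷ []) b⁺ (d₂ ⁻¹ * d) (≡.trans l₂' (≡.sym l⁺)) (≡.subst (ℕ._≤ N) (≡.sym l₂') le)
              (𝒦-* (𝒦-inv d₂≉0 Kd₂) Kd) (*-≉0 (⁻¹-≉0 d₂≉0) d≉0)
              (~-trans (~-reflexive (begin
                mon 0 (b₂ ++ 0 ∷ []) ≈⟨ trans (mon-snoc 0 b₂ 0) (*-identityʳ _) ⟩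
                mon 0 b₂ ≈⟨ sym (trans (sym (*-assoc _ _ _)) (trans (*-congʳ (inverseˡ' d₂ d₂≉0)) (*-identityˡ _))) ⟩
                d₂ ⁻¹ * (d₂ * mon 0 b₂) ∎)) (~-trans (*-mono-~ (~-refl {d₂ ⁻¹}) (~-trans (~-sym e₂) (~-trans eq yH))) (~-reflexive (sym (*-assoc _ _ _))))))
            where
            l₂' : length (b₂ ++ 0 ∷ []) ≡ suc j
            l₂' = ≡.trans (LP.length-++ b₂) (≡.trans (ℕP.+-comm _ 1) (≡.cong suc l₂))
            snoc-≢ : b₂ ++ 0 ∷ [] ≡ b' ++ suc f ∷ [] → ⊥
            snoc-≢ e with proj₂ (LP.∷ʳ-injective b₂ b' e)
            ... | ()

    -- Each derivative of `ys 0` brings in one new term of the chain, linearly and with the product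
    -- of the earlier terms as coefficient. So passing from jets to the chain is an invertible
    -- triangular substitution.
    jet-linear : ∀ j → j ℕ.≤ N → ∃ λ m → ∃ λ n → R j m × R j n × ¬ (m ≈ 0#) × ∂^ j (ys 0) ≈ m * ys j + n
    jet-linear zero le = 1# , 0# , R-𝒦 0 𝒦-1 , R-0 0 , 1≉0 , sym (trans (+-identityʳ _) (*-identityˡ _))
    jet-linear (suc j) le with jet-linear j (ℕP.<⇒≤ le)
    ... | m , n , Rm , Rn , m≉0 , e = m * ys j , (∂ m * ys j + m * (bs j * ys j)) + ∂ n ,
        R-* (suc j) (R-up j Rm) (R-gen j) ,
        R-+ (suc j) (R-+ (suc j) (R-* (suc j) (R-∂ j (ℕP.<⇒≤ le) Rm) (R-gen j)) (R-* (suc j) (R-up j Rm) (R-* (suc j) (R-𝒦 (suc j) (Link.Kb (links j le))) (R-gen j)))) (R-∂ j (ℕP.<⇒≤ le) Rn) ,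
        *-≉0 m≉0 (y≉0 j le) ,
        (begin
          ∂ (∂^ j (ys 0)) ≈⟨ ∂-cong e ⟩
          ∂ (m * ys j + n) ≈⟨ trans (∂-+ _ _) (+-congʳ (trans (∂-* _ _) (+-congˡ (*-congˡ (∂y j le))))) ⟩
          (∂ m * ys j + m * ((ys (suc j) + bs j) * ys j)) + ∂ n ≈⟨ solve 6 (λ m' y m z b n' → (m' :* y :+ m :* ((z :+ b) :* y)) :+ n' := (m :* y) :* z :+ ((m' :* y :+ m :* (b :* y)) :+ n')) refl (∂ m) (ys j) m (ys (suc j)) (bs j) (∂ n) ⟩
          (m * ys j) * ys (suc j) + ((∂ m * ys j + m * (bs j * ys j)) + ∂ n) ∎)

    R-jet : ∀ j → j ℕ.< N → R (suc j) (∂^ j (ys 0))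
    R-jet j lt with jet-linear j (ℕP.<⇒≤ lt)
    ... | m , n , Rm , Rn , _ , e = R-≈ (suc j) (sym e) (R-+ (suc j) (R-* (suc j) (R-up j Rm) (R-gen j)) (R-up j Rn))

    comb-R : ∀ j {m n p qs} → R j m → R j n → R j p → All (R j) qs → All (R j) (comb m n p qs)
    comb-R j Rm Rn Rp [] = Rp ∷ []
    comb-R j Rm Rn Rp (a ∷ as) = R-+ j Rp (R-* j Rn a) ∷ comb-R j Rm Rn (R-* j Rm a) as

    recentre-horner : ∀ j {m n} → R j m → R j n → ¬ (m ≈ 0#) → ∀ ps → All (R j) ps →
      All (_≈ 0#) ps ⊎ (∃ λ qs → All (R j) qs × LastNZ qs × horner ps (m * ys j + n) ≈ horner qs (ys j))
    recentre-horner j Rm Rn m≉0 [] [] = inj₁ []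
    recentre-horner j {m} {n} Rm Rn m≉0 (p ∷ ps) (a ∷ as) with recentre-horner j Rm Rn m≉0 ps as
    ... | inj₂ (qs , b , l , e) = inj₂ (comb m n p qs , comb-R j Rm Rn a b , comb-last m≉0 l , trans (+-congˡ (*-congˡ e)) (sym (comb-horner m n p qs (ys j))))
    ... | inj₁ z with p ≟0
    ...   | yes p0 = inj₁ (p0 ∷ z)
    ...   | no pn = inj₂ (p ∷ [] , a ∷ [] , end pn , +-congˡ (trans (*-congˡ (horner-0 z)) (trans (zeroʳ _) (sym (zeroʳ _)))))

    jets : ∀ k → Fin k → Carrier
    jets k i = ∂^ (toℕ i) (ys 0)

    snoc-eval : ∀ {d} k (cf : Vec (Fin (suc d)) (suc k) → Carrier) →
      evalAux (suc k) cf (jets (suc k)) ≈ horner (tabulate (λ i → evalAux k (λ es → cf (es ∷ʳ i)) (jets k))) (∂^ k (ys 0))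
    snoc-eval {d} k cf = trans (evalAux-snoc k cf (jets (suc k))) (trans
      (sumFin-cong (suc d) {λ i → pow (∂^ (toℕ (fromℕ k)) (ys 0)) (toℕ i) * evalAux k (λ es → cf (es ∷ʳ i)) (jets (suc k) ∘ inject₁)} {λ i → pow (∂^ k (ys 0)) (toℕ i) * q i}
        (λ i → *-cong (pow-cong (toℕ i) (reflexive (≡.cong (λ t → ∂^ t (ys 0)) (FP.toℕ-fromℕ k))))
          (evalAux-cong k (λ _ → refl) (λ t → reflexive (≡.cong (λ u → ∂^ u (ys 0)) (FP.toℕ-inject₁ t))))))
      (sym (horner-tabulate (suc d) q _)))
      where
      q : Fin (suc d) → Carrier
      q i = evalAux k (λ es → cf (es ∷ʳ i)) (jets k)

    eval-R : ∀ {d} k → k ℕ.≤ N → (cf : Vec (Fin (suc d)) k → Carrier) → (∀ e → 𝒦 (cf e)) → R k (evalAux k cf (jets k))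
    eval-R zero le cf Kc = lift (Kc [])
    eval-R (suc k) le cf Kc = R-≈ (suc k) (sym (snoc-eval k cf)) (go _ (AllP.tabulate⁺ (λ i → eval-R k (ℕP.<⇒≤ le) (λ es → cf (es ∷ʳ i)) (λ es → Kc (es ∷ʳ i)))))
      where
      go : ∀ qs → All (R k) qs → R (suc k) (horner qs (∂^ k (ys 0)))
      go [] [] = R-0 (suc k)
      go (q ∷ qs) (a ∷ as) = R-+ (suc k) (R-up k a) (R-* (suc k) (R-jet k le) (go qs as))

    -- If all coefficients with respect to the highest derivative vanished at `ys 0`, one of them
    -- would be a nonzero polynomial of lower order vanishing there. Otherwise the substitution of
    -- `jet-linear` leaves a nonzero polynomial in `ys k` over `R k`, and `horner-Val` gives it a
    -- value.
    eval-nz : ∀ {d} k → k ℕ.≤ N → (cf : Vec (Fin (suc d)) k → Carrier) → (∀ e → 𝒦 (cf e)) → ∀ e → ¬ (cf e ≈ 0#) → ¬ (evalAux k cf (jets k) ≈ 0#)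
    eval-nz zero le cf Kc [] n = n
    eval-nz {d} (suc k) le cf Kc e n ev0 with unsnoc e | jet-linear k (ℕP.<⇒≤ le)
    ... | es , i , ≡.refl | m , n' , Rm , Rn , m≉0 , ej
        with recentre-horner k Rm Rn m≉0 (tabulate q) (AllP.tabulate⁺ (λ i → eval-R k (ℕP.<⇒≤ le) (λ es → cf (es ∷ʳ i)) (λ es → Kc (es ∷ʳ i))))
      where
      q : Fin (suc d) → Carrier
      q i = evalAux k (λ es → cf (es ∷ʳ i)) (jets k)
    ... | inj₁ z = eval-nz k (ℕP.<⇒≤ le) (λ es → cf (es ∷ʳ i)) (λ es → Kc (es ∷ʳ i)) es n (AllP.tabulate⁻ {f = λ i → evalAux k (λ es → cf (es ∷ʳ i)) (jets k)} z i)
    ... | inj₂ (qs , b , l , eh) = horner-Val k le qs b λ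
          { (inj₁ z) → LastNZ⇒¬All0 l z
          ; (inj₂ v) → Val-≉0 le v (trans (sym eh) (trans (horner-cong (tabulate (λ i → evalAux k (λ es → cf (es ∷ʳ i)) (jets k))) (sym ej)) (trans (sym (snoc-eval k cf)) ev0))) }
      where
      horner-cong : ∀ ps {x x'} → x ≈ x' → horner ps x ≈ horner ps x'
      horner-cong [] e = refl
      horner-cong (p ∷ ps) e = +-congˡ (*-cong e (horner-cong ps e))

  no-outer : (∀ y → DAlgebraic y) → ∀ {y} → ¬ Outer y
  no-outer dalg {y} O with dalg y
  ... | r , d , P , KP , (e , nz) , ev = chain dalg (suc r) O λ { (ys , bs , e₀ , links) →
    Indep.eval-nz (suc r) ys bs links (suc r) ℕP.≤-refl P KP e nz
      (trans (evalAux-cong (suc r) {P} {P} (λ _ → refl) (λ i → ∂^-cong (toℕ i) e₀)) ev) }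

  everything-in-𝒦 : (∀ y → DAlgebraic y) → ∀ y → (∀ x → 𝒦 x → ¬ (x ≈ y)) → ⊥
  everything-in-𝒦 dalg y y∉ = best (dalg y) λ { (a , Ka , bst) → no-outer dalg (best⇒Outer y∉ Ka bst) }

-- Transfer of the hypotheses on K to its image in L.

module Embedding {c ℓ g gℓ c' ℓ' g' gℓ' : Level}
  (K : ValuedDifferentialField c ℓ g gℓ) (L : ValuedDifferentialField c' ℓ' g' gℓ') (E : Extension K L)
  (hasy : ValuedDifferentialField.HAsymptotic L) (max0 : ValuedDifferentialField.Max0 L) where
  private
    module K = ValuedField K
  open MaxZero L hasy max0
  open Extension E

  ι-0 : ι K.0# ≈ 0#
  ι-0 = trans (sym (x+y-y (ι K.0#) (ι K.0#))) (trans (+-congʳ (trans (sym (ι-+ K.0# K.0#)) (ι-cong (K.+-identityˡ K.0#)))) (-‿inverseʳ _))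

  ι-neg : ∀ x → ι (K.- x) ≈ - ι x
  ι-neg x = +-inv-unique (trans (sym (ι-+ x (K.- x))) (trans (ι-cong (K.-‿inverseʳ x)) ι-0))

  ι-≉0 : ∀ {x} → ¬ (x K.≈ K.0#) → ¬ (ι x ≈ 0#)
  ι-≉0 {x} n e = n (K.≼0⇒≈0 (Equivalence.from (ι-≼ x K.0#) (≼-reflexive (trans e (sym ι-0)))))

  ι-inv : ∀ {x} → ¬ (x K.≈ K.0#) → ι (x K.⁻¹) ≈ ι x ⁻¹
  ι-inv {x} n = inv-unique (ι-≉0 n) (trans (sym (ι-* x (x K.⁻¹))) (trans (ι-cong (K.inverseʳ x n)) ι-1))

  ι-∂^ : ∀ n x → ι (K.∂^ n x) ≈ ∂^ n (ι x)
  ι-∂^ zero x = refl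
  ι-∂^ (suc n) x = trans (ι-∂ _) (∂-cong (ι-∂^ n x))

  ι-pow : ∀ x n → ι (K.pow x n) ≈ pow (ι x) n
  ι-pow x zero = ι-1
  ι-pow x (suc n) = trans (ι-* _ _) (*-congˡ (ι-pow x n))

  ι-sum : ∀ n (f : Fin n → K.Carrier) → ι (K.sumFin n f) ≈ sumFin n (ι ∘ f)
  ι-sum zero f = ι-0
  ι-sum (suc n) f = trans (ι-+ _ _) (+-congˡ (ι-sum n (f ∘ fsuc)))

  ι-eval : ∀ {d} k (cf : Vec (Fin (suc d)) k → K.Carrier) xs → ι (K.evalAux k cf xs) ≈ evalAux k (ι ∘ cf) (ι ∘ xs)
  ι-eval zero cf xs = refl
  ι-eval {d} (suc k) cf xs = trans (ι-sum (suc d) (λ e → K.pow (xs fzero) (toℕ e) K.* K.evalAux k (λ es → cf (e ∷ es)) (xs ∘ fsuc)))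
    (sumFin-cong (suc d) {λ e → ι (K.pow (xs fzero) (toℕ e) K.* K.evalAux k (λ es → cf (e ∷ es)) (xs ∘ fsuc))} {λ e → pow (ι (xs fzero)) (toℕ e) * evalAux k (λ es → ι (cf (e ∷ es))) (ι ∘ xs ∘ fsuc)}
      (λ e → trans (ι-* _ _) (*-cong (ι-pow _ (toℕ e)) (ι-eval k (λ es → cf (e ∷ es)) (xs ∘ fsuc)))))

  In : Carrier → Set (c ⊔ ℓ')
  In x = ∃ λ k → ι k ≈ x

  ≼-up : ∀ {x y} → x K.≼ y → ι x ≼ ι y
  ≼-up = Equivalence.to (ι-≼ _ _)
  ≼-down : ∀ {x y} → ι x ≼ ι y → x K.≼ y
  ≼-down = Equivalence.from (ι-≼ _ _)

  ◁-up : ∀ {x y} → x K.≺ y → ι x ◁ ι y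
  ◁-up q = mk◁ λ le → K.un◁ (K.≺⇒◁ q) (≼-down le)
  ◁-down : ∀ {x y} → ι x ◁ ι y → x K.≺ y
  ◁-down q = K.◁⇒≺ (K.mk◁ λ le → un◁ q (≼-up le))

  ground : K.DifferentialHenselian → K.ExponentialIntegration → K.DivisibleValueGroup → SameResidueField → GroundField.Ground L hasy max0 (c ⊔ ℓ')
  ground (_ , _ , hens) expi div same = record
    { 𝒦 = In
    ; 𝒦-≈ = λ { e (k , f) → k , trans f e }
    ; 𝒦-0 = K.0# , ι-0
    ; 𝒦-1 = K.1# , ι-1
    ; 𝒦-+ = λ { (k , e) (k' , e') → k K.+ k' , trans (ι-+ k k') (+-cong e e') }
    ; 𝒦-* = λ { (k , e) (k' , e') → k K.* k' , trans (ι-* k k') (*-cong e e') }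
    ; 𝒦-neg = λ { (k , e) → K.- k , trans (ι-neg k) (-‿cong e) }
    ; 𝒦-inv = λ { n (k , e) → k K.⁻¹ , trans (ι-inv (nz n e)) (⁻¹-cong e) }
    ; 𝒦-∂ = λ { (k , e) → K.∂ k , trans (ι-∂ k) (∂-cong e) }
    ; henselian = λ r d P KP P⊴1 P₀ → λ { (e₁ , d₁ , big) k →
        let p = λ e → proj₁ (KP e)
            p≈ = λ e → proj₂ (KP e)
        -- The coefficients are finitely many, so the double negations of their bounds can be pulled
        -- out together.
        in vec-¬¬ (suc r) {λ e → p e K.≼ K.1#} (λ e q → un⊴ (⊴-resp (sym (p≈ e)) (sym ι-1) (P⊴1 e)) (λ le → q (≼-down le))) λ p≼1 →
           un⊴ (⊴-resp (sym ι-1) (sym (p≈ e₁)) (proj₂ big)) λ 1≼p →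
           let y , y≺1 , ev = hens r d p p≼1
                 (λ e z → ◁-down (◁-resp (sym (p≈ e)) (sym ι-1) (P₀ e z)))
                 (e₁ , d₁ , K.≼-antisym (p≼1 e₁) (≼-down 1≼p))
           in k (ι y , (y , refl) , ◁-resp refl ι-1 (◁-up y≺1) ,
                 trans (evalAux-cong (suc r) {P} {ι ∘ p} (λ e → sym (p≈ e)) (λ i → sym (ι-∂^ (toℕ i) y)))
                   (trans (sym (ι-eval (suc r) p (λ i → K.∂^ (toℕ i) y))) (trans (ι-cong ev) ι-0))) }
    ; exp-int = λ { (k , e) κ → let z , z≉0 , ez = expi k in
        κ (ι z , (z , refl) , ι-≉0 z≉0 , trans (*-cong (sym (ι-∂ z)) (sym (ι-inv z≉0))) (trans (sym (ι-* _ _)) (trans (ι-cong ez) e))) }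
    ; root = λ { n (k , e) x≉0 κ → let z , z≉0 , ez = K.root-≍ div k (nz x≉0 e) n
                                       ex = ι-pow z (suc n) in
        κ (ι z , (z , refl) , ι-≉0 z≉0 ,
           (⊴-resp ex e (≼⇒⊴ (≼-up (K.≍⇒≼ ez))) , ⊴-resp e ex (≼⇒⊴ (≼-up (K.≍⇒≽ ez))))) }
    ; residue = λ q κ → un⊴ q λ le → let x , _ , q' = same _ le in κ (ι x , (x , refl) , ≺⇒◁ q')
    }
    where
    nz : ∀ {k x} → ¬ (x ≈ 0#) → ι k ≈ x → ¬ (k K.≈ K.0#)
    nz n e z = n (trans (sym e) (trans (ι-cong z) ι-0))

theorem5p3 : ∀ {c ℓ g gℓ c' ℓ' g' gℓ' : Level}
    (K : ValuedDifferentialField c ℓ g gℓ) →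
    ValuedDifferentialField.DifferentialHenselian K →
    ValuedDifferentialField.HAsymptotic K →
    ValuedDifferentialField.ExponentialIntegration K →
    ValuedDifferentialField.Max0 K →
    ValuedDifferentialField.DivisibleValueGroup K →
    (L : ValuedDifferentialField c' ℓ' g' gℓ') →
    ValuedDifferentialField.HAsymptotic L →
    ValuedDifferentialField.Max0 L →
    (E : Extension K L) →
    Extension.Proper E →
    Extension.DifferentiallyAlgebraic E →
    Extension.SameResidueField E →
    ⊥
theorem5p3 K dh _ expi _ div L hasy max0 E (y , y∉) dalg same =
  Independence.everything-in-𝒦 L hasy max0 (ground dh expi div same)
    (λ y → let r , d , P , (e , nz) , ev = dalg y in
      r , d , Extension.ι E ∘ P , (λ e → P e , ValuedDifferentialField.refl L) , (e , ι-≉0 nz) , ev)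
    y (λ { x (k , e) q → y∉ k (ValuedDifferentialField.trans L e q) })
  where open Embedding K L E hasy max0
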